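{- Let $v=pq$ or $v=p^n$, where $p,q$ are primes and $n\ge 1$. Then any two balanced cyclic configurations with point set $\mathbb{Z}_v$ are isomorphic if and only if they are multiplier equivalent.
   Context: A configuration of type $(v_k)$ (balanced configuration) is a pair $(P,\mathcal{B})$ with $|P|=|\mathcal{B}|=v$, lines being subsets of $P$, any two distinct lines meeting in at most one point, every line containing exactly $k\ge 3$ points and every point lying on exactly $k$ lines. An isomorphism is a bijection of point sets mapping lines onto lines. A balanced cyclic configuration on $\mathbb{Z}_v$ is such a configuration with point set $\mathbb{Z}_v$ for which the translation $x\mapsto x+1$ is an automorphism. Two such configurations are multiplier equivalent if there is a unit $a\in\mathbb{Z}_v^*$ such that $x\mapsto ax$ is an isomorphism between them. -}

module Defs where

open import Data.Nat using (ℕ; suc; _+_; _*_; _^_; _≤_; NonZero)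
open import Data.Nat.DivMod using (_mod_)
open import Data.Nat.Coprimality using (Coprime)
open import Data.Fin using (Fin; toℕ)
open import Data.Fin.Subset using (Subset; _∩_; ∣_∣) renaming (_∈_ to _∈ₛ_)
open import Data.Fin.Subset.Properties using () renaming (_∈?_ to _∈ₛ?_)
open import Data.List using (List; length; filter)
open import Data.List.Membership.Propositional using () renaming (_∈_ to _∈ₗ_)
open import Data.List.Relation.Unary.Unique.Propositional using (Unique)
open import Data.Product using (Σ; ∃; _×_)
open import Function.Definitions using (Bijective)
open import Relation.Binary.PropositionalEquality using (_≡_; _≢_)
open import Function.Bundles using (_⇔_)

-- Points are Z_v = Fin v; a line is a subset of Fin v; the line set
-- is a duplicate-free list of subsets (so |B| = length of the list).
record Config (v : ℕ) : Set where
  field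
    k          : ℕ
    k≥3        : 3 ≤ k
    lines      : List (Subset v)
    distinct   : Unique lines
    numLines   : length lines ≡ v
    lineSize   : ∀ {ℓ} → ℓ ∈ₗ lines → ∣ ℓ ∣ ≡ k
    pointDeg   : ∀ (x : Fin v) → length (filter (x ∈ₛ?_) lines) ≡ k
    meetAtMost1 : ∀ {ℓ₁ ℓ₂} → ℓ₁ ∈ₗ lines → ℓ₂ ∈ₗ lines → ℓ₁ ≢ ℓ₂ → ∣ ℓ₁ ∩ ℓ₂ ∣ ≤ 1

open Config public

IsImage : ∀ {v} → (Fin v → Fin v) → Subset v → Subset v → Set
IsImage {v} f ℓ ℓ' = ∀ (y : Fin v) → (y ∈ₛ ℓ') ⇔ (∃ λ x → x ∈ₛ ℓ × f x ≡ y)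

IsIsoMap : ∀ {v} → Config v → Config v → (Fin v → Fin v) → Set
IsIsoMap C₁ C₂ f =
  Bijective _≡_ _≡_ f
  × (∀ {ℓ} → ℓ ∈ₗ lines C₁ → ∃ λ ℓ' → ℓ' ∈ₗ lines C₂ × IsImage f ℓ ℓ')
  × (∀ {ℓ'} → ℓ' ∈ₗ lines C₂ → ∃ λ ℓ → ℓ ∈ₗ lines C₁ × IsImage f ℓ ℓ')

Isomorphic : ∀ {v} → Config v → Config v → Set
Isomorphic C₁ C₂ = ∃ λ f → IsIsoMap C₁ C₂ f

shift : ∀ {v} .{{_ : NonZero v}} → Fin v → Fin v
shift {v} x = (toℕ x + 1) mod v

mulBy : ∀ {v} .{{_ : NonZero v}} → Fin v → Fin v → Fin v
mulBy {v} a x = (toℕ a * toℕ x) mod v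

IsCyclic : ∀ {v} .{{_ : NonZero v}} → Config v → Set
IsCyclic C = IsIsoMap C C shift

MultiplierEquivalent : ∀ {v} .{{_ : NonZero v}} → Config v → Config v → Set
MultiplierEquivalent {v} C₁ C₂ =
  ∃ λ (a : Fin v) → Coprime (toℕ a) v × IsIsoMap C₁ C₂ (mulBy a)

{-# OPTIONS --safe #-}
module Submission where

-- All lines are translates of one base line: a line through 0 with a nontrivial translational symmetry contains the
-- subgroup of order p or q, so of three lines through 0 one has none, and its v translates are all the lines.
-- That base line S is a Sidon set (differences of distinct elements are distinct).
--
-- Given an isomorphism f from the development of S to that of T, we look for g in the automorphism group G of the
-- former such that f ∘ g is affine. If ρ ∈ N ≤ G has order a power of a prime r and fixes only the coset N of G / N, then
-- |G / N| ≡ 1 mod r, so every σ ∈ G of order a power of r is conjugate into N. For v = pⁿ take ρ = translation by 1,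
-- σ = f⁻¹ ρ f and N the affine automorphisms: ρ fixes only N because an affine automorphism x ↦ u x + j which is a
-- v-cycle has u ≡ 1 mod p (mod 4 if p = 2), and a multiplier u ≠ 1 of this kind would produce an arithmetic progression
-- in S, unless S is constant modulo p. For v = p q with p < q the same is done first with the translation by p,
-- where N is the normaliser of the subgroup of order q (an automorphism rotating the cosets of that subgroup
-- independently would give q lines through a point, too many differences for a Sidon set), and then with the
-- translation by q inside that normaliser. If S and T are constant modulo p, one divides by p.

-- For cyclic structures in general, isomorphism does not imply multiplier equivalence, so
-- everything rests on the Sidon property. It is used in three forms: no nonzero translation fixes
-- S, S contains no three-term progression, and for v = p q with p < q it has fewer than q elements.
-- That ρ fixes only the coset N is phrased as follows: if `conjugate h r` normalises the
-- translation by m, so does h. This is proved for isomorphisms h onto an arbitrary development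
-- because it serves twice: for automorphisms of S it feeds the fixed-point count, and for f ∘ g it
-- turns the conjugacy found there into a statement on f ∘ g itself. In each instance the
-- pulled-back translation is affine at least on cosets, its slope is forced to be 1, and h then
-- intertwines two translations. A base line constant modulo p gives a disconnected configuration
-- whose components can be rotated independently, so its automorphism group is far from affine;
-- hence the division. It goes on until S or T has two elements not congruent modulo the prime in
-- question; as f can be inverted, one of the two suffices.

open import Defs hiding (k; distinct)
open import Algebra.Bundles using (CommutativeRing; Group)
import Algebra.Properties.Group as GroupProperties
import Algebra.Properties.Ring as RingProperties
import Algebra.Solver.Ring as RingSolver
open import Algebra.Solver.Ring.AlmostCommutativeRing using (Induced-equivalence; _-Raw-AlmostCommutative⟶_; fromCommutativeRing)
open import Algebra.Structures using (IsCommutativeRing)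
open import Data.Bool using (Bool; false; true)
import Data.Bool.Properties as Boolₚ
open import Data.Empty using (⊥; ⊥-elim)
open import Data.Fin using (Fin; combine; finToFun; funToFin; punchIn; remQuot; suc; toℕ; zero)
import Data.Fin.Properties as Finₚ
open import Data.Fin.Properties using (toℕ-fromℕ<; toℕ-injective; toℕ<n)
open import Data.Fin.Subset using (Subset; _-_; ⁅_⁆) renaming (_∈_ to _∈ₛ_; ∣_∣ to card)
open import Data.Fin.Subset.Properties using (p⊆q⇒∣p∣≤∣q∣; x∈p⇒∣p-x∣<∣p∣; x∈p∧x≢y⇒x∈p-y; x∈p∩q⁺; x∈⁅x⁆; x∈⁅y⁆⇒x≡y; ∣⁅x⁆∣≡1) renaming (_∈?_ to _∈ₛ?_)
import Data.Integer as ℤ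
open import Data.Integer using (-[1+_]; ℤ) renaming (+_ to pos)
import Data.Integer.Properties as ℤₚ
import Data.List as List
open import Data.List using (List; []; _++_; _∷_; allFin; applyUpTo; concatMap; filter; length; map)
open import Data.List.Membership.Propositional using (_∈_; _∉_; find; lose)
open import Data.List.Membership.Propositional.Properties using (∈-++⁺ʳ; ∈-++⁻; ∈-allFin; ∈-applyUpTo⁺; ∈-applyUpTo⁻; ∈-filter⁺; ∈-filter⁻; ∈-∃++)
open import Data.List.Properties using (length-++; length-applyUpTo)
open import Data.List.Relation.Binary.Permutation.Propositional using (_↭_; prep; ↭-refl; ↭-sym; ↭-trans; ↭⇒↭ₛ)
open import Data.List.Relation.Binary.Permutation.Propositional.Properties using (↭-length; ∈-resp-↭) renaming (shift to ↭-shift)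
import Data.List.Relation.Binary.Permutation.Setoid.Properties as SetoidPermutation
import Data.List.Relation.Unary.All as All
open import Data.List.Relation.Unary.All using (All; []; _∷_)
open import Data.List.Relation.Unary.AllPairs using ([]; _∷_)
import Data.List.Relation.Unary.Any as Any
open import Data.List.Relation.Unary.Any using (Any; here; there)
import Data.List.Relation.Unary.Any.Properties as Anyₚ
open import Data.List.Relation.Unary.Unique.Propositional using (Unique)
import Data.List.Relation.Unary.Unique.Propositional.Properties as Uniqueₚ
import Data.Maybe as Maybe
open import Data.Nat using (>-nonZero; >-nonZero⁻¹; NonZero; _*_; _+_; _<_; _^_; _∸_; _≤_; _≥_; suc; s≤s; zero; ℕ)
import Data.Nat.Coprimality as Coprimality
open import Data.Nat.Coprimality using (Coprime; coprime-Bézout; coprime-divisor; coprime⇒gcd≡1; prime⇒coprime)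
open import Data.Nat.DivMod using (_%_; _/_; _mod_; m≡m%n+[m/n]*n; m%n<n; m<n⇒m%n≡m; n%n≡0; m*n%n≡0; %-distribˡ-+; %-distribˡ-*; %-remove-+ʳ; m∣n⇒o%n%m≡o%m)
open import Data.Nat.Divisibility using (_∣_; divides; quotient; ∣-refl; ∣-trans; ∣⇒≤; ∣1⇒≡1; _∣0; _∣?_; m∣m*n; n∣m*n; ∣m⇒∣m*n; ∣n⇒∣m*n; ∣m∣n⇒∣m+n; ∣m+n∣m⇒∣n; *-monoʳ-∣; *-cancelˡ-∣; n∣m⇒m%n≡0; %-presˡ-∣)
open import Data.Nat.GCD using (gcd; gcd-GCD; gcd[m,n]∣m; gcd[m,n]∣n; module Bézout)
open import Data.Nat.GeneralisedArithmetic using (fold; fold-+)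
open import Data.Nat.Primality using (Prime; euclidsLemma; prime[2]; prime⇒irreducible; prime⇒nonZero; ¬prime[1])
import Data.Nat.Properties as ℕₚ
open import Data.Product using (_,_; _×_; proj₁; proj₂; ∃)
open import Data.Sum using (_⊎_; inj₁; inj₂)
open import Data.Vec using (lookup)
open import Data.Vec.Properties using ([]=⇒lookup; lookup⇒[]=)
open import Function using (_∘_)
open import Function.Bundles using (Equivalence; _⇔_; mk⇔)
open import Level using (0ℓ)
open import Relation.Binary.Definitions using (DecidableEquality; WeaklyDecidable; tri<; tri>; tri≈)
open import Relation.Binary.PropositionalEquality using (_≡_; _≢_; refl; sym; trans; cong; cong₂; subst; subst₂; setoid; isEquivalence; module ≡-Reasoning)
open import Relation.Nullary using (Dec; _×-dec_; _→-dec_; contradiction; no; yes; ¬?; ¬_)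
open import Relation.Nullary.Decidable using (decidable-stable; dec⇒maybe; map′)
open import Relation.Unary using (Decidable; Pred)

-- Arithmetic modulo v

module ZMod (v : ℕ) .{{_ : NonZero v}} where

  infixl 6 _⊕_ _⊝_
  infixl 7 _⊗_
  infix 8 ⊖_

  opaque

    [_] : ℕ → Fin v
    [ m ] = m mod v

    _⊕_ _⊗_ : Fin v → Fin v → Fin v
    x ⊕ y = [ toℕ x + toℕ y ]
    x ⊗ y = [ toℕ x * toℕ y ]

    ⊖_ : Fin v → Fin v
    ⊖ x = [ v ∸ toℕ x ]

    toℕ-[] : ∀ m → toℕ [ m ] ≡ m % v
    toℕ-[] m = toℕ-fromℕ< (m%n<n m v)

    -- `shift` and `mulBy` are written with `mod`; the equations that tie them to the opaque
    -- operations must be recorded here, where those still unfold.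
    []-mod : ∀ m → m mod v ≡ [ m ]
    []-mod m = refl

    ⊗-mod : ∀ x y → (toℕ x * toℕ y) mod v ≡ x ⊗ y
    ⊗-mod x y = refl

  []-cong : ∀ {m n} → m % v ≡ n % v → [ m ] ≡ [ n ]
  []-cong {m} {n} e = toℕ-injective (trans (toℕ-[] m) (trans e (sym (toℕ-[] n))))

  []-toℕ : ∀ x → [ toℕ x ] ≡ x
  []-toℕ x = toℕ-injective (trans (toℕ-[] (toℕ x)) (m<n⇒m%n≡m (toℕ<n x)))

  opaque
    unfolding [_]

    []-+ : ∀ m n → [ m + n ] ≡ [ m ] ⊕ [ n ]
    []-+ m n = []-cong (trans (%-distribˡ-+ m n v)
      (sym (cong₂ (λ a b → (a + b) % v) (toℕ-[] m) (toℕ-[] n))))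

    []-* : ∀ m n → [ m * n ] ≡ [ m ] ⊗ [ n ]
    []-* m n = []-cong (trans (%-distribˡ-* m n v)
      (sym (cong₂ (λ a b → (a * b) % v) (toℕ-[] m) (toℕ-[] n))))

    ⊖-inverseˡ : ∀ x → ⊖ x ⊕ x ≡ [ 0 ]
    ⊖-inverseˡ x = begin
      ⊖ x ⊕ x                     ≡⟨ cong (⊖ x ⊕_) (sym ([]-toℕ x)) ⟩
      ⊖ x ⊕ [ toℕ x ]             ≡⟨ sym ([]-+ (v ∸ toℕ x) (toℕ x)) ⟩
      [ v ∸ toℕ x + toℕ x ]       ≡⟨ cong [_] (ℕₚ.m∸n+n≡m (ℕₚ.<⇒≤ (toℕ<n x))) ⟩
      [ v ]                       ≡⟨ []-cong (trans (n%n≡0 v) (sym (0%v≡0))) ⟩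
      [ 0 ]                       ∎
      where
      open ≡-Reasoning
      0%v≡0 : 0 % v ≡ 0
      0%v≡0 = m*n%n≡0 0 v

  private
    -- Every residue has the form `[ m ]`, so the ring laws are inherited from ℕ through `[]-+` and
    -- `[]-*`.
    lift₁ : ∀ {P : Fin v → Set} → (∀ m → P [ m ]) → ∀ x → P x
    lift₁ {P} h x = subst P ([]-toℕ x) (h (toℕ x))

  ⊕-comm : ∀ x y → x ⊕ y ≡ y ⊕ x
  ⊕-comm = lift₁ λ m → lift₁ λ n →
    trans (sym ([]-+ m n)) (trans (cong [_] (ℕₚ.+-comm m n)) ([]-+ n m))

  ⊗-comm : ∀ x y → x ⊗ y ≡ y ⊗ x
  ⊗-comm = lift₁ λ m → lift₁ λ n →
    trans (sym ([]-* m n)) (trans (cong [_] (ℕₚ.*-comm m n)) ([]-* n m))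

  ⊕-assoc : ∀ x y z → (x ⊕ y) ⊕ z ≡ x ⊕ (y ⊕ z)
  ⊕-assoc = lift₁ λ m → lift₁ λ n → lift₁ λ o →
    trans (trans (cong (_⊕ [ o ]) (sym ([]-+ m n))) (sym ([]-+ (m + n) o)))
    (trans (cong [_] (ℕₚ.+-assoc m n o))
    (trans ([]-+ m (n + o)) (cong ([ m ] ⊕_) ([]-+ n o))))

  ⊗-assoc : ∀ x y z → (x ⊗ y) ⊗ z ≡ x ⊗ (y ⊗ z)
  ⊗-assoc = lift₁ λ m → lift₁ λ n → lift₁ λ o →
    trans (trans (cong (_⊗ [ o ]) (sym ([]-* m n))) (sym ([]-* (m * n) o)))
    (trans (cong [_] (ℕₚ.*-assoc m n o))
    (trans ([]-* m (n * o)) (cong ([ m ] ⊗_) ([]-* n o))))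

  ⊕-identityˡ : ∀ x → [ 0 ] ⊕ x ≡ x
  ⊕-identityˡ = lift₁ λ m → sym ([]-+ 0 m)

  ⊗-identityˡ : ∀ x → [ 1 ] ⊗ x ≡ x
  ⊗-identityˡ = lift₁ λ m → trans (sym ([]-* 1 m)) (cong [_] (ℕₚ.*-identityˡ m))

  ⊗-distribˡ-⊕ : ∀ x y z → x ⊗ (y ⊕ z) ≡ x ⊗ y ⊕ x ⊗ z
  ⊗-distribˡ-⊕ = lift₁ λ m → lift₁ λ n → lift₁ λ o →
    trans (trans (cong ([ m ] ⊗_) (sym ([]-+ n o))) (sym ([]-* m (n + o))))
    (trans (cong [_] (ℕₚ.*-distribˡ-+ m n o))
    (trans ([]-+ (m * n) (m * o)) (cong₂ _⊕_ ([]-* m n) ([]-* m o))))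

  isCommutativeRing : IsCommutativeRing _≡_ _⊕_ _⊗_ ⊖_ [ 0 ] [ 1 ]
  isCommutativeRing = record
    { isRing = record
      { +-isAbelianGroup = record
        { isGroup = record
          { isMonoid = record
            { isSemigroup = record
              { isMagma = record { isEquivalence = isEquivalence ; ∙-cong = cong₂ _⊕_ }
              ; assoc = ⊕-assoc }
            ; identity = ⊕-identityˡ , λ x → trans (⊕-comm x [ 0 ]) (⊕-identityˡ x) }
          ; inverse = ⊖-inverseˡ , λ x → trans (⊕-comm x (⊖ x)) (⊖-inverseˡ x)
          ; ⁻¹-cong = cong ⊖_ }
        ; comm = ⊕-comm }
      ; *-cong = cong₂ _⊗_
      ; *-assoc = ⊗-assoc
      ; *-identity = ⊗-identityˡ , λ x → trans (⊗-comm x [ 1 ]) (⊗-identityˡ x)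
      ; distrib = ⊗-distribˡ-⊕ , λ x y z → trans (⊗-comm (y ⊕ z) x)
          (trans (⊗-distribˡ-⊕ x y z) (cong₂ _⊕_ (⊗-comm x y) (⊗-comm x z))) }
    ; *-comm = ⊗-comm }

  commutativeRing : CommutativeRing 0ℓ 0ℓ
  commutativeRing = record { isCommutativeRing = isCommutativeRing }

  _⊝_ : Fin v → Fin v → Fin v
  x ⊝ y = x ⊕ ⊖ y

  fromℤ : ℤ → Fin v
  fromℤ (pos m)    = [ m ]
  fromℤ -[1+ m ] = ⊖ [ suc m ]

  private
    open RingProperties (CommutativeRing.ring commutativeRing)

    fromℤ-neg : ∀ i → fromℤ (ℤ.- i) ≡ ⊖ fromℤ i
    fromℤ-neg (pos zero)   = sym (-0#≈0#)
    fromℤ-neg (pos (suc m))  = refl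
    fromℤ-neg -[1+ m ]   = sym (-‿involutive _)

    [suc] : ∀ m → [ suc m ] ≡ [ 1 ] ⊕ [ m ]
    [suc] m = []-+ 1 m

    fromℤ-⊖ : ∀ m n → fromℤ (m ℤ.⊖ n) ≡ [ m ] ⊝ [ n ]
    fromℤ-⊖ m zero = begin
      [ m ]              ≡⟨ sym (⊕-identityˡ [ m ]) ⟩
      [ 0 ] ⊕ [ m ]      ≡⟨ ⊕-comm [ 0 ] [ m ] ⟩
      [ m ] ⊕ [ 0 ]      ≡⟨ cong ([ m ] ⊕_) (sym -0#≈0#) ⟩
      [ m ] ⊝ [ 0 ]      ∎
      where open ≡-Reasoning
    fromℤ-⊖ zero (suc n) = sym (⊕-identityˡ _)
    fromℤ-⊖ (suc m) (suc n) = begin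
      fromℤ (suc m ℤ.⊖ suc n)          ≡⟨ cong fromℤ (ℤₚ.[1+m]⊖[1+n]≡m⊖n m n) ⟩
      fromℤ (m ℤ.⊖ n)                  ≡⟨ fromℤ-⊖ m n ⟩
      [ m ] ⊝ [ n ]                    ≡⟨ sym (xyx⁻¹≈y [ 1 ] ([ m ] ⊝ [ n ])) ⟩
      [ 1 ] ⊕ ([ m ] ⊝ [ n ]) ⊝ [ 1 ]  ≡⟨ cong (_⊝ [ 1 ]) (sym (⊕-assoc [ 1 ] [ m ] (⊖ [ n ]))) ⟩
      [ 1 ] ⊕ [ m ] ⊝ [ n ] ⊝ [ 1 ]    ≡⟨ ⊕-assoc ([ 1 ] ⊕ [ m ]) (⊖ [ n ]) (⊖ [ 1 ]) ⟩
      [ 1 ] ⊕ [ m ] ⊕ (⊖ [ n ] ⊝ [ 1 ]) ≡⟨ cong₂ _⊕_ (sym ([suc] m)) (trans (⊕-comm _ _) (trans (-‿+-comm [ 1 ] [ n ]) (cong ⊖_ (sym ([suc] n))))) ⟩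
      [ suc m ] ⊝ [ suc n ]            ∎
      where open ≡-Reasoning

    fromℤ-+ : ∀ i j → fromℤ (i ℤ.+ j) ≡ fromℤ i ⊕ fromℤ j
    fromℤ-+ (pos m) (pos n) = []-+ m n
    fromℤ-+ (pos m) -[1+ n ] = fromℤ-⊖ m (suc n)
    fromℤ-+ -[1+ m ] (pos n) = trans (fromℤ-⊖ n (suc m)) (⊕-comm _ _)
    fromℤ-+ -[1+ m ] -[1+ n ] = trans
      (cong ⊖_ (trans (cong [_] (cong suc (sym (ℕₚ.+-suc m n)))) ([]-+ (suc m) (suc n))))
      (sym (-‿+-comm [ suc m ] [ suc n ]))

    fromℤ-pos-* : ∀ m j → fromℤ (pos m ℤ.* j) ≡ [ m ] ⊗ fromℤ j
    fromℤ-pos-* m (pos n) = trans (cong fromℤ (sym (ℤₚ.pos-* m n))) ([]-* m n)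
    fromℤ-pos-* m -[1+ n ] = begin
      fromℤ (pos m ℤ.* -[1+ n ])          ≡⟨ cong fromℤ (sym (ℤₚ.neg-distribʳ-* (pos m) (pos (suc n)))) ⟩
      fromℤ (ℤ.- (pos m ℤ.* pos (suc n)))     ≡⟨ fromℤ-neg (pos m ℤ.* pos (suc n)) ⟩
      ⊖ fromℤ (pos m ℤ.* pos (suc n))         ≡⟨ cong ⊖_ (fromℤ-pos-* m (pos (suc n))) ⟩
      ⊖ ([ m ] ⊗ [ suc n ])             ≡⟨ -‿distribʳ-* [ m ] [ suc n ] ⟩
      [ m ] ⊗ ⊖ [ suc n ]               ∎
      where open ≡-Reasoning

    fromℤ-* : ∀ i j → fromℤ (i ℤ.* j) ≡ fromℤ i ⊗ fromℤ j
    fromℤ-* (pos m) j = fromℤ-pos-* m j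
    fromℤ-* -[1+ m ] j = begin
      fromℤ (-[1+ m ] ℤ.* j)            ≡⟨ cong fromℤ (sym (ℤₚ.neg-distribˡ-* (pos (suc m)) j)) ⟩
      fromℤ (ℤ.- (pos (suc m) ℤ.* j))       ≡⟨ fromℤ-neg (pos (suc m) ℤ.* j) ⟩
      ⊖ fromℤ (pos (suc m) ℤ.* j)           ≡⟨ cong ⊖_ (fromℤ-pos-* (suc m) j) ⟩
      ⊖ ([ suc m ] ⊗ fromℤ j)           ≡⟨ -‿distribˡ-* [ suc m ] (fromℤ j) ⟩
      ⊖ [ suc m ] ⊗ fromℤ j             ∎
      where open ≡-Reasoning

  -- Integer coefficients, since arithmetic in Fin v does not compute for a variable v.
  private
    coefficients : ℤ.+-*-rawRing -Raw-AlmostCommutative⟶ fromCommutativeRing commutativeRing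
    coefficients = record { ⟦_⟧ = fromℤ ; +-homo = fromℤ-+ ; *-homo = fromℤ-* ; -‿homo = fromℤ-neg
                          ; 0-homo = refl ; 1-homo = refl }

    coefficients≟ : WeaklyDecidable (Induced-equivalence coefficients)
    coefficients≟ i j = Maybe.map (cong fromℤ) (dec⇒maybe (i ℤₚ.≟ j))

  open RingSolver ℤ.+-*-rawRing (fromCommutativeRing commutativeRing) coefficients coefficients≟ public
    using (Polynomial; solve; _:=_; _:+_; _:*_; _:-_; :-_; con)

  :0 :1 : ∀ {n} → Polynomial n
  :0 = con (pos 0)
  :1 = con (pos 1)

-- Permutations of prime-power order and conjugation in finite groups

import Relation.Binary.Reasoning.Setoid as SetoidReasoning

module _ {A : Set} (f : A → A) where

  fold-shift : ∀ x n → fold (f x) f n ≡ f (fold x f n)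
  fold-shift x zero    = refl
  fold-shift x (suc n) = cong f (fold-shift x n)

  fold-comm : ∀ x m n → fold (fold x f m) f n ≡ fold (fold x f n) f m
  fold-comm x m n = trans (sym (fold-+ x f n)) (trans (cong (fold x f) (ℕₚ.+-comm n m)) (fold-+ x f m))

  fold-period : ∀ x n → fold x f n ≡ x → ∀ k → fold x f (k * n) ≡ x
  fold-period x n e zero    = refl
  fold-period x n e (suc k) =
    trans (fold-+ x f n) (trans (cong (λ y → fold y f n) (fold-period x n e k)) e)

  fold-fold : ∀ x m n → fold x (λ y → fold y f m) n ≡ fold x f (n * m)
  fold-fold x m zero    = refl
  fold-fold x m (suc n) = trans (cong (λ y → fold y f m) (fold-fold x m n)) (sym (fold-+ x f m))

  -- The orbit stops moving after one step. Combined with a period this shows that x itself is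
  -- fixed.
  fold-absorb : ∀ {x n} → f (f x) ≡ f x → .(NonZero n) → fold x f n ≡ f x
  fold-absorb {x} {suc zero}    e _ = refl
  fold-absorb {x} {suc (suc n)} e _ = trans (cong f (fold-absorb {x} {suc n} e _)) e

  -- By Bézout a multiple of one period exceeds a multiple of the other by one, and both bring x
  -- back.
  coprime-periods : ∀ {x m n} → Coprime m n → fold x f m ≡ x → fold x f n ≡ x → f x ≡ x
  coprime-periods {x} {m} {n} c em en with coprime-Bézout c
  ... | Bézout.+- a b eq = trans (cong f (sym (fold-period x n en b)))
                             (trans (cong (fold x f) eq) (fold-period x m em a))
  ... | Bézout.-+ a b eq = trans (cong f (sym (fold-period x m em a)))
                             (trans (cong (fold x f) eq) (fold-period x n en b))

  -- A coincidence makes j - i a period. It lies strictly between 0 and p, hence is coprime to p,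
  -- and `coprime-periods` would fix x.
  prime-period-<-distinct : ∀ {p x} → Prime p → fold x f p ≡ x → f x ≢ x →
                            ∀ {i j} → i < j → j < p → fold x f i ≢ fold x f j
  prime-period-<-distinct {p} {x} pr ep fx≢x {i} {j} i<j j<p e =
    fx≢x (coprime-periods (prime⇒coprime pr {{>-nonZero 0<d}} d<p) ep ed)
    where
    open ≡-Reasoning
    d = j ∸ i
    0<d : 0 < d
    0<d = ℕₚ.m<n⇒0<n∸m i<j
    d<p : d < p
    d<p = ℕₚ.≤-<-trans (ℕₚ.m∸n≤m j i) j<p
    i≤p = ℕₚ.<⇒≤ (ℕₚ.<-trans i<j j<p)
    back : fold (fold x f i) f (p ∸ i) ≡ x
    back = trans (sym (fold-+ x f (p ∸ i))) (trans (cong (fold x f) (ℕₚ.m∸n+n≡m i≤p)) ep)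
    ed : fold x f d ≡ x
    ed = begin
      fold x f d                                   ≡⟨ cong (λ y → fold y f d) (sym back) ⟩
      fold (fold (fold x f i) f (p ∸ i)) f d       ≡⟨ fold-comm (fold x f i) (p ∸ i) d ⟩
      fold (fold (fold x f i) f d) f (p ∸ i)       ≡⟨ cong (λ y → fold y f (p ∸ i)) (sym (fold-+ x f d)) ⟩
      fold (fold x f (d + i)) f (p ∸ i)            ≡⟨ cong (λ k → fold (fold x f k) f (p ∸ i)) (ℕₚ.m∸n+n≡m (ℕₚ.<⇒≤ i<j)) ⟩
      fold (fold x f j) f (p ∸ i)                  ≡⟨ cong (λ y → fold y f (p ∸ i)) (sym e) ⟩
      fold (fold x f i) f (p ∸ i)                  ≡⟨ back ⟩
      x                                            ∎

module _ {A : Set} where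

  Unique-resp-↭ : {xs ys : List A} → xs ↭ ys → Unique xs → Unique ys
  Unique-resp-↭ = SetoidPermutation.Unique-resp-↭ (setoid A) ∘ ↭⇒↭ₛ

  Unique-++⁻-disjoint : ∀ (xs : List A) {ys x} → Unique (xs ++ ys) → x ∈ xs → x ∉ ys
  Unique-++⁻-disjoint (x ∷ xs) (x∉ ∷ u) (here refl) x∈ys = All.lookup x∉ (∈-++⁺ʳ xs x∈ys) refl
  Unique-++⁻-disjoint (x ∷ xs) (x∉ ∷ u) (there x∈)  x∈ys = Unique-++⁻-disjoint xs u x∈ x∈ys

  Unique-++⁻ʳ : ∀ (xs : List A) {ys} → Unique (xs ++ ys) → Unique ys
  Unique-++⁻ʳ []       u       = u
  Unique-++⁻ʳ (x ∷ xs) (_ ∷ u) = Unique-++⁻ʳ xs u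

  Unique-⊆⇒↭ : ∀ {xs : List A} ys → Unique ys → (∀ {x} → x ∈ ys → x ∈ xs) → ∃ λ zs → xs ↭ ys ++ zs
  Unique-⊆⇒↭ {xs} [] _ _ = xs , ↭-refl
  Unique-⊆⇒↭ (y ∷ ys) (y∉ ∷ u) sub with ∈-∃++ (sub (here refl))
  ... | as , bs , refl with Unique-⊆⇒↭ ys u sub′
    where
    sub′ : ∀ {x} → x ∈ ys → x ∈ as ++ bs
    sub′ x∈ with ∈-resp-↭ (↭-shift y as bs) (sub (there x∈))
    ... | here refl = contradiction refl (All.lookup y∉ x∈)
    ... | there x∈′ = x∈′
  ...   | zs , q = zs , ↭-trans (↭-shift y as bs) (prep y q)

  length-filter-complement : ∀ {P : Pred A 0ℓ} (P? : Decidable P) xs →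
    length xs ≡ length (filter P? xs) + length (filter (¬? ∘ P?) xs)
  length-filter-complement P? [] = refl
  length-filter-complement P? (x ∷ xs) with P? x
  ... | yes _ = cong suc (length-filter-complement P? xs)
  ... | no  _ = trans (cong suc (length-filter-complement P? xs)) (sym (ℕₚ.+-suc _ _))

module _ {A : Set} (_≟_ : DecidableEquality A) {p} (pr : Prime p) where

  private
    -- Removes the orbit of the head, which has exactly p elements, and continues with the rest. The
    -- bound n makes the recursion structural.
    p∣length-≤ : ∀ n (f : A → A) (xs : List A) → length xs ≤ n → Unique xs →
      (∀ {x} → x ∈ xs → f x ∈ xs) → (∀ {x} → x ∈ xs → fold x f p ≡ x) →
      (∀ {x} → x ∈ xs → f x ≢ x) → p ∣ length xs
    p∣length-≤ n f [] _ _ _ _ _ = p ∣0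
    p∣length-≤ (suc n) f xs@(x ∷ _) (s≤s le) u closed per nofix
      with Unique-⊆⇒↭ orbit orbit-unique orbit⊆xs
      where
      orbit = applyUpTo (fold x f) p
      orbit-unique : Unique orbit
      orbit-unique = Uniqueₚ.applyUpTo⁺₁ (fold x f) p
        (prime-period-<-distinct f pr (per (here refl)) (nofix (here refl)))
      fold∈xs : ∀ i → fold x f i ∈ xs
      fold∈xs zero    = here refl
      fold∈xs (suc i) = closed (fold∈xs i)
      orbit⊆xs : ∀ {y} → y ∈ orbit → y ∈ xs
      orbit⊆xs y∈ with ∈-applyUpTo⁻ (fold x f) y∈
      ... | i , _ , refl = fold∈xs i
    ... | rest , xs↭ = subst (p ∣_) (sym (↭-length xs↭)) (subst (p ∣_) (sym (length-++ orbit))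
        (∣m∣n⇒∣m+n (subst (p ∣_) (sym orbit-length) ∣-refl)
          (p∣length-≤ n f rest rest≤n (Unique-++⁻ʳ orbit u′) closed′ (per ∘ up) (nofix ∘ up))))
      where
      orbit = applyUpTo (fold x f) p
      orbit-length : length orbit ≡ p
      orbit-length = length-applyUpTo (fold x f) p
      u′ : Unique (orbit ++ rest)
      u′ = Unique-resp-↭ xs↭ u
      up : ∀ {y} → y ∈ rest → y ∈ xs
      up y∈ = ∈-resp-↭ (↭-sym xs↭) (∈-++⁺ʳ orbit y∈)
      1≤p : 1 ≤ p
      1≤p = >-nonZero⁻¹ p {{prime⇒nonZero pr}}
      rest≤n : length rest ≤ n
      rest≤n = ℕₚ.≤-pred (ℕₚ.≤-trans (ℕₚ.+-monoˡ-≤ (length rest) (subst (1 ≤_) (sym orbit-length) 1≤p))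
        (ℕₚ.≤-trans (ℕₚ.≤-reflexive (trans (sym (length-++ orbit)) (sym (↭-length xs↭)))) (s≤s le)))
      -- The orbit is closed under preimages, since p - 1 further steps invert f on points of period
      -- p; so f never leads from `rest` into the orbit.
      preimage∈orbit : ∀ {y} → fold y f p ≡ y → f y ∈ orbit → y ∈ orbit
      preimage∈orbit {y} ey fy∈ with ∈-applyUpTo⁻ (fold x f) fy∈
      ... | zero , _ , fy≡x = subst (_∈ orbit) y≡ (∈-applyUpTo⁺ (fold x f) (ℕₚ.≤-reflexive p≡))
        where
        p≡ : suc (p ∸ 1) ≡ p
        p≡ = ℕₚ.m+[n∸m]≡n 1≤p
        y≡ : fold x f (p ∸ 1) ≡ y
        y≡ = trans (cong (λ z → fold z f (p ∸ 1)) (sym fy≡x))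
               (trans (fold-shift f y (p ∸ 1)) (trans (cong (fold y f) p≡) ey))
      ... | suc i , si<p , fy≡ = subst (_∈ orbit) y≡ (∈-applyUpTo⁺ (fold x f) (ℕₚ.<-trans (ℕₚ.n<1+n i) si<p))
        where
        inverse : ∀ z → fold z f p ≡ z → fold (f z) f (p ∸ 1) ≡ z
        inverse z ez = trans (fold-shift f z (p ∸ 1)) (trans (cong (fold z f) (ℕₚ.m+[n∸m]≡n 1≤p)) ez)
        y≡ : fold x f i ≡ y
        y≡ = trans (sym (inverse (fold x f i)
               (trans (fold-comm f x i p) (cong (λ z → fold z f i) (per (here refl))))))
               (trans (cong (λ z → fold z f (p ∸ 1)) (sym fy≡)) (inverse y ey))
      closed′ : ∀ {y} → y ∈ rest → f y ∈ rest
      closed′ {y} y∈ with ∈-++⁻ orbit (∈-resp-↭ xs↭ (closed (up y∈)))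
      ... | inj₂ fy∈rest  = fy∈rest
      ... | inj₁ fy∈orbit =
        contradiction y∈ (Unique-++⁻-disjoint orbit u′ (preimage∈orbit (per (up y∈)) fy∈orbit))

  -- Induction on e with g the p^e-th iterate of f: the points fixed by g satisfy the hypothesis for
  -- e, and on all others g has period p and no fixed point.
  p∣length-fixed-point-free : ∀ e (f : A → A) (xs : List A) → Unique xs →
    (∀ {x} → x ∈ xs → f x ∈ xs) → (∀ {x} → x ∈ xs → fold x f (p ^ e) ≡ x) →
    (∀ {x} → x ∈ xs → f x ≢ x) → p ∣ length xs
  p∣length-fixed-point-free zero f [] u closed per nofix = p ∣0
  p∣length-fixed-point-free zero f (x ∷ xs) u closed per nofix =
    contradiction (per (here refl)) (nofix (here refl))
  p∣length-fixed-point-free (suc e) f xs u closed per nofix =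
    subst (p ∣_) (sym (length-filter-complement Fix? xs)) (∣m∣n⇒∣m+n p∣fix p∣move)
    where
    g : A → A
    g x = fold x f (p ^ e)
    Fix? : Decidable (λ x → g x ≡ x)
    Fix? x = g x ≟ x
    fold∈xs : ∀ {x} → x ∈ xs → ∀ i → fold x f i ∈ xs
    fold∈xs x∈ zero    = x∈
    fold∈xs x∈ (suc i) = closed (fold∈xs x∈ i)
    per-g : ∀ {x} → x ∈ xs → fold x g p ≡ x
    per-g {x} x∈ = trans (fold-fold f x (p ^ e) p) (per x∈)
    p∣fix : p ∣ length (filter Fix? xs)
    p∣fix = p∣length-fixed-point-free e f _ (Uniqueₚ.filter⁺ Fix? u)
      (λ {x} x∈ → let x∈xs , gx≡x = ∈-filter⁻ Fix? x∈ in
        ∈-filter⁺ Fix? (closed x∈xs) (trans (fold-shift f x (p ^ e)) (cong f gx≡x)))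
      (λ x∈ → proj₂ (∈-filter⁻ Fix? {xs = xs} x∈))
      (λ x∈ → nofix (proj₁ (∈-filter⁻ Fix? x∈)))
    move : List A
    move = filter (¬? ∘ Fix?) xs
    p∣move : p ∣ length move
    p∣move = p∣length-≤ (length move) g move ℕₚ.≤-refl (Uniqueₚ.filter⁺ (¬? ∘ Fix?) u)
      -- g x must again be moved: were it fixed by g, all further iterates would equal g x, while
      -- the p-th one is x.
      (λ {x} x∈ → let x∈xs , gx≢x = ∈-filter⁻ (¬? ∘ Fix?) x∈ in
        ∈-filter⁺ (¬? ∘ Fix?) (fold∈xs x∈xs (p ^ e)) λ ggx≡gx →
          gx≢x (trans (sym (fold-absorb g ggx≡gx (prime⇒nonZero pr))) (per-g x∈xs)))
      (λ x∈ → per-g (proj₁ (∈-filter⁻ (¬? ∘ Fix?) x∈)))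
      (λ x∈ → proj₂ (∈-filter⁻ (¬? ∘ Fix?) {xs = xs} x∈))

  -- Since f moves everything except c, the length is 1 modulo p. Without a fixed point of g it
  -- would be 0 modulo p.
  fixed-points-mod-p : ∀ d e (f g : A → A) (xs : List A) → Unique xs →
    (∀ {x} → x ∈ xs → f x ∈ xs) → (∀ {x} → x ∈ xs → fold x f (p ^ d) ≡ x) →
    (∀ {x} → x ∈ xs → g x ∈ xs) → (∀ {x} → x ∈ xs → fold x g (p ^ e) ≡ x) →
    ∀ {c} → c ∈ xs → f c ≡ c → (∀ {x} → x ∈ xs → f x ≡ x → x ≡ c) →
    ∃ λ x → x ∈ xs × g x ≡ x
  fixed-points-mod-p d e f g xs u f-closed f-per g-closed g-per {c} c∈ fc uniq
    with Any.any? (λ x → g x ≟ x) xs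
  ... | yes a = find a
  ... | no ¬a with Unique-⊆⇒↭ (c ∷ []) ([] ∷ []) (λ { (here refl) → c∈ })
  ...   | rest , xs↭ with Unique-resp-↭ xs↭ u
  ...     | c∉rest ∷ u′ = contradiction (subst Prime (∣1⇒≡1 p∣1) pr) ¬prime[1]
    where
    up : ∀ {x} → x ∈ rest → x ∈ xs
    up x∈ = ∈-resp-↭ (↭-sym xs↭) (there x∈)
    p∣xs : p ∣ length xs
    p∣xs = p∣length-fixed-point-free e g xs u g-closed g-per (λ x∈ gx≡x → ¬a (lose x∈ gx≡x))
    -- Only c is mapped to c, so removing c leaves a list closed under f.
    f-injective : ∀ {x} → x ∈ xs → f x ≡ c → x ≡ c
    f-injective {x} x∈ fx≡c = trans (sym (f-per x∈))
      (trans (fold-absorb f (trans (cong f fx≡c) (trans fc (sym fx≡c))) (ℕₚ.m^n≢0 p d {{prime⇒nonZero pr}})) fx≡c)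
    p∣rest : p ∣ length rest
    p∣rest = p∣length-fixed-point-free d f rest u′ closed′ (f-per ∘ up)
      (λ x∈ fx≡x → All.lookup c∉rest x∈ (sym (uniq (up x∈) fx≡x)))
      where
      closed′ : ∀ {x} → x ∈ rest → f x ∈ rest
      closed′ x∈ with ∈-resp-↭ xs↭ (f-closed (up x∈))
      ... | there fx∈ = fx∈
      ... | here fx≡c = contradiction (sym (f-injective (up x∈) fx≡c)) (All.lookup c∉rest x∈)
    p∣1 : p ∣ 1
    p∣1 = ∣m+n∣m⇒∣n (subst (p ∣_) (trans (↭-length xs↭) (ℕₚ.+-comm 1 (length rest))) p∣xs) p∣rest

module _ {A : Set} {_~_ : A → A → Set} (~-sym : ∀ {x y} → x ~ y → y ~ x) (~-refl : ∀ {x} → x ~ x)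
         (_~?_ : ∀ x y → Dec (x ~ y)) where

  -- Turns the coset space into a type `Fin n`, on which permutations can be counted.
  representatives : (xs : List A) → ∃ λ n → ∃ λ (r : Fin n → A) →
    (∀ {i j} → r i ~ r j → i ≡ j) × (∀ {x} → x ∈ xs → ∃ λ i → r i ~ x)
  representatives [] = 0 , (λ ()) , (λ { {()} }) , λ ()
  representatives (x ∷ xs) with representatives xs
  ... | n , r , r-inj , r-cover with Finₚ.any? (λ i → r i ~? x)
  ...   | yes found = n , r , r-inj , λ { (here refl) → found ; (there y∈) → r-cover y∈ }
  ...   | no  new   = suc n , r′ , r′-inj , λ
      { (here refl) → zero , ~-refl
      ; (there y∈)  → let i , e = r-cover y∈ in suc i , e }
    where
    r′ : Fin (suc n) → A
    r′ zero    = x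
    r′ (suc i) = r i
    r′-inj : ∀ {i j} → r′ i ~ r′ j → i ≡ j
    r′-inj {zero}  {zero}  _ = refl
    r′-inj {zero}  {suc j} e = contradiction (j , ~-sym e) new
    r′-inj {suc i} {zero}  e = contradiction (i , e) new
    r′-inj {suc i} {suc j} e = cong suc (r-inj e)

record DecidableSubgroup (G : Group 0ℓ 0ℓ) : Set₁ where
  open Group G
  field
    Member   : Carrier → Set
    member?  : ∀ g → Dec (Member g)
    resp-≈   : ∀ {g h} → g ≈ h → Member g → Member h
    ε-member : Member ε
    ∙-member : ∀ {g h} → Member g → Member h → Member (g ∙ h)
    ⁻¹-member : ∀ {g} → Member g → Member (g ⁻¹)

module _ (G : Group 0ℓ 0ℓ) (elements : List (Group.Carrier G))
         (complete : ∀ g → Any (Group._≈_ G g) elements) (N : DecidableSubgroup G) where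

  open Group G renaming (refl to ≈-refl; sym to ≈-sym; trans to ≈-trans; reflexive to ≈-reflexive)
  open DecidableSubgroup N
  open GroupProperties G
  open SetoidReasoning (Group.setoid G)

  private
    _~_ : Carrier → Carrier → Set
    g ~ h = Member (g ⁻¹ ∙ h)

    ~-reflexive : ∀ {g h} → g ≈ h → g ~ h
    ~-reflexive {g} e = resp-≈ (≈-trans (≈-sym (inverseˡ g)) (∙-congˡ e)) ε-member

    ~-sym : ∀ {g h} → g ~ h → h ~ g
    ~-sym {g} {h} m = resp-≈ (≈-trans (⁻¹-anti-homo-∙ (g ⁻¹) h) (∙-congˡ (⁻¹-involutive g))) (⁻¹-member m)

    ~-trans : ∀ {g h k} → g ~ h → h ~ k → g ~ k
    ~-trans {g} {h} {k} a b = resp-≈ (begin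
      (g ⁻¹ ∙ h) ∙ (h ⁻¹ ∙ k) ≈⟨ assoc _ _ _ ⟩
      g ⁻¹ ∙ (h ∙ (h ⁻¹ ∙ k)) ≈⟨ ∙-congˡ (\\-leftDividesˡ h k) ⟩
      g ⁻¹ ∙ k ∎) (∙-member a b)

    ~-∙ : ∀ k {g h} → g ~ h → (k ∙ g) ~ (k ∙ h)
    ~-∙ k {g} {h} m = resp-≈ (≈-sym (begin
      (k ∙ g) ⁻¹ ∙ (k ∙ h)      ≈⟨ ∙-congʳ (⁻¹-anti-homo-∙ k g) ⟩
      (g ⁻¹ ∙ k ⁻¹) ∙ (k ∙ h)   ≈⟨ assoc _ _ _ ⟩
      g ⁻¹ ∙ (k ⁻¹ ∙ (k ∙ h))   ≈⟨ ∙-congˡ (\\-leftDividesʳ k h) ⟩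
      g ⁻¹ ∙ h ∎)) m

    member⇒~ε : ∀ {g} → Member g → ε ~ g
    member⇒~ε {g} = resp-≈ (≈-sym (≈-trans (∙-congʳ ε⁻¹≈ε) (identityˡ g)))

    ~ε⇒member : ∀ {g} → ε ~ g → Member g
    ~ε⇒member {g} = resp-≈ (≈-trans (∙-congʳ ε⁻¹≈ε) (identityˡ g))

  -- G acts on the cosets G / N; ρ fixes only the coset N, so |G / N| ≡ 1 mod p and σ fixes a coset.
  conjugate-into-subgroup : ∀ {p} → Prime p → ∀ d e ρ σ →
    (∀ g → fold g (ρ ∙_) (p ^ d) ≈ g) → (∀ g → fold g (σ ∙_) (p ^ e) ≈ g) →
    Member ρ → (∀ g → Member (g ⁻¹ ∙ (ρ ∙ g)) → Member g) →
    ∃ λ g → Member (g ⁻¹ ∙ (σ ∙ g))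
  conjugate-into-subgroup {p} pr d e ρ σ ρ-per σ-per ρ∈N ρ-self
    with representatives {_~_ = _~_} ~-sym (~-reflexive (≈-refl)) (λ g h → member? (g ⁻¹ ∙ h)) elements
  ... | n , r , r-inj , r-cover = conclude (fixed-points-mod-p Finₚ._≟_ pr d e (act ρ) (act σ) (allFin n)
          (Uniqueₚ.allFin⁺ n) (λ _ → ∈-allFin _) (λ {i} _ → act-per ρ i (p ^ d) (ρ-per (r i)))
          (λ _ → ∈-allFin _) (λ {i} _ → act-per σ i (p ^ e) (σ-per (r i)))
          (∈-allFin (coset ε)) ρ-fixes ρ-unique)
    where
    find-coset : ∀ g → ∃ λ i → r i ~ g
    find-coset g with find (complete g)
    ... | h , h∈ , g≈h with r-cover h∈
    ...   | i , ri~h = i , ~-trans ri~h (~-reflexive (≈-sym g≈h))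
    coset : Carrier → Fin n
    coset g = proj₁ (find-coset g)
    r-coset : ∀ g → r (coset g) ~ g
    r-coset g = proj₂ (find-coset g)
    coset-unique : ∀ {i g} → r i ~ g → coset g ≡ i
    coset-unique {i} {g} m = r-inj (~-trans (r-coset g) (~-sym m))
    act : Carrier → Fin n → Fin n
    act k i = coset (k ∙ r i)
    r-act : ∀ k i m → r (fold i (act k) m) ~ fold (r i) (k ∙_) m
    r-act k i zero    = ~-reflexive (≈-refl)
    r-act k i (suc m) = ~-trans (r-coset _) (~-∙ k (r-act k i m))
    act-per : ∀ k i m → fold (r i) (k ∙_) m ≈ r i → fold i (act k) m ≡ i
    act-per k i m per = r-inj (~-trans (r-act k i m) (~-reflexive per))
    r-coset-ε : Member (r (coset ε))
    r-coset-ε = ~ε⇒member (~-sym (r-coset ε))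
    ρ-fixes : act ρ (coset ε) ≡ coset ε
    ρ-fixes = coset-unique (∙-member (⁻¹-member r-coset-ε) (∙-member ρ∈N r-coset-ε))
    fixed⇒ : ∀ k i → act k i ≡ i → r i ~ (k ∙ r i)
    fixed⇒ k i fix = ~-trans (~-reflexive (≈-reflexive (cong r (sym fix)))) (r-coset (k ∙ r i))
    ρ-unique : ∀ {i} → i ∈ allFin n → act ρ i ≡ i → i ≡ coset ε
    ρ-unique {i} _ fix = sym (coset-unique (~-sym (member⇒~ε (ρ-self (r i) (fixed⇒ ρ i fix)))))
    conclude : (∃ λ i → i ∈ allFin n × act σ i ≡ i) → ∃ λ g → Member (g ⁻¹ ∙ (σ ∙ g))
    conclude (i , _ , fix) = r i , fixed⇒ σ i fix

-- Isomorphisms between cyclic developments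

module Development (v : ℕ) .{{_ : NonZero v}} where

  open ZMod v

  Line : Set
  Line = Fin v → Bool

  -- The lines of the configuration developed from S are the translates {x ∣ S (x ⊝ i)}.
  PreservesLines : Line → Line → (Fin v → Fin v) → Set
  PreservesLines S T f = ∀ i → ∃ λ j → ∀ x → S (x ⊝ i) ≡ T (f x ⊝ j)

  -- For bijective f: conjugation by f takes the translation by m to the translation by m b. For m =
  -- 1 it says that f is affine.
  Equivariant : Fin v → (Fin v → Fin v) → Set
  Equivariant m f = ∃ λ b → ∀ x → f (x ⊕ m) ≡ f x ⊕ m ⊗ b

  -- Half of an isomorphism. `Iso` consists of two such halves with the maps exchanged, so that
  -- inversion merely swaps fields.
  record LeftInverse (S T : Line) (m : Fin v) (f g : Fin v → Fin v) : Set where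
    constructor leftInverse
    field
      cancel      : ∀ x → f (g x) ≡ x
      preserves   : PreservesLines S T f
      equivariant : Equivariant m f

  open LeftInverse

  -- An isomorphism is also required to normalise the translations by multiples of m; m = 0 imposes nothing.
  record Iso (S T : Line) (m : Fin v) : Set where
    constructor iso
    field
      to from : Fin v → Fin v
      fwd     : LeftInverse S T m to from
      bwd     : LeftInverse T S m from to

    to-from : ∀ x → to (from x) ≡ x
    to-from = cancel fwd
    from-to : ∀ x → from (to x) ≡ x
    from-to = cancel bwd
    to-injective : ∀ {x y} → to x ≡ to y → x ≡ y
    to-injective {x} {y} e = trans (sym (from-to x)) (trans (cong from e) (from-to y))

  open Iso public

  Normalises : ∀ {S T m₀} → Fin v → Iso S T m₀ → Set
  Normalises m h = Equivariant m (to h) × Equivariant m (from h)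

  -- Iterates the hypothesis `toℕ z` times. The step c is arbitrary, so that maps intertwining two
  -- unrelated translations are covered too.
  translation-linear : ∀ (f : Fin v → Fin v) m c → (∀ x → f (x ⊕ m) ≡ f x ⊕ c) →
                       ∀ z x → f (x ⊕ m ⊗ z) ≡ f x ⊕ c ⊗ z
  translation-linear f m c e z x =
    subst (λ z → f (x ⊕ m ⊗ z) ≡ f x ⊕ c ⊗ z) ([]-toℕ z) (go (toℕ z))
    where
    go : ∀ n → f (x ⊕ m ⊗ [ n ]) ≡ f x ⊕ c ⊗ [ n ]
    go zero    = trans (cong f (solve 2 (λ x m → x :+ m :* :0 := x) refl x m))
                       (solve 2 (λ x m → x := x :+ m :* :0) refl (f x) c)
    go (suc n) = begin
      f (x ⊕ m ⊗ [ suc n ])          ≡⟨ cong (λ k → f (x ⊕ m ⊗ k)) ([]-+ 1 n) ⟩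
      f (x ⊕ m ⊗ ([ 1 ] ⊕ [ n ]))    ≡⟨ cong f (solve 3 (λ x m n → x :+ m :* (:1 :+ n) := x :+ m :* n :+ m) refl x m [ n ]) ⟩
      f (x ⊕ m ⊗ [ n ] ⊕ m)          ≡⟨ e _ ⟩
      f (x ⊕ m ⊗ [ n ]) ⊕ c          ≡⟨ cong (_⊕ c) (go n) ⟩
      f x ⊕ c ⊗ [ n ] ⊕ c            ≡⟨ solve 3 (λ x m n → x :+ m :* n :+ m := x :+ m :* (:1 :+ n)) refl (f x) c [ n ] ⟩
      f x ⊕ c ⊗ ([ 1 ] ⊕ [ n ])      ≡⟨ cong (λ k → f x ⊕ c ⊗ k) (sym ([]-+ 1 n)) ⟩
      f x ⊕ c ⊗ [ suc n ]            ∎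
      where open ≡-Reasoning

  equivariant-1⇒affine : ∀ (f : Fin v → Fin v) b → (∀ x → f (x ⊕ [ 1 ]) ≡ f x ⊕ [ 1 ] ⊗ b) → ∀ x → f x ≡ f [ 0 ] ⊕ b ⊗ x
  equivariant-1⇒affine f b e x = begin
    f x                         ≡⟨ cong f (solve 1 (λ x → x := :0 :+ :1 :* x) refl x) ⟩
    f ([ 0 ] ⊕ [ 1 ] ⊗ x)       ≡⟨ translation-linear f [ 1 ] ([ 1 ] ⊗ b) e x [ 0 ] ⟩
    f [ 0 ] ⊕ [ 1 ] ⊗ b ⊗ x     ≡⟨ cong (λ z → f [ 0 ] ⊕ z ⊗ x) (⊗-identityˡ b) ⟩
    f [ 0 ] ⊕ b ⊗ x             ∎
    where open ≡-Reasoning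

  equivariant-∘ : ∀ {m} f g → Equivariant m f → Equivariant m g → Equivariant m (λ x → f (g x))
  equivariant-∘ {m} f g (b , f-eq) (c , g-eq) = b ⊗ c , λ x →
    trans (cong f (g-eq x)) (trans (translation-linear f m (m ⊗ b) f-eq c (g x))
      (cong (f (g x) ⊕_) (⊗-assoc m b c)))

  equivariant-resp : ∀ {m} f g → (∀ x → f x ≡ g x) → Equivariant m f → Equivariant m g
  equivariant-resp f g f≗g (b , e) = b , λ x → trans (sym (f≗g _)) (trans (e x) (cong (_⊕ _) (f≗g x)))

  equivariant-0 : ∀ f → Equivariant [ 0 ] f
  equivariant-0 f = [ 0 ] , λ x → trans (cong f (solve 1 (λ x → x :+ :0 := x) refl x))
    (solve 1 (λ x → x := x :+ :0 :* :0) refl (f x))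

  preservesLines-∘ : ∀ {S T U} f g → PreservesLines T U f → PreservesLines S T g →
                     PreservesLines S U (λ x → f (g x))
  preservesLines-∘ f g F G i with G i
  ... | j , Gij with F j
  ...   | k , Fjk = k , λ x → trans (Gij x) (Fjk (g x))

  preservesLines-resp : ∀ {S T} f g → (∀ x → f x ≡ g x) → PreservesLines S T f → PreservesLines S T g
  preservesLines-resp {T = T} f g f≗g F i with F i
  ... | j , Fij = j , λ x → trans (Fij x) (cong (λ y → T (y ⊝ j)) (f≗g x))

  preservesLines? : ∀ S T f → Dec (PreservesLines S T f)
  preservesLines? S T f = Finₚ.all? λ i → Finₚ.any? λ j → Finₚ.all? λ x → S (x ⊝ i) Boolₚ.≟ T (f x ⊝ j)

  equivariant? : ∀ m f → Dec (Equivariant m f)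
  equivariant? m f = Finₚ.any? λ b → Finₚ.all? λ x → f (x ⊕ m) Finₚ.≟ f x ⊕ m ⊗ b

  leftInverse-resp : ∀ {S T m f f′ g g′} → (∀ x → f x ≡ f′ x) → (∀ x → g x ≡ g′ x) →
                     LeftInverse S T m f g → LeftInverse S T m f′ g′
  leftInverse-resp {S} {T} {m} {f} {f′} f≗ g≗ (leftInverse sec lin equi) = leftInverse
    (λ x → trans (sym (trans (cong f (g≗ x)) (f≗ _))) (sec x))
    (preservesLines-resp {S} {T} f f′ f≗ lin) (equivariant-resp f f′ f≗ equi)

  leftInverse? : ∀ S T m f g → Dec (LeftInverse S T m f g)
  leftInverse? S T m f g = map′ (λ (s , l , e) → leftInverse s l e) (λ (leftInverse s l e) → s , l , e)
    (Finₚ.all? (λ x → f (g x) Finₚ.≟ x) ×-dec (preservesLines? S T f ×-dec equivariant? m f))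

  leftInverse-∘ : ∀ {S T U m f f′ g g′} → LeftInverse T U m f f′ → LeftInverse S T m g g′ →
                  LeftInverse S U m (λ x → f (g x)) (λ x → g′ (f′ x))
  leftInverse-∘ {S} {T} {U} {m} {f} {f′} {g} (leftInverse s₁ l₁ e₁) (leftInverse s₂ l₂ e₂) = leftInverse
    (λ x → trans (cong f (s₂ (f′ x))) (s₁ x)) (preservesLines-∘ {S} {T} {U} f g l₁ l₂) (equivariant-∘ f g e₁ e₂)

  infixr 9 _∘ⁱ_

  _∘ⁱ_ : ∀ {S T U m} → Iso T U m → Iso S T m → Iso S U m
  g ∘ⁱ f = iso (λ x → to g (to f x)) (λ x → from f (from g x))
    (leftInverse-∘ (fwd g) (fwd f)) (leftInverse-∘ (bwd f) (bwd g))

  inverseⁱ : ∀ {S T m} → Iso S T m → Iso T S m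
  inverseⁱ f = iso (from f) (to f) (bwd f) (fwd f)

  translation : ∀ {S m} → Fin v → Iso S S m
  translation {S} {m} r = iso (_⊕ r) (_⊝ r)
    (leftInverse (λ x → solve 2 (λ x r → x :- r :+ r := x) refl x r)
     (λ i → i ⊕ r , λ x → cong S (solve 3 (λ x i r → x :- i := x :+ r :- (i :+ r)) refl x i r))
     ([ 1 ] , λ x → solve 3 (λ x m r → x :+ m :+ r := x :+ r :+ m :* :1) refl x m r))
    (leftInverse (λ x → solve 2 (λ x r → x :+ r :- r := x) refl x r)
     (λ i → i ⊝ r , λ x → cong S (solve 3 (λ x i r → x :- i := x :- r :- (i :- r)) refl x i r))
     ([ 1 ] , λ x → solve 3 (λ x m r → x :+ m :- r := x :- r :+ m :* :1) refl x m r))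

  translation-normalises : ∀ {S m₀} r m → Normalises m (translation {S} {m₀} r)
  translation-normalises r m =
    ([ 1 ] , λ x → solve 3 (λ x m r → x :+ m :+ r := x :+ r :+ m :* :1) refl x m r) ,
    ([ 1 ] , λ x → solve 3 (λ x m r → x :+ m :- r := x :- r :+ m :* :1) refl x m r)

  identityⁱ : ∀ {S m} → Iso S S m
  identityⁱ {S} {m} = iso (λ x → x) (λ x → x) half half
    where
    half : LeftInverse S S m (λ x → x) (λ x → x)
    half = leftInverse (λ x → refl) (λ i → i , λ x → refl)
           ([ 1 ] , λ x → solve 2 (λ x m → x :+ m := x :+ m :* :1) refl x m)

  from-cong : ∀ {S T m} (f g : Iso S T m) → (∀ x → to f x ≡ to g x) → ∀ x → from f x ≡ from g x
  from-cong f g f≗g x = to-injective f (trans (to-from f x) (sym (trans (f≗g (from g x)) (to-from g x))))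

  -- An `Iso` also carries proofs, so equality is pointwise equality of the forward maps; the
  -- inverses then agree by `from-cong`.
  automorphismGroup : Line → Fin v → Group 0ℓ 0ℓ
  automorphismGroup S m = record
    { Carrier = Iso S S m
    ; _≈_ = λ f g → ∀ x → to f x ≡ to g x
    ; _∙_ = _∘ⁱ_
    ; ε = identityⁱ
    ; _⁻¹ = inverseⁱ
    ; isGroup = record
      { isMonoid = record
        { isSemigroup = record
          { isMagma = record
            { isEquivalence = record
              { refl = λ x → refl ; sym = λ e x → sym (e x) ; trans = λ d e x → trans (d x) (e x) }
            ; ∙-cong = λ {f} {f′} {g} {g′} d e x → trans (cong (to f) (e x)) (d (to g′ x)) }
          ; assoc = λ f g h x → refl }
        ; identity = (λ f x → refl) , (λ f x → refl) }
      ; inverse = from-to , to-from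
      ; ⁻¹-cong = λ {f} {g} → from-cong f g } }

  private
    -- The v ^ v value tables. Every automorphism is found, up to pointwise equality, by testing all
    -- pairs of tables for the two halves of an `Iso`.
    tables : List (Fin v → Fin v)
    tables = map finToFun (allFin (v ^ v))

    table : ∀ f → Any (λ t → ∀ x → f x ≡ t x) tables
    table f = Anyₚ.map⁺ (Any.map (λ { refl x → sym (Finₚ.finToFun-funToFin f x) }) (∈-allFin (funToFin f)))

    withTables : ∀ S m f g → List (Iso S S m)
    withTables S m f g with leftInverse? S S m f g ×-dec leftInverse? S S m g f
    ... | yes (fw , bw) = iso f g fw bw ∷ []
    ... | no  _         = []

    withTables-complete : ∀ {S m f g} (h : Iso S S m) → (∀ x → to h x ≡ f x) → (∀ x → from h x ≡ g x) →
      Any (λ k → ∀ x → to h x ≡ to k x) (withTables S m f g)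
    withTables-complete {S} {m} {f} {g} h d e with leftInverse? S S m f g ×-dec leftInverse? S S m g f
    ... | yes _ = here d
    ... | no ¬p = contradiction (leftInverse-resp d e (fwd h) , leftInverse-resp e d (bwd h)) ¬p

  automorphisms : ∀ S m → List (Iso S S m)
  automorphisms S m = concatMap (λ f → concatMap (withTables S m f) tables) tables

  automorphisms-complete : ∀ S m h → Any (λ k → ∀ x → to h x ≡ to k x) (automorphisms S m)
  automorphisms-complete S m h =
    Anyₚ.concatMap⁺ _ (Any.map (λ {f} d →
      Anyₚ.concatMap⁺ (withTables S m f) (Any.map (withTables-complete h d) (table (from h))))
      (table (to h)))

  normaliser : ∀ S m₀ m → DecidableSubgroup (automorphismGroup S m₀)
  normaliser S m₀ m = record
    { Member = Normalises m
    ; member? = λ h → equivariant? m (to h) ×-dec equivariant? m (from h)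
    ; resp-≈ = λ {f} {g} f≗g (a , b) → 
        equivariant-resp (to f) (to g) f≗g a , equivariant-resp (from f) (from g) (from-cong f g f≗g) b
    ; ε-member = identity , identity
    ; ∙-member = λ {f} {g} (a , b) (c , d) →
        equivariant-∘ (to f) (to g) a c , equivariant-∘ (from g) (from f) d b
    ; ⁻¹-member = λ (a , b) → b , a }
    where
    identity : Equivariant m (λ x → x)
    identity = [ 1 ] , λ x → solve 2 (λ x m → x :+ m := x :+ m :* :1) refl x m

  -- The translation by r of the development of T, pulled back along h to an automorphism of the
  -- development of S.
  conjugate : ∀ {S T m₀} → Iso S T m₀ → Fin v → Iso S S m₀
  conjugate h r = inverseⁱ h ∘ⁱ translation r ∘ⁱ h

  conjugate-iterate : ∀ {S T m₀} (h : Iso S T m₀) r (g : Iso S S m₀) n x →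
    to (fold g (conjugate h r ∘ⁱ_) n) x ≡ from h (to h (to g x) ⊕ [ n ] ⊗ r)
  conjugate-iterate h r g zero x =
    sym (trans (cong (from h) (solve 2 (λ y r → y :+ :0 :* r := y) refl (to h (to g x)) r)) (from-to h _))
  conjugate-iterate h r g (suc n) x = cong (from h) (begin
    to h (to (fold g (conjugate h r ∘ⁱ_) n) x) ⊕ r     ≡⟨ cong (λ y → to h y ⊕ r) (conjugate-iterate h r g n x) ⟩
    to h (from h (to h (to g x) ⊕ [ n ] ⊗ r)) ⊕ r      ≡⟨ cong (_⊕ r) (to-from h _) ⟩
    to h (to g x) ⊕ [ n ] ⊗ r ⊕ r                      ≡⟨ solve 3 (λ y n r → y :+ n :* r :+ r := y :+ (:1 :+ n) :* r) refl (to h (to g x)) [ n ] r ⟩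
    to h (to g x) ⊕ ([ 1 ] ⊕ [ n ]) ⊗ r                ≡⟨ cong (λ k → to h (to g x) ⊕ k ⊗ r) (sym ([]-+ 1 n)) ⟩
    to h (to g x) ⊕ [ suc n ] ⊗ r                      ∎)
    where open ≡-Reasoning

  conjugate-period : ∀ {S T m₀} (h : Iso S T m₀) r n → [ n ] ⊗ r ≡ [ 0 ] → ∀ (g : Iso S S m₀) x →
    to (fold g (conjugate h r ∘ⁱ_) n) x ≡ to g x
  conjugate-period h r n nr≡0 g x = trans (conjugate-iterate h r g n x)
    (trans (cong (from h) (trans (cong (to h (to g x) ⊕_) nr≡0)
      (solve 1 (λ y → y :+ :0 := y) refl _))) (from-to h (to g x)))

  -- Here ρ is the translation by r on S and σ the one on T pulled back along f. The g obtained puts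
  -- the pullback along f ∘ g into the normaliser, and `self` at U = T transfers this to f ∘ g. At U
  -- = S, `self` is the condition that ρ fixes a single coset.
  normalising-iso : ∀ {S T m₀ p} → Prime p → ∀ e m r → [ p ^ e ] ⊗ r ≡ [ 0 ] → Iso S T m₀ →
    (∀ {U} (h : Iso S U m₀) → Normalises m (conjugate h r) → Normalises m h) →
    ∃ λ (h : Iso S T m₀) → Normalises m h
  normalising-iso {S} {T} {m₀} {p} pr e m r per f self = f ∘ⁱ proj₁ found , self (f ∘ⁱ proj₁ found) (proj₂ found)
    where
    found : ∃ λ (g : Iso S S m₀) → Normalises m (inverseⁱ g ∘ⁱ conjugate f r ∘ⁱ g)
    found = conjugate-into-subgroup (automorphismGroup S m₀) (automorphisms S m₀) (automorphisms-complete S m₀)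
           -- Writing the translation as a conjugate by the identity lets `conjugate-period` supply
           -- both periods.
           (normaliser S m₀ m) {p} pr e e (conjugate {S} {S} {m₀} identityⁱ r) (conjugate f r)
           (conjugate-period identityⁱ r (p ^ e) per) (conjugate-period f r (p ^ e) per)
           (translation-normalises {S} {m₀} r m) (λ g → self g)

-- Units modulo v

prime∤⇒coprime : ∀ {p m} → Prime p → ¬ p ∣ m → Coprime m p
prime∤⇒coprime pr p∤m (d∣m , d∣p) with prime⇒irreducible pr d∣p
... | inj₁ d≡1  = d≡1
... | inj₂ refl = contradiction d∣m p∤m

coprime-*ʳ : ∀ {m a b} → Coprime m a → Coprime m b → Coprime m (a * b)
coprime-*ʳ ca cb (d∣m , d∣ab) =
  cb (d∣m , coprime-divisor (λ (e∣d , e∣a) → ca (∣-trans e∣d d∣m , e∣a)) d∣ab)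

coprime-^ʳ : ∀ {m a} → Coprime m a → ∀ n → Coprime m (a ^ n)
coprime-^ʳ c zero    = Coprimality.sym (Coprimality.1-coprimeTo _)
coprime-^ʳ c (suc n) = coprime-*ʳ c (coprime-^ʳ c n)

-- The sum 0 + 1 + ... + (n - 1), that is n (n - 1) / 2: the linear coefficient in
-- `geometric-expansion`.
triangular : ℕ → ℕ
triangular zero    = 0
triangular (suc n) = n + triangular n

2*triangular : ∀ n → 2 * triangular (suc n) ≡ suc n * n
2*triangular zero    = refl
2*triangular (suc n) = begin
  2 * (suc n + triangular (suc n))          ≡⟨ ℕₚ.*-distribˡ-+ 2 (suc n) (triangular (suc n)) ⟩
  2 * suc n + 2 * triangular (suc n)        ≡⟨ cong (2 * suc n +_) (2*triangular n) ⟩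
  2 * suc n + suc n * n                     ≡⟨ cong (2 * suc n +_) (ℕₚ.*-comm (suc n) n) ⟩
  2 * suc n + n * suc n                     ≡⟨ ℕₚ.*-distribʳ-+ (suc n) 2 n ⟨
  suc (suc n) * suc n                       ∎
  where open ≡-Reasoning

-- p divides 2 · `triangular p` = p (p - 1) but not 2. This is where odd primes part from 2.
odd-prime∣triangular : ∀ {p} → Prime p → p ≢ 2 → p ∣ triangular p
odd-prime∣triangular {suc n} pr p≢2
  with euclidsLemma 2 (triangular (suc n)) pr (subst (suc n ∣_) (sym (2*triangular n)) (m∣m*n n))
... | inj₂ p∣t = p∣t
... | inj₁ p∣2 with prime⇒irreducible prime[2] p∣2
...   | inj₁ p≡1 = contradiction (subst Prime p≡1 pr) ¬prime[1]
...   | inj₂ p≡2 = contradiction p≡2 p≢2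

module Units (v : ℕ) .{{_ : NonZero v}} where

  open ZMod v

  Unit : Fin v → Set
  Unit x = ∃ λ y → x ⊗ y ≡ [ 1 ]

  []-mod-divisor : ∀ {d a b} → d ∣ v → [ a ] ≡ [ b ] → d ∣ a → d ∣ b
  []-mod-divisor {d} {a} {b} d∣v e d∣a = subst (d ∣_) (sym (m≡m%n+[m/n]*n b v))
    (∣m∣n⇒∣m+n (subst (d ∣_) a%v≡b%v (%-presˡ-∣ d∣a d∣v)) (∣n⇒∣m*n (b / v) d∣v))
    where
    a%v≡b%v : a % v ≡ b % v
    a%v≡b%v = trans (sym (toℕ-[] a)) (trans (cong toℕ e) (toℕ-[] b))

  []≡0 : ∀ {m} → v ∣ m → [ m ] ≡ [ 0 ]
  []≡0 {m} v∣m = []-cong (trans (n∣m⇒m%n≡0 m v v∣m) (sym (n∣m⇒m%n≡0 0 v (v ∣0))))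

  []≡0⇒∣ : ∀ {m} → [ m ] ≡ [ 0 ] → v ∣ m
  []≡0⇒∣ e = []-mod-divisor ∣-refl (sym e) (v ∣0)

  bézout : ∀ m n → ∃ λ a → ∃ λ b → [ m ] ⊗ a ⊕ [ n ] ⊗ b ≡ [ gcd m n ]
  bézout m n with Bézout.identity (gcd-GCD m n)
  ... | Bézout.+- x y eq = [ x ] , ⊖ [ y ] , (begin
    [ m ] ⊗ [ x ] ⊕ [ n ] ⊗ ⊖ [ y ]        ≡⟨ solve 4 (λ m x n y → m :* x :+ n :* :- y := x :* m :- y :* n) refl [ m ] [ x ] [ n ] [ y ] ⟩
    [ x ] ⊗ [ m ] ⊝ [ y ] ⊗ [ n ]          ≡⟨ cong₂ _⊝_ (sym ([]-* x m)) (sym ([]-* y n)) ⟩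
    [ x * m ] ⊝ [ y * n ]                  ≡⟨ cong (λ k → [ k ] ⊝ [ y * n ]) (sym eq) ⟩
    [ gcd m n + y * n ] ⊝ [ y * n ]        ≡⟨ cong (_⊝ [ y * n ]) ([]-+ (gcd m n) (y * n)) ⟩
    [ gcd m n ] ⊕ [ y * n ] ⊝ [ y * n ]    ≡⟨ solve 2 (λ g z → g :+ z :- z := g) refl [ gcd m n ] [ y * n ] ⟩
    [ gcd m n ]                            ∎)
    where open ≡-Reasoning
  ... | Bézout.-+ x y eq = ⊖ [ x ] , [ y ] , (begin
    [ m ] ⊗ ⊖ [ x ] ⊕ [ n ] ⊗ [ y ]        ≡⟨ solve 4 (λ m x n y → m :* :- x :+ n :* y := y :* n :- x :* m) refl [ m ] [ x ] [ n ] [ y ] ⟩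
    [ y ] ⊗ [ n ] ⊝ [ x ] ⊗ [ m ]          ≡⟨ cong₂ _⊝_ (sym ([]-* y n)) (sym ([]-* x m)) ⟩
    [ y * n ] ⊝ [ x * m ]                  ≡⟨ cong (λ k → [ k ] ⊝ [ x * m ]) (sym eq) ⟩
    [ gcd m n + x * m ] ⊝ [ x * m ]        ≡⟨ cong (_⊝ [ x * m ]) ([]-+ (gcd m n) (x * m)) ⟩
    [ gcd m n ] ⊕ [ x * m ] ⊝ [ x * m ]    ≡⟨ solve 2 (λ g z → g :+ z :- z := g) refl [ gcd m n ] [ x * m ] ⟩
    [ gcd m n ]                            ∎)
    where open ≡-Reasoning

  coprime-bézout : ∀ {m n} → Coprime m n → ∃ λ a → ∃ λ b → [ m ] ⊗ a ⊕ [ n ] ⊗ b ≡ [ 1 ]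
  coprime-bézout {m} {n} c with bézout m n
  ... | a , b , e = a , b , trans e (cong [_] (coprime⇒gcd≡1 c))

  multiple-gcd : ∀ m → ∃ λ c → [ m ] ⊗ c ≡ [ gcd m v ]
  multiple-gcd m with bézout m v
  ... | a , b , e = a , (begin
    [ m ] ⊗ a                      ≡⟨ solve 2 (λ x b → x := x :+ :0 :* b) refl ([ m ] ⊗ a) b ⟩
    [ m ] ⊗ a ⊕ [ 0 ] ⊗ b          ≡⟨ cong (λ z → [ m ] ⊗ a ⊕ z ⊗ b) (sym ([]≡0 ∣-refl)) ⟩
    [ m ] ⊗ a ⊕ [ v ] ⊗ b          ≡⟨ e ⟩
    [ gcd m v ]                    ∎)
    where open ≡-Reasoning

  coprime⇒unit : ∀ {m} → Coprime m v → Unit [ m ]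
  coprime⇒unit {m} c = proj₁ (multiple-gcd m) , trans (proj₂ (multiple-gcd m)) (cong [_] (coprime⇒gcd≡1 c))

  unit⇒coprime : ∀ {x} → Unit x → Coprime (toℕ x) v
  unit⇒coprime {x} (y , xy≡1) (d∣x , d∣v) = ∣1⇒≡1 ([]-mod-divisor d∣v
    (trans ([]-* (toℕ x) (toℕ y)) (trans (cong₂ _⊗_ ([]-toℕ x) ([]-toℕ y)) xy≡1)) (∣m⇒∣m*n (toℕ y) d∣x))

  ∣⇒multiple : ∀ {d} x → d ∣ toℕ x → ∃ λ y → x ≡ [ d ] ⊗ y
  ∣⇒multiple {d} x (divides k e) = [ k ] ,
    trans (sym ([]-toℕ x)) (trans (cong [_] (trans e (ℕₚ.*-comm k d))) ([]-* d k))

  ⊗-cancel-unit : ∀ {u} → Unit u → ∀ x → x ⊗ u ≡ [ 0 ] → x ≡ [ 0 ]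
  ⊗-cancel-unit {u} (y , uy≡1) x xu≡0 = begin
    x              ≡⟨ solve 1 (λ x → x := x :* :1) refl x ⟩
    x ⊗ [ 1 ]      ≡⟨ cong (x ⊗_) (sym uy≡1) ⟩
    x ⊗ (u ⊗ y)    ≡⟨ ⊗-assoc x u y ⟨
    x ⊗ u ⊗ y      ≡⟨ cong (_⊗ y) xu≡0 ⟩
    [ 0 ] ⊗ y      ≡⟨ solve 1 (λ y → :0 :* y := :0) refl y ⟩
    [ 0 ]          ∎
    where open ≡-Reasoning

  ⊝≡0⇒≡ : ∀ {x y} → x ⊝ y ≡ [ 0 ] → x ≡ y
  ⊝≡0⇒≡ {x} {y} e = trans (solve 2 (λ x y → x := y :+ (x :- y)) refl x y)
    (trans (cong (y ⊕_) e) (solve 1 (λ y → y :+ :0 := y) refl y))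

  prime∤1 : ∀ {p} → Prime p → p ∣ v → ∀ y → [ p ] ⊗ y ≢ [ 1 ]
  prime∤1 {p} pr p∣v y py≡1 = contradiction (subst Prime (∣1⇒≡1 p∣1) pr) ¬prime[1]
    where
    p∣1 : p ∣ 1
    p∣1 = []-mod-divisor p∣v (trans ([]-* p (toℕ y)) (trans (cong ([ p ] ⊗_) ([]-toℕ y)) py≡1)) (m∣m*n (toℕ y))

  1≢0 : ∀ {p} → Prime p → p ∣ v → [ 1 ] ≢ [ 0 ]
  1≢0 {p} pr p∣v e = prime∤1 pr p∣v [ 0 ]
    (trans (solve 1 (λ p → p :* :0 := :0) refl [ p ]) (sym e))

  infixr 8 _↑_

  _↑_ : Fin v → ℕ → Fin v
  u ↑ zero  = [ 1 ]
  u ↑ suc n = u ⊗ u ↑ n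

  -- The sum 1 + u + ... + u^(n - 1), by which the constant term is multiplied in the n-th iterate
  -- of an affine map of slope u.
  geometric : Fin v → ℕ → Fin v
  geometric u zero    = [ 0 ]
  geometric u (suc n) = [ 1 ] ⊕ u ⊗ geometric u n

  ↑-+ : ∀ u m n → u ↑ (m + n) ≡ u ↑ m ⊗ u ↑ n
  ↑-+ u zero    n = sym (⊗-identityˡ _)
  ↑-+ u (suc m) n = trans (cong (u ⊗_) (↑-+ u m n)) (sym (⊗-assoc u _ _))

  1↑ : ∀ n → [ 1 ] ↑ n ≡ [ 1 ]
  1↑ zero    = refl
  1↑ (suc n) = trans (⊗-identityˡ _) (1↑ n)

  ↑-distrib-⊗ : ∀ u w n → (u ⊗ w) ↑ n ≡ u ↑ n ⊗ w ↑ n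
  ↑-distrib-⊗ u w zero    = sym (⊗-identityˡ _)
  ↑-distrib-⊗ u w (suc n) = trans (cong (u ⊗ w ⊗_) (↑-distrib-⊗ u w n))
    (solve 4 (λ u w a b → u :* w :* (a :* b) := u :* a :* (w :* b)) refl u w (u ↑ n) (w ↑ n))

  ↑-* : ∀ u m n → u ↑ (m * n) ≡ (u ↑ m) ↑ n
  ↑-* u zero    n = sym (1↑ n)
  ↑-* u (suc m) n = trans (↑-+ u n (m * n))
    (trans (cong (u ↑ n ⊗_) (↑-* u m n)) (sym (↑-distrib-⊗ u (u ↑ m) n)))

  geometric-telescope : ∀ u n → (u ⊝ [ 1 ]) ⊗ geometric u n ≡ u ↑ n ⊝ [ 1 ]
  geometric-telescope u zero    = solve 1 (λ u → (u :- :1) :* :0 := :1 :- :1) refl u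
  geometric-telescope u (suc n) = begin
    (u ⊝ [ 1 ]) ⊗ ([ 1 ] ⊕ u ⊗ geometric u n)             ≡⟨ solve 2 (λ u g → (u :- :1) :* (:1 :+ u :* g) := u :- :1 :+ u :* ((u :- :1) :* g)) refl u (geometric u n) ⟩
    u ⊝ [ 1 ] ⊕ u ⊗ ((u ⊝ [ 1 ]) ⊗ geometric u n)         ≡⟨ cong (λ z → u ⊝ [ 1 ] ⊕ u ⊗ z) (geometric-telescope u n) ⟩
    u ⊝ [ 1 ] ⊕ u ⊗ (u ↑ n ⊝ [ 1 ])                       ≡⟨ solve 2 (λ u a → u :- :1 :+ u :* (a :- :1) := u :* a :- :1) refl u (u ↑ n) ⟩
    u ⊗ u ↑ n ⊝ [ 1 ]                                     ∎
    where open ≡-Reasoning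

  -- Binomial expansion to second order in w. For n = p and p dividing w it serves to recognise the
  -- sum as p times a unit.
  geometric-expansion : ∀ w n → ∃ λ k →
    geometric ([ 1 ] ⊕ w) n ≡ [ n ] ⊕ w ⊗ [ triangular n ] ⊕ w ⊗ w ⊗ k
  geometric-expansion w zero = [ 0 ] ,
    solve 1 (λ w → :0 := :0 :+ w :* :0 :+ w :* w :* :0) refl w
  geometric-expansion w (suc n) with geometric-expansion w n
  ... | k , e = [ triangular n ] ⊕ k ⊕ w ⊗ k , (begin
    [ 1 ] ⊕ ([ 1 ] ⊕ w) ⊗ geometric ([ 1 ] ⊕ w) n
      ≡⟨ cong (λ z → [ 1 ] ⊕ ([ 1 ] ⊕ w) ⊗ z) e ⟩
    [ 1 ] ⊕ ([ 1 ] ⊕ w) ⊗ ([ n ] ⊕ w ⊗ [ triangular n ] ⊕ w ⊗ w ⊗ k)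
      ≡⟨ solve 4 (λ w n t k → :1 :+ (:1 :+ w) :* (n :+ w :* t :+ w :* w :* k) :=
           :1 :+ n :+ w :* (n :+ t) :+ w :* w :* (t :+ k :+ w :* k)) refl w [ n ] [ triangular n ] k ⟩
    [ 1 ] ⊕ [ n ] ⊕ w ⊗ ([ n ] ⊕ [ triangular n ]) ⊕ w ⊗ w ⊗ ([ triangular n ] ⊕ k ⊕ w ⊗ k)
      ≡⟨ cong₂ (λ a b → a ⊕ w ⊗ b ⊕ w ⊗ w ⊗ ([ triangular n ] ⊕ k ⊕ w ⊗ k)) (sym ([]-+ 1 n)) (sym ([]-+ n (triangular n))) ⟩
    [ suc n ] ⊕ w ⊗ [ triangular (suc n) ] ⊕ w ⊗ w ⊗ ([ triangular n ] ⊕ k ⊕ w ⊗ k) ∎)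
    where open ≡-Reasoning

  module PrimePower {p} (pr : Prime p) (n : ℕ) (v≡ : v ≡ p ^ n) (p∣v : p ∣ v) where

    multiple⊎unit : ∀ x → (∃ λ y → x ≡ [ p ] ⊗ y) ⊎ Unit x
    multiple⊎unit x with p ∣? toℕ x
    ... | yes p∣x = inj₁ (∣⇒multiple x p∣x)
    ... | no  p∤x = inj₂ (subst Unit ([]-toℕ x)
      (coprime⇒unit (subst (Coprime (toℕ x)) (sym v≡) (coprime-^ʳ (prime∤⇒coprime pr p∤x) n))))

    1+multiple-unit : ∀ y → Unit ([ 1 ] ⊕ [ p ] ⊗ y)
    1+multiple-unit y with multiple⊎unit ([ 1 ] ⊕ [ p ] ⊗ y)
    ... | inj₂ u       = u
    ... | inj₁ (z , e) = contradiction
      (trans (solve 3 (λ p z y → p :* (z :- y) := p :* z :- p :* y) refl [ p ] z y)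
        (trans (cong (_⊝ [ p ] ⊗ y) (sym e)) (solve 2 (λ p y → :1 :+ p :* y :- p :* y := :1) refl [ p ] y)))
      (prime∤1 pr p∣v (z ⊝ y))

-- Sidon sets and multipliers

module Sidon (v : ℕ) .{{_ : NonZero v}} where

  open ZMod v
  open Units v
  open Development v

  -- Only `a ≡ c` is demanded; `b ≡ d` then follows from the equality of the differences.
  record IsSidon (S : Line) : Set where
    constructor sidon
    field
      differences-distinct : ∀ {a b c d} → S a ≡ true → S b ≡ true → S c ≡ true → S d ≡ true →
                             a ⊝ b ≡ c ⊝ d → a ≢ b → a ≡ c

  open IsSidon public

  -- The constant c is harmless: the lines are all the translates of S and of T, so c only renumbers
  -- them.
  MultiplierRelated : Line → Line → Set
  MultiplierRelated S T = ∃ λ b → Unit b × ∃ λ c → ∀ x → S x ≡ T (b ⊗ x ⊕ c)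

  -- A nonzero d would occur as the difference of both consecutive pairs.
  sidon-progression : ∀ {S} → IsSidon S → ∀ {a} d → S a ≡ true → S (a ⊕ d) ≡ true → S (a ⊕ d ⊕ d) ≡ true →
                      d ≡ [ 0 ]
  sidon-progression sid {a} d Sa Sb Sc with d Finₚ.≟ [ 0 ]
  ... | yes d≡0 = d≡0
  ... | no  d≢0 = contradiction (cancel′ (differences-distinct sid Sc Sb Sb Sa
        (solve 2 (λ a d → a :+ d :+ d :- (a :+ d) := a :+ d :- a) refl a d) (λ e → d≢0 (cancel′ e)))) d≢0
    where
    cancel′ : ∀ {x} → x ⊕ d ≡ x → d ≡ [ 0 ]
    cancel′ {x} e = trans (solve 2 (λ x d → d := x :+ d :- x) refl x d)
      (trans (cong (_⊝ x) e) (solve 1 (λ x → x :- x := :0) refl x))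

  -- Invariance puts a, a - h and a - 2 h into S, a progression with difference -h.
  translation-invariant⇒0 : ∀ {S} → IsSidon S → ∀ {a} → S a ≡ true → ∀ h → (∀ x → S x ≡ S (x ⊝ h)) → h ≡ [ 0 ]
  translation-invariant⇒0 {S} sid {a} Sa h inv =
    trans (solve 1 (λ h → h := :- :- h) refl h)
      (trans (cong ⊖_ (sidon-progression sid (⊖ h) Sa Sb (trans (sym (inv _)) Sb)))
        (solve 0 (:- :0 := :0) refl))
    where
    Sb : S (a ⊝ h) ≡ true
    Sb = trans (sym (inv a)) Sa

  affine-iso⇒related : ∀ {S T m₀} (h : Iso S T m₀) → Normalises [ 1 ] h → MultiplierRelated S T
  affine-iso⇒related {S} {T} h ((b , to-eq) , (b′ , from-eq)) = b , (b′ , bb′≡1) , to h [ 0 ] ⊝ k , λ x → begin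
      S x                              ≡⟨ cong S (solve 1 (λ x → x := x :- :0) refl x) ⟩
      S (x ⊝ [ 0 ])                    ≡⟨ proj₂ (LeftInverse.preserves (fwd h) [ 0 ]) x ⟩
      T (to h x ⊝ k)                   ≡⟨ cong (λ y → T (y ⊝ k)) (affine x) ⟩
      T (to h [ 0 ] ⊕ b ⊗ x ⊝ k)       ≡⟨ cong T (solve 3 (λ a bx k → a :+ bx :- k := bx :+ (a :- k)) refl (to h [ 0 ]) (b ⊗ x) k) ⟩
      T (b ⊗ x ⊕ (to h [ 0 ] ⊝ k))     ∎
    where
    open ≡-Reasoning
    k = proj₁ (LeftInverse.preserves (fwd h) [ 0 ])
    linear : ∀ z x → to h (x ⊕ z) ≡ to h x ⊕ b ⊗ z
    linear z x = begin
      to h (x ⊕ z)             ≡⟨ cong (λ y → to h (x ⊕ y)) (sym (⊗-identityˡ z)) ⟩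
      to h (x ⊕ [ 1 ] ⊗ z)     ≡⟨ translation-linear (to h) [ 1 ] ([ 1 ] ⊗ b) to-eq z x ⟩
      to h x ⊕ [ 1 ] ⊗ b ⊗ z   ≡⟨ cong (λ y → to h x ⊕ y ⊗ z) (⊗-identityˡ b) ⟩
      to h x ⊕ b ⊗ z           ∎
    affine : ∀ x → to h x ≡ to h [ 0 ] ⊕ b ⊗ x
    affine = equivariant-1⇒affine (to h) b to-eq
    bb′≡1 : b ⊗ b′ ≡ [ 1 ]
    bb′≡1 = begin
      b ⊗ b′                                   ≡⟨ solve 2 (λ a c → c := a :+ c :- a) refl (to h (from h [ 0 ])) (b ⊗ b′) ⟩
      to h (from h [ 0 ]) ⊕ b ⊗ b′ ⊝ to h (from h [ 0 ]) ≡⟨ cong (_⊝ to h (from h [ 0 ])) (sym (linear b′ (from h [ 0 ]))) ⟩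
      to h (from h [ 0 ] ⊕ b′) ⊝ to h (from h [ 0 ])     ≡⟨ cong (λ y → to h (from h [ 0 ] ⊕ y) ⊝ to h (from h [ 0 ])) (sym (⊗-identityˡ b′)) ⟩
      to h (from h [ 0 ] ⊕ [ 1 ] ⊗ b′) ⊝ to h (from h [ 0 ]) ≡⟨ cong (λ y → to h y ⊝ to h (from h [ 0 ])) (sym (from-eq [ 0 ])) ⟩
      to h (from h ([ 0 ] ⊕ [ 1 ])) ⊝ to h (from h [ 0 ])    ≡⟨ cong₂ _⊝_ (to-from h _) (to-from h _) ⟩
      [ 0 ] ⊕ [ 1 ] ⊝ [ 0 ]                     ≡⟨ solve 0 (:0 :+ :1 :- :0 := :1) refl ⟩
      [ 1 ]                                     ∎

  related-sym : ∀ {S T} → MultiplierRelated S T → MultiplierRelated T S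
  related-sym {S} {T} (b , (b′ , bb′≡1) , c , e) = b′ , (b , trans (⊗-comm b′ b) bb′≡1) , ⊖ (b′ ⊗ c) , λ x → sym (begin
      S (b′ ⊗ x ⊝ b′ ⊗ c)                ≡⟨ e _ ⟩
      T (b ⊗ (b′ ⊗ x ⊝ b′ ⊗ c) ⊕ c)      ≡⟨ cong T (solve 4 (λ b b′ x c → b :* (b′ :* x :- b′ :* c) :+ c := b :* b′ :* (x :- c) :+ c) refl b b′ x c) ⟩
      T (b ⊗ b′ ⊗ (x ⊝ c) ⊕ c)           ≡⟨ cong (λ y → T (y ⊗ (x ⊝ c) ⊕ c)) bb′≡1 ⟩
      T ([ 1 ] ⊗ (x ⊝ c) ⊕ c)            ≡⟨ cong T (solve 2 (λ x c → :1 :* (x :- c) :+ c := x) refl x c) ⟩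
      T x                                ∎)
    where open ≡-Reasoning

  -- As for difference sets: multiplication by u carries S to a translate of itself.
  Multiplier : Line → Fin v → Set
  Multiplier S u = ∃ λ i → ∀ x → S x ≡ S (u ⊗ x ⊝ i)

  multiplier-↑ : ∀ (S : Line) u i → (∀ x → S x ≡ S (u ⊗ x ⊝ i)) → ∀ n x → S x ≡ S (u ↑ n ⊗ x ⊝ i ⊗ geometric u n)
  multiplier-↑ S u i e zero x = cong S (solve 2 (λ x i → x := :1 :* x :- i :* :0) refl x i)
  multiplier-↑ S u i e (suc n) x = trans (multiplier-↑ S u i e n x) (trans (e _)
    (cong S (solve 5 (λ u a x i g → u :* (a :* x :- i :* g) :- i := u :* a :* x :- i :* (:1 :+ u :* g))
      refl u (u ↑ n) x i (geometric u n))))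

  module PrimePowerMultipliers {p} (pr : Prime p) (n : ℕ) (v≡ : v ≡ p ^ n) (p∣v : p ∣ v)
    {S} (sid : IsSidon S) {s₁ s₂} (Ss₁ : S s₁ ≡ true) (Ss₂ : S s₂ ≡ true) (δ-unit : Unit (s₁ ⊝ s₂)) where

    open PrimePower pr n v≡ p∣v

    p·unit-cancel : ∀ {ε} → Unit ε → ∀ x → x ⊗ ([ p ] ⊗ ε) ≡ [ 0 ] → [ p ] ⊗ x ≡ [ 0 ]
    p·unit-cancel {ε} ε-unit x e = ⊗-cancel-unit ε-unit ([ p ] ⊗ x)
      (trans (solve 3 (λ p x ε → p :* x :* ε := x :* (p :* ε)) refl [ p ] x ε) e)

    -- The map φ s = u s − i permutes S and φᵖ is a translation, hence trivial, so p i = 0;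
    -- then s, φ s, φ (φ s) is an arithmetic progression in S, which forces φ s = s.
    multiplier-order-p : ∀ {w′} (let u = [ 1 ] ⊕ [ p ] ⊗ w′) → ∀ {ε} → Unit ε → geometric u p ≡ [ p ] ⊗ ε →
      Multiplier S u → u ↑ p ≡ [ 1 ] → [ p ] ⊗ w′ ≡ [ 0 ]
    multiplier-order-p {w′} {ε} ε-unit geo (i , mul) uᵖ≡1 =
      -- As φ fixes s₁ and s₂, w s₁ = i = w s₂, and the unit s₁ - s₂ cancels from w (s₁ - s₂) = 0.
      ⊗-cancel-unit δ-unit w (trans (solve 3 (λ w a b → w :* (a :- b) := w :* a :- w :* b) refl w s₁ s₂)
        (trans (cong₂ _⊝_ (⊝≡0⇒≡ (shift≡0 Ss₁)) (⊝≡0⇒≡ (shift≡0 Ss₂))) (solve 1 (λ i → i :- i := :0) refl i)))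
      where
      open ≡-Reasoning
      w = [ p ] ⊗ w′
      u = [ 1 ] ⊕ w
      pw≡0 : [ p ] ⊗ w ≡ [ 0 ]
      pw≡0 = p·unit-cancel ε-unit w (begin
        w ⊗ ([ p ] ⊗ ε)            ≡⟨ cong (w ⊗_) (sym geo) ⟩
        w ⊗ geometric u p          ≡⟨ solve 2 (λ w g → w :* g := (:1 :+ w :- :1) :* g) refl w (geometric u p) ⟩
        (u ⊝ [ 1 ]) ⊗ geometric u p ≡⟨ geometric-telescope u p ⟩
        u ↑ p ⊝ [ 1 ]              ≡⟨ cong (_⊝ [ 1 ]) uᵖ≡1 ⟩
        [ 1 ] ⊝ [ 1 ]              ≡⟨ solve 0 (:1 :- :1 := :0) refl ⟩
        [ 0 ]                      ∎)
      pi≡0 : [ p ] ⊗ i ≡ [ 0 ]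
      pi≡0 = p·unit-cancel ε-unit i (trans (cong (i ⊗_) (sym geo))
        (translation-invariant⇒0 sid Ss₁ (i ⊗ geometric u p) λ x → trans (multiplier-↑ S u i mul p x)
          (cong S (trans (cong (λ y → y ⊗ x ⊝ i ⊗ geometric u p) uᵖ≡1)
            (cong (_⊝ i ⊗ geometric u p) (⊗-identityˡ x))))))
      shift≡0 : ∀ {s} → S s ≡ true → w ⊗ s ⊝ i ≡ [ 0 ]
      shift≡0 {s} Ss = sidon-progression sid d Ss Ss+d Ss+2d
        where
        d = w ⊗ s ⊝ i
        step : ∀ x → u ⊗ x ⊝ i ≡ x ⊕ (w ⊗ x ⊝ i)
        step x = solve 3 (λ w x i → (:1 :+ w) :* x :- i := x :+ (w :* x :- i)) refl w x i
        -- The second step of φ differs from the first by w d, so this makes s, φ s, φ (φ s) equally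
        -- spaced.
        wd≡0 : w ⊗ d ≡ [ 0 ]
        wd≡0 = begin
          [ p ] ⊗ w′ ⊗ (w ⊗ s ⊝ i)                        ≡⟨ solve 5 (λ p w′ w s i → p :* w′ :* (w :* s :- i) := w′ :* s :* (p :* w) :- w′ :* (p :* i)) refl [ p ] w′ w s i ⟩
          w′ ⊗ s ⊗ ([ p ] ⊗ w) ⊝ w′ ⊗ ([ p ] ⊗ i)         ≡⟨ cong₂ (λ a b → w′ ⊗ s ⊗ a ⊝ w′ ⊗ b) pw≡0 pi≡0 ⟩
          w′ ⊗ s ⊗ [ 0 ] ⊝ w′ ⊗ [ 0 ]                     ≡⟨ solve 2 (λ a b → a :* b :* :0 :- a :* :0 := :0) refl w′ s ⟩
          [ 0 ]                                           ∎
        Ss+d : S (s ⊕ d) ≡ true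
        Ss+d = trans (cong S (sym (step s))) (trans (sym (mul s)) Ss)
        Ss+2d : S (s ⊕ d ⊕ d) ≡ true
        Ss+2d = trans (cong S (sym (begin
          u ⊗ (s ⊕ d) ⊝ i              ≡⟨ step (s ⊕ d) ⟩
          s ⊕ d ⊕ (w ⊗ (s ⊕ d) ⊝ i)    ≡⟨ solve 4 (λ w s d i → s :+ d :+ (w :* (s :+ d) :- i) := s :+ d :+ (w :* s :- i :+ w :* d)) refl w s d i ⟩
          s ⊕ d ⊕ (d ⊕ w ⊗ d)          ≡⟨ cong (λ y → s ⊕ d ⊕ (d ⊕ y)) wd≡0 ⟩
          s ⊕ d ⊕ (d ⊕ [ 0 ])          ≡⟨ solve 2 (λ s d → s :+ d :+ (d :+ :0) := s :+ d :+ d) refl s d ⟩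
          s ⊕ d ⊕ d                    ∎))) (trans (sym (mul (s ⊕ d))) Ss+d)

    module _ {q} (q∣ : ∃ λ q′ → q ≡ [ p ] ⊗ q′)
      (geo : ∀ w′ → ∃ λ ε → Unit ε × geometric ([ 1 ] ⊕ q ⊗ w′) p ≡ [ p ] ⊗ ε) where

      -- Induction on r: the p-th power of u is again a multiplier of the form 1 + q w″, hence 1 by
      -- induction, and `multiplier-order-p` finishes. The modulus q will be p for odd p and 4 for p
      -- = 2.
      multiplier-trivial : ∀ r w′ (let u = [ 1 ] ⊕ q ⊗ w′) → Multiplier S u → u ↑ (p ^ r) ≡ [ 1 ] → u ≡ [ 1 ]
      multiplier-trivial zero w′ _ e = trans (solve 1 (λ u → u := u :* :1) refl _) e
      multiplier-trivial (suc r) w′ (i , mul) e = trans (cong ([ 1 ] ⊕_) (trans q·w′≡ w≡0))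
          (solve 0 (:1 :+ :0 := :1) refl)
        where
        open ≡-Reasoning
        u = [ 1 ] ⊕ q ⊗ w′
        q′ = proj₁ q∣
        q·w′≡ : q ⊗ w′ ≡ [ p ] ⊗ (q′ ⊗ w′)
        q·w′≡ = trans (cong (_⊗ w′) (proj₂ q∣)) (⊗-assoc [ p ] q′ w′)
        w″ = w′ ⊗ geometric u p
        uᵖ≡ : u ↑ p ≡ [ 1 ] ⊕ q ⊗ w″
        uᵖ≡ = begin
          u ↑ p                                      ≡⟨ solve 1 (λ a → a := :1 :+ (a :- :1)) refl (u ↑ p) ⟩
          [ 1 ] ⊕ (u ↑ p ⊝ [ 1 ])                    ≡⟨ cong ([ 1 ] ⊕_) (sym (geometric-telescope u p)) ⟩
          [ 1 ] ⊕ (u ⊝ [ 1 ]) ⊗ geometric u p        ≡⟨ solve 3 (λ q w g → :1 :+ (:1 :+ q :* w :- :1) :* g := :1 :+ q :* (w :* g)) refl q w′ (geometric u p) ⟩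
          [ 1 ] ⊕ q ⊗ w″                             ∎
        uᵖ≡1 : u ↑ p ≡ [ 1 ]
        uᵖ≡1 = trans uᵖ≡ (multiplier-trivial r w″
          (i ⊗ geometric u p , λ x → trans (multiplier-↑ S u i mul p x) (cong (λ y → S (y ⊗ x ⊝ i ⊗ geometric u p)) uᵖ≡))
          (trans (cong (_↑ (p ^ r)) (sym uᵖ≡)) (trans (sym (↑-* u p (p ^ r))) e)))
        w≡0 : [ p ] ⊗ (q′ ⊗ w′) ≡ [ 0 ]
        w≡0 with geo w′
        ... | ε , ε-unit , g = multiplier-order-p {q′ ⊗ w′} ε-unit
          (trans (cong (λ y → geometric ([ 1 ] ⊕ y) p) (sym q·w′≡)) g)
          (i , λ x → trans (mul x) (cong (λ y → S (([ 1 ] ⊕ y) ⊗ x ⊝ i)) q·w′≡))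
          (trans (cong (λ y → ([ 1 ] ⊕ y) ↑ p) (sym q·w′≡)) uᵖ≡1)

-- Conjugates of translations, and v a prime power

2∣n⊎2∣1+n : ∀ n → 2 ∣ n ⊎ 2 ∣ suc n
2∣n⊎2∣1+n zero    = inj₁ (2 ∣0)
2∣n⊎2∣1+n (suc n) with 2∣n⊎2∣1+n n
... | inj₁ 2∣n  = inj₂ (∣m∣n⇒∣m+n ∣-refl 2∣n)
... | inj₂ 2∣1+n = inj₁ 2∣1+n

module Conjugates (v : ℕ) .{{_ : NonZero v}} where

  open ZMod v
  open Units v
  open Development v
  open Sidon v

  module _ {S T m₀} (h : Iso S T m₀) where

    -- A translation by r ≠ 0 has no fixed point, hence neither has its pullback. Wrong slopes are
    -- excluded below by exhibiting such a point.
    conjugate-fixed-point : ∀ r x → to (conjugate h r) x ≡ x → r ≡ [ 0 ]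
    conjugate-fixed-point r x e = trans (solve 2 (λ y r → r := y :+ r :- y) refl (to h x) r)
      (trans (cong (_⊝ to h x) (trans (sym (to-from h _)) (cong (to h) e))) (solve 1 (λ y → y :- y := :0) refl (to h x)))

    -- The translation by 1 is a single cycle through all points, hence so is its pullback.
    conjugate-1-invariant : ∀ {P : Fin v → Set} → P [ 0 ] → (∀ {x} → P x → P (to (conjugate h [ 1 ]) x)) → ∀ y → P y
    conjugate-1-invariant {P} P0 step y = subst P hit (go (toℕ z))
      where
      z = to h y ⊝ to h [ 0 ]
      go : ∀ n → P (from h (to h [ 0 ] ⊕ [ n ]))
      go zero    = subst P (sym (trans (cong (from h) (solve 1 (λ y → y :+ :0 := y) refl (to h [ 0 ]))) (from-to h [ 0 ]))) P0
      go (suc n) = subst P (cong (from h) (trans (cong (_⊕ [ 1 ]) (to-from h _))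
        (trans (solve 2 (λ a n → a :+ n :+ :1 := a :+ (:1 :+ n)) refl (to h [ 0 ]) [ n ])
          (cong (to h [ 0 ] ⊕_) (sym ([]-+ 1 n)))))) (step (go n))
      hit : from h (to h [ 0 ] ⊕ [ toℕ z ]) ≡ y
      hit = trans (cong (from h) (trans (cong (to h [ 0 ] ⊕_) ([]-toℕ z))
        (solve 2 (λ a b → a :+ (b :- a) := b) refl (to h [ 0 ]) (to h y)))) (from-to h y)

    conjugate-fold : ∀ r n x →
      fold x (to (conjugate h r)) n ≡ from h (to h x ⊕ [ n ] ⊗ r)
    conjugate-fold r zero x = sym (trans (cong (from h) (solve 2 (λ y r → y :+ :0 :* r := y) refl (to h x) r)) (from-to h x))
    conjugate-fold r (suc n) x = cong (from h) (begin
      to h (fold x (to (conjugate h r)) n) ⊕ r     ≡⟨ cong (λ y → to h y ⊕ r) (conjugate-fold r n x) ⟩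
      to h (from h (to h x ⊕ [ n ] ⊗ r)) ⊕ r       ≡⟨ cong (_⊕ r) (to-from h _) ⟩
      to h x ⊕ [ n ] ⊗ r ⊕ r                       ≡⟨ solve 3 (λ y n r → y :+ n :* r :+ r := y :+ (:1 :+ n) :* r) refl (to h x) [ n ] r ⟩
      to h x ⊕ ([ 1 ] ⊕ [ n ]) ⊗ r                 ≡⟨ cong (λ k → to h x ⊕ k ⊗ r) (sym ([]-+ 1 n)) ⟩
      to h x ⊕ [ suc n ] ⊗ r                       ∎)
      where open ≡-Reasoning

    conjugate-fold-period : ∀ r n → [ n ] ⊗ r ≡ [ 0 ] → ∀ x →
      fold x (to (conjugate h r)) n ≡ x
    conjugate-fold-period r n e x = trans (conjugate-fold r n x) (trans (cong (from h) (trans (cong (to h x ⊕_) e)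
      (solve 1 (λ y → y :+ :0 := y) refl (to h x)))) (from-to h x))

    from-shift : ∀ {r j} → (∀ x → to (conjugate h r) x ≡ x ⊕ j) → ∀ y → from h (y ⊕ r) ≡ from h y ⊕ j
    from-shift {r} e y = trans (cong (λ z → from h (z ⊕ r)) (sym (to-from h y))) (e (from h y))

    to-shift : ∀ {r j} → (∀ x → to (conjugate h r) x ≡ x ⊕ j) → ∀ x → to h (x ⊕ j) ≡ to h x ⊕ r
    to-shift e x = trans (cong (to h) (sym (e x))) (to-from h _)

  module PrimePowerCore {p} (pr : Prime p) (n : ℕ) (v≡ : v ≡ p ^ n) (p∣v : p ∣ v)
    {S} (sid : IsSidon S) {s₁ s₂} (Ss₁ : S s₁ ≡ true) (Ss₂ : S s₂ ≡ true) (δ-unit : Unit (s₁ ⊝ s₂)) where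

    open PrimePower pr n v≡ p∣v
    open PrimePowerMultipliers pr n v≡ p∣v sid Ss₁ Ss₂ δ-unit
    open ≡-Reasoning

    private
      1≢0′ : [ 1 ] ≢ [ 0 ]
      1≢0′ = 1≢0 pr p∣v

    -- For odd p both correction terms of `geometric-expansion` are divisible by p², the linear one
    -- because p divides `triangular p`.
    geometric-odd : p ≢ 2 → ∀ w′ → ∃ λ ε → Unit ε × geometric ([ 1 ] ⊕ [ p ] ⊗ w′) p ≡ [ p ] ⊗ ε
    geometric-odd p≢2 w′ with geometric-expansion ([ p ] ⊗ w′) p | odd-prime∣triangular pr p≢2
    ... | k , e | divides t tri≡ = [ 1 ] ⊕ [ p ] ⊗ (w′ ⊗ [ t ] ⊕ w′ ⊗ w′ ⊗ k) , 1+multiple-unit _ , (begin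
      geometric ([ 1 ] ⊕ [ p ] ⊗ w′) p
        ≡⟨ e ⟩
      [ p ] ⊕ [ p ] ⊗ w′ ⊗ [ triangular p ] ⊕ [ p ] ⊗ w′ ⊗ ([ p ] ⊗ w′) ⊗ k
        ≡⟨ cong (λ z → [ p ] ⊕ [ p ] ⊗ w′ ⊗ z ⊕ [ p ] ⊗ w′ ⊗ ([ p ] ⊗ w′) ⊗ k) (trans (cong [_] tri≡) ([]-* t p)) ⟩
      [ p ] ⊕ [ p ] ⊗ w′ ⊗ ([ t ] ⊗ [ p ]) ⊕ [ p ] ⊗ w′ ⊗ ([ p ] ⊗ w′) ⊗ k
        ≡⟨ solve 4 (λ p w t k → p :+ p :* w :* (t :* p) :+ p :* w :* (p :* w) :* k :=
             p :* (:1 :+ p :* (w :* t :+ w :* w :* k))) refl [ p ] w′ [ t ] k ⟩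
      [ p ] ⊗ ([ 1 ] ⊕ [ p ] ⊗ (w′ ⊗ [ t ] ⊕ w′ ⊗ w′ ⊗ k)) ∎)

    module Even (p≡2 : p ≡ 2) where

      two : [ p ] ≡ [ 1 ] ⊕ [ 1 ]
      two = trans (cong [_] p≡2) ([]-+ 1 1)

      -- The sum is 1 + u = 2 + 4 w′, twice an odd element; this is what the modulus 4 is for.
      geometric-even : ∀ w′ → ∃ λ ε → Unit ε × geometric ([ 1 ] ⊕ [ p ] ⊗ [ p ] ⊗ w′) p ≡ [ p ] ⊗ ε
      geometric-even w′ = [ 1 ] ⊕ [ p ] ⊗ w′ , 1+multiple-unit w′ , (begin
        geometric u p                          ≡⟨ cong (geometric u) p≡2 ⟩
        [ 1 ] ⊕ u ⊗ ([ 1 ] ⊕ u ⊗ [ 0 ])        ≡⟨ solve 2 (λ p w → let u = :1 :+ p :* p :* w in :1 :+ u :* (:1 :+ u :* :0) := :1 :+ :1 :+ p :* (p :* w)) refl [ p ] w′ ⟩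
        [ 1 ] ⊕ [ 1 ] ⊕ [ p ] ⊗ ([ p ] ⊗ w′)   ≡⟨ cong (_⊕ [ p ] ⊗ ([ p ] ⊗ w′)) (sym two) ⟩
        [ p ] ⊕ [ p ] ⊗ ([ p ] ⊗ w′)           ≡⟨ solve 2 (λ p w → p :+ p :* (p :* w) := p :* (:1 :+ p :* w)) refl [ p ] w′ ⟩
        [ p ] ⊗ ([ 1 ] ⊕ [ p ] ⊗ w′)           ∎)
        where u = [ 1 ] ⊕ [ p ] ⊗ [ p ] ⊗ w′

      even⊎odd : ∀ x → (∃ λ y → x ≡ [ p ] ⊗ y) ⊎ (∃ λ y → [ 1 ] ⊕ x ≡ [ p ] ⊗ y)
      even⊎odd x with 2∣n⊎2∣1+n (toℕ x)
      ... | inj₁ 2∣x = inj₁ (∣⇒multiple x (subst (_∣ toℕ x) (sym p≡2) 2∣x))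
      ... | inj₂ (divides k 1+x≡) = inj₂ ([ k ] , (begin
        [ 1 ] ⊕ x              ≡⟨ cong ([ 1 ] ⊕_) (sym ([]-toℕ x)) ⟩
        [ 1 ] ⊕ [ toℕ x ]      ≡⟨ sym ([]-+ 1 (toℕ x)) ⟩
        [ suc (toℕ x) ]        ≡⟨ cong [_] (trans 1+x≡ (ℕₚ.*-comm k 2)) ⟩
        [ 2 * k ]              ≡⟨ cong (λ t → [ t * k ]) (sym p≡2) ⟩
        [ p * k ]              ≡⟨ []-* p k ⟩
        [ p ] ⊗ [ k ]          ∎))

      -- If 2 vanished, s₁ - s₂ would equal its negative, so by the Sidon property it would be 0,
      -- which is no unit.
      2≢0 : [ p ] ≢ [ 0 ]
      2≢0 e = 1≢0′ (trans (sym (proj₂ δ-unit)) (trans (cong (_⊗ proj₁ δ-unit) δ≡0)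
          (solve 1 (λ y → :0 :* y := :0) refl (proj₁ δ-unit))))
        where
        opposite : s₁ ⊝ s₂ ≡ s₂ ⊝ s₁
        opposite = begin
          s₁ ⊝ s₂                                   ≡⟨ solve 2 (λ a b → a :- b := b :- a :+ (:1 :+ :1) :* (a :- b)) refl s₁ s₂ ⟩
          s₂ ⊝ s₁ ⊕ ([ 1 ] ⊕ [ 1 ]) ⊗ (s₁ ⊝ s₂)     ≡⟨ cong (λ z → s₂ ⊝ s₁ ⊕ z ⊗ (s₁ ⊝ s₂)) (trans (sym two) e) ⟩
          s₂ ⊝ s₁ ⊕ [ 0 ] ⊗ (s₁ ⊝ s₂)               ≡⟨ solve 2 (λ a b → b :- a :+ :0 :* (a :- b) := b :- a) refl s₁ s₂ ⟩
          s₂ ⊝ s₁                                   ∎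
        δ≡0 : s₁ ⊝ s₂ ≡ [ 0 ]
        δ≡0 with s₁ Finₚ.≟ s₂
        ... | yes s₁≡s₂ = trans (cong (_⊝ s₂) s₁≡s₂) (solve 1 (λ a → a :- a := :0) refl s₂)
        ... | no  s₁≢s₂ = contradiction (differences-distinct sid Ss₁ Ss₂ Ss₂ Ss₁ opposite s₁≢s₂) s₁≢s₂

      -- Otherwise 4ℤ ∪ (j + 4ℤ) would be a proper subset invariant under the cycle x ↦ (1 + 2 w) x + j.
      cycle⇒4∣ : ∀ w j → (∀ (P : Fin v → Set) → P [ 0 ] → (∀ {x} → P x → P (j ⊕ ([ 1 ] ⊕ [ p ] ⊗ w) ⊗ x)) → ∀ y → P y) →
        ∃ λ w′ → w ≡ [ p ] ⊗ w′
      cycle⇒4∣ w j transitive with even⊎odd w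
      ... | inj₁ even = even
      ... | inj₂ (y₂ , 1+w≡) = contradiction (transitive A (inj₁ ([ 0 ] , solve 1 (λ p → :0 := p :* p :* :0) refl [ p ])) A-step) notAll
        where
        4Z : Fin v → Set
        4Z x = ∃ λ y → x ≡ [ p ] ⊗ [ p ] ⊗ y
        A : Fin v → Set
        A x = 4Z x ⊎ 4Z (x ⊝ j)
        u = [ 1 ] ⊕ [ p ] ⊗ w
        A-step : ∀ {x} → A x → A (j ⊕ u ⊗ x)
        A-step {x} (inj₁ (y , x≡)) = inj₂ (u ⊗ y , trans (cong (λ z → j ⊕ u ⊗ z ⊝ j) x≡)
          (solve 4 (λ j u p y → j :+ u :* (p :* p :* y) :- j := p :* p :* (u :* y)) refl j u [ p ] y))
        -- For odd w, 1 + u = 2 (1 + w) = 4 y₂, and j + u x = (1 + u) j + u (x - j): the coset j +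
        -- 4ℤ goes to 4ℤ.
        A-step {x} (inj₂ (y , x≡)) = inj₁ (y₂ ⊗ j ⊕ u ⊗ y , (begin
          j ⊕ u ⊗ x                                                ≡⟨ solve 4 (λ p w j x → let u = :1 :+ p :* w in j :+ u :* x := (:1 :+ :1 :+ p :* w) :* j :+ u :* (x :- j)) refl [ p ] w j x ⟩
          ([ 1 ] ⊕ [ 1 ] ⊕ [ p ] ⊗ w) ⊗ j ⊕ u ⊗ (x ⊝ j)            ≡⟨ cong₂ (λ a b → (a ⊕ [ p ] ⊗ w) ⊗ j ⊕ u ⊗ b) (sym two) x≡ ⟩
          ([ p ] ⊕ [ p ] ⊗ w) ⊗ j ⊕ u ⊗ ([ p ] ⊗ [ p ] ⊗ y)        ≡⟨ solve 5 (λ p w j u y → (p :+ p :* w) :* j :+ u :* (p :* p :* y) := p :* (:1 :+ w) :* j :+ u :* (p :* p :* y)) refl [ p ] w j u y ⟩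
          [ p ] ⊗ ([ 1 ] ⊕ w) ⊗ j ⊕ u ⊗ ([ p ] ⊗ [ p ] ⊗ y)        ≡⟨ cong (λ z → [ p ] ⊗ z ⊗ j ⊕ u ⊗ ([ p ] ⊗ [ p ] ⊗ y)) 1+w≡ ⟩
          [ p ] ⊗ ([ p ] ⊗ y₂) ⊗ j ⊕ u ⊗ ([ p ] ⊗ [ p ] ⊗ y)       ≡⟨ solve 5 (λ p y₂ j u y → p :* (p :* y₂) :* j :+ u :* (p :* p :* y) := p :* p :* (y₂ :* j :+ u :* y)) refl [ p ] y₂ j u y ⟩
          [ p ] ⊗ [ p ] ⊗ (y₂ ⊗ j ⊕ u ⊗ y)                         ∎))
        1∉4Z : ¬ 4Z [ 1 ]
        1∉4Z (y , e) = prime∤1 pr p∣v ([ p ] ⊗ y) (trans (sym (⊗-assoc [ p ] [ p ] y)) (sym e))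
        2∉4Z : ¬ 4Z [ p ]
        2∉4Z (y , e) = 2≢0 (⊗-cancel-unit (1+multiple-unit (⊖ y)) [ p ]
          (trans (solve 2 (λ p y → p :* (:1 :+ p :* :- y) := p :- p :* p :* y) refl [ p ] y)
            (trans (cong (_⊝ [ p ] ⊗ [ p ] ⊗ y) e) (solve 1 (λ z → z :- z := :0) refl ([ p ] ⊗ [ p ] ⊗ y)))))
        -- 1 and 2 lie outside 4ℤ, and not both in j + 4ℤ, since their difference is no multiple of
        -- 4.
        notAll : ¬ (∀ y → A y)
        notAll all with all [ 1 ] | all [ p ]
        ... | inj₁ z | _ = 1∉4Z z
        ... | inj₂ _ | inj₁ z = 2∉4Z z
        ... | inj₂ (y , e) | inj₂ (y′ , e′) = 1∉4Z (y′ ⊝ y , (begin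
          [ 1 ]                                              ≡⟨ solve 1 (λ j → :1 := :1 :+ :1 :- j :- (:1 :- j)) refl j ⟩
          [ 1 ] ⊕ [ 1 ] ⊝ j ⊝ ([ 1 ] ⊝ j)                    ≡⟨ cong₂ (λ a b → a ⊝ j ⊝ b) (sym two) e ⟩
          [ p ] ⊝ j ⊝ [ p ] ⊗ [ p ] ⊗ y                      ≡⟨ cong (_⊝ [ p ] ⊗ [ p ] ⊗ y) e′ ⟩
          [ p ] ⊗ [ p ] ⊗ y′ ⊝ [ p ] ⊗ [ p ] ⊗ y             ≡⟨ solve 3 (λ p a b → p :* p :* a :- p :* p :* b := p :* p :* (a :- b)) refl [ p ] y′ y ⟩
          [ p ] ⊗ [ p ] ⊗ (y′ ⊝ y)                           ∎))

    module _ {T} (h : Iso S T [ 0 ]) (norm : Normalises [ 1 ] (conjugate h [ 1 ])) where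

      private
        α : Fin v → Fin v
        α = to (conjugate h [ 1 ])

        u j : Fin v
        u = proj₁ (proj₁ norm)
        j = α [ 0 ]

        α-affine : ∀ x → α x ≡ j ⊕ u ⊗ x
        α-affine = equivariant-1⇒affine α u (proj₂ (proj₁ norm))

        α-iterate : ∀ n x → fold x α n ≡ u ↑ n ⊗ x ⊕ j ⊗ geometric u n
        α-iterate zero x = solve 2 (λ x j → x := :1 :* x :+ j :* :0) refl x j
        α-iterate (suc n) x = begin
          α (fold x α n)                                     ≡⟨ α-affine (fold x α n) ⟩
          j ⊕ u ⊗ fold x α n                                 ≡⟨ cong (λ z → j ⊕ u ⊗ z) (α-iterate n x) ⟩
          j ⊕ u ⊗ (u ↑ n ⊗ x ⊕ j ⊗ geometric u n)            ≡⟨ solve 5 (λ u a x j g → j :+ u :* (a :* x :+ j :* g) := u :* a :* x :+ j :* (:1 :+ u :* g)) refl u (u ↑ n) x j (geometric u n) ⟩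
          u ⊗ u ↑ n ⊗ x ⊕ j ⊗ ([ 1 ] ⊕ u ⊗ geometric u n)    ∎

        α-period : ∀ x → u ↑ v ⊗ x ⊕ j ⊗ geometric u v ≡ x
        α-period x = trans (sym (α-iterate v x)) (conjugate-fold-period h [ 1 ] v
          (trans (cong (_⊗ [ 1 ]) ([]≡0 ∣-refl)) (solve 0 (:0 :* :1 := :0) refl)) x)

        -- The v-th iterate of the cycle is the identity; comparing its values at 1 and 0 isolates
        -- the slope.
        u↑v≡1 : u ↑ v ≡ [ 1 ]
        u↑v≡1 = begin
          u ↑ v                                                                  ≡⟨ solve 2 (λ a g → a := a :* :1 :+ g :- (a :* :0 :+ g)) refl (u ↑ v) (j ⊗ geometric u v) ⟩
          u ↑ v ⊗ [ 1 ] ⊕ j ⊗ geometric u v ⊝ (u ↑ v ⊗ [ 0 ] ⊕ j ⊗ geometric u v) ≡⟨ cong₂ _⊝_ (α-period [ 1 ]) (α-period [ 0 ]) ⟩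
          [ 1 ] ⊝ [ 0 ]                                                          ≡⟨ solve 0 (:1 :- :0 := :1) refl ⟩
          [ 1 ]                                                                  ∎

        multiplier : Multiplier S u
        multiplier = k ⊝ j , λ x → begin
          S x                            ≡⟨ cong S (solve 1 (λ x → x := x :- :0) refl x) ⟩
          S (x ⊝ [ 0 ])                  ≡⟨ proj₂ (LeftInverse.preserves (fwd (conjugate h [ 1 ])) [ 0 ]) x ⟩
          S (α x ⊝ k)                    ≡⟨ cong (λ y → S (y ⊝ k)) (α-affine x) ⟩
          S (j ⊕ u ⊗ x ⊝ k)              ≡⟨ cong S (solve 3 (λ j y k → j :+ y :- k := y :- (k :- j)) refl j (u ⊗ x) k) ⟩
          S (u ⊗ x ⊝ (k ⊝ j))            ∎
          where k = proj₁ (LeftInverse.preserves (fwd (conjugate h [ 1 ])) [ 0 ])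

        u≡1+pw : ∃ λ w → u ≡ [ 1 ] ⊕ [ p ] ⊗ w
        u≡1+pw with multiple⊎unit (u ⊝ [ 1 ])
        ... | inj₁ (w , e) = w , trans (solve 1 (λ u → u := :1 :+ (u :- :1)) refl u) (cong ([ 1 ] ⊕_) e)
        -- If u - 1 had the inverse y, then -j y would solve u x + j = x.
        ... | inj₂ (y , e) = contradiction (conjugate-fixed-point h [ 1 ] (⊖ (j ⊗ y)) (begin
          α (⊖ (j ⊗ y))                             ≡⟨ α-affine _ ⟩
          j ⊕ u ⊗ ⊖ (j ⊗ y)                         ≡⟨ solve 3 (λ j u y → j :+ u :* :- (j :* y) := :- (j :* y) :+ j :* (:1 :- (u :- :1) :* y)) refl j u y ⟩
          ⊖ (j ⊗ y) ⊕ j ⊗ ([ 1 ] ⊝ (u ⊝ [ 1 ]) ⊗ y) ≡⟨ cong (λ z → ⊖ (j ⊗ y) ⊕ j ⊗ ([ 1 ] ⊝ z)) e ⟩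
          ⊖ (j ⊗ y) ⊕ j ⊗ ([ 1 ] ⊝ [ 1 ])           ≡⟨ solve 2 (λ a j → a :+ j :* (:1 :- :1) := a) refl (⊖ (j ⊗ y)) j ⟩
          ⊖ (j ⊗ y)                                 ∎)) 1≢0′

        u↑pⁿ≡1 : u ↑ (p ^ n) ≡ [ 1 ]
        u↑pⁿ≡1 = trans (cong (u ↑_) (sym v≡)) u↑v≡1

        trivial-of-form : ∀ {q} → (∃ λ q′ → q ≡ [ p ] ⊗ q′) →
          (∀ w′ → ∃ λ ε → Unit ε × geometric ([ 1 ] ⊕ q ⊗ w′) p ≡ [ p ] ⊗ ε) →
          ∀ w → u ≡ [ 1 ] ⊕ q ⊗ w → u ≡ [ 1 ]
        trivial-of-form q∣ geo w u≡ = trans u≡ (multiplier-trivial q∣ geo n w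
          (subst (Multiplier S) u≡ multiplier) (subst (λ z → z ↑ (p ^ n) ≡ [ 1 ]) u≡ u↑pⁿ≡1))

        u≡1 : u ≡ [ 1 ]
        u≡1 with p ℕₚ.≟ 2 | u≡1+pw
        ... | no p≢2  | w , u≡ =
          trivial-of-form ([ 1 ] , solve 1 (λ p → p := p :* :1) refl [ p ]) (geometric-odd p≢2) w u≡
        -- `geometric-even` needs u to be 1 modulo 4, which holds because the affine map is a single
        -- cycle.
        ... | yes p≡2 | w , u≡ with Even.cycle⇒4∣ p≡2 w j (λ P P0 step → conjugate-1-invariant h {P} P0
              (λ {x} Px → subst P (trans (cong (λ z → j ⊕ z ⊗ x) (sym u≡)) (sym (α-affine x))) (step Px)))
        ...   | w′ , w≡ = trivial-of-form ([ p ] , refl) (Even.geometric-even p≡2) w′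
          (trans u≡ (cong ([ 1 ] ⊕_) (trans (cong ([ p ] ⊗_) w≡) (sym (⊗-assoc [ p ] [ p ] w′)))))

        α-translation : ∀ x → α x ≡ x ⊕ j
        α-translation x = trans (α-affine x) (trans (cong (λ z → j ⊕ z ⊗ x) u≡1)
          (solve 2 (λ j x → j :+ :1 :* x := x :+ j) refl j x))

      -- The pulled-back translation is the translation by j, so h turns steps of j into steps of 1.
      -- From 0, h 1 - h 0 steps of j lead to 1; so j is a unit, and a step of 1 is a multiple of a
      -- step of j.
      self-normalising : Normalises [ 1 ] h
      self-normalising = (z , to-eq) , (j , λ y → trans (from-shift h α-translation y) (cong (from h y ⊕_) (sym (⊗-identityˡ j))))
        where
        z = to h [ 1 ] ⊝ to h [ 0 ]
        linear : ∀ t x → to h (x ⊕ j ⊗ t) ≡ to h x ⊕ [ 1 ] ⊗ t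
        linear = translation-linear (to h) j [ 1 ] (to-shift h α-translation)
        jz≡1 : j ⊗ z ≡ [ 1 ]
        jz≡1 = to-injective h (begin
          to h (j ⊗ z)                   ≡⟨ cong (to h) (sym (⊕-identityˡ (j ⊗ z))) ⟩
          to h ([ 0 ] ⊕ j ⊗ z)           ≡⟨ linear z [ 0 ] ⟩
          to h [ 0 ] ⊕ [ 1 ] ⊗ z         ≡⟨ solve 2 (λ a b → a :+ :1 :* (b :- a) := b) refl (to h [ 0 ]) (to h [ 1 ]) ⟩
          to h [ 1 ]                     ∎)
        to-eq : ∀ x → to h (x ⊕ [ 1 ]) ≡ to h x ⊕ [ 1 ] ⊗ z
        to-eq x = trans (cong (λ y → to h (x ⊕ y)) (sym jz≡1)) (linear z x)

    prime-power-related : ∀ {T} → Iso S T [ 0 ] → MultiplierRelated S T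
    prime-power-related f = affine-iso⇒related (proj₁ found) (proj₂ found)
      where
      found = normalising-iso pr n [ 1 ] [ 1 ] (trans (cong (λ m → [ m ] ⊗ [ 1 ]) (sym v≡))
        (trans (cong (_⊗ [ 1 ]) ([]≡0 ∣-refl)) (solve 0 (:0 :* :1 := :0) refl))) f self-normalising

-- v a product of two distinct primes

module TwoPrimes (v : ℕ) .{{_ : NonZero v}} {p q : ℕ} (p-prime : Prime p) (q-prime : Prime q)
  (p<q : p < q) (v≡pq : v ≡ p * q) where

  open ZMod v
  open Units v
  open Development v
  open Sidon v
  open Conjugates v
  open ≡-Reasoning

  private
    instance
      p-nonZero : NonZero p
      p-nonZero = prime⇒nonZero p-prime

    p∣v : p ∣ v
    p∣v = subst (p ∣_) (sym v≡pq) (m∣m*n q)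

    q∣v : q ∣ v
    q∣v = subst (q ∣_) (sym v≡pq) (n∣m*n p)

    P Q : Fin v
    P = [ p ]
    Q = [ q ]

    PQ≡0 : P ⊗ Q ≡ [ 0 ]
    PQ≡0 = trans (sym ([]-* p q)) ([]≡0 (subst (_∣ p * q) (sym v≡pq) ∣-refl))

  -- With t the cofactor of r, equality after multiplication by `[ t ]` expresses congruence modulo
  -- r: the second alternative is invertibility modulo r.
  multiple⊎invertible : ∀ {r t} → Prime r → [ t ] ⊗ [ r ] ≡ [ 0 ] → ∀ x →
    (∃ λ y → x ≡ [ r ] ⊗ y) ⊎ (∃ λ y → [ t ] ⊗ x ⊗ y ≡ [ t ])
  multiple⊎invertible {r} {t} pr tr≡0 x with r ∣? toℕ x
  ... | yes r∣x = inj₁ (∣⇒multiple x r∣x)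
  ... | no  r∤x with coprime-bézout (prime∤⇒coprime pr r∤x)
  ...   | a , b , e = inj₂ (a , (begin
    [ t ] ⊗ x ⊗ a                           ≡⟨ solve 4 (λ t x a rb → t :* x :* a := t :* (x :* a :+ rb) :- t :* rb) refl [ t ] x a ([ r ] ⊗ b) ⟩
    [ t ] ⊗ (x ⊗ a ⊕ [ r ] ⊗ b) ⊝ [ t ] ⊗ ([ r ] ⊗ b)    ≡⟨ cong₂ (λ y z → [ t ] ⊗ y ⊝ z) (trans (cong (λ y → y ⊗ a ⊕ [ r ] ⊗ b) (sym ([]-toℕ x))) e) (trans (sym (⊗-assoc [ t ] [ r ] b)) (cong (_⊗ b) tr≡0)) ⟩
    [ t ] ⊗ [ 1 ] ⊝ [ 0 ] ⊗ b               ≡⟨ solve 2 (λ t b → t :* :1 :- :0 :* b := t) refl [ t ] b ⟩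
    [ t ]                                   ∎))

  private
    dich-p : ∀ x → (∃ λ y → x ≡ P ⊗ y) ⊎ (∃ λ y → Q ⊗ x ⊗ y ≡ Q)
    dich-p = multiple⊎invertible p-prime (trans (⊗-comm Q P) PQ≡0)

    dich-q : ∀ x → (∃ λ y → x ≡ Q ⊗ y) ⊎ (∃ λ y → P ⊗ x ⊗ y ≡ P)
    dich-q = multiple⊎invertible q-prime PQ≡0

    coprime-pq : Coprime p q
    coprime-pq = Coprimality.sym (prime⇒coprime q-prime p<q)

    A B : Fin v
    A = proj₁ (coprime-bézout coprime-pq)
    B = proj₁ (proj₂ (coprime-bézout coprime-pq))

    PA+QB≡1 : P ⊗ A ⊕ Q ⊗ B ≡ [ 1 ]
    PA+QB≡1 = proj₂ (proj₂ (coprime-bézout coprime-pq))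

    -- Chinese remainders: the components of x in the subgroups of order q and p.
    split : ∀ x → x ≡ P ⊗ (A ⊗ x) ⊕ Q ⊗ (B ⊗ x)
    split x = trans (sym (⊗-identityˡ x)) (trans (cong (_⊗ x) (sym PA+QB≡1))
      (solve 5 (λ p a q b x → (p :* a :+ q :* b) :* x := p :* (a :* x) :+ q :* (b :* x)) refl P A Q B x))

    P≢0 : P ≢ [ 0 ]
    P≢0 P≡0 = prime∤1 q-prime q∣v B (trans (solve 3 (λ a q b → q :* b := :0 :* a :+ q :* b) refl A Q B)
      (trans (cong (λ z → z ⊗ A ⊕ Q ⊗ B) (sym P≡0)) PA+QB≡1))

    Q≢0 : Q ≢ [ 0 ]
    Q≢0 Q≡0 = prime∤1 p-prime p∣v A (trans (solve 3 (λ p a b → p :* a := p :* a :+ :0 :* b) refl P A B)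
      (trans (cong (λ z → P ⊗ A ⊕ z ⊗ B) (sym Q≡0)) PA+QB≡1))

    res : Fin v → Fin p
    res x = toℕ x mod p

    toℕ-res : ∀ x → toℕ (res x) ≡ toℕ x % p
    toℕ-res x = Finₚ.toℕ-fromℕ< (m%n<n (toℕ x) p)

    res-[] : ∀ m → toℕ (res [ m ]) ≡ m % p
    res-[] m = trans (toℕ-res [ m ]) (trans (cong (_% p) (toℕ-[] m)) (m∣n⇒o%n%m≡o%m p v m p∣v))

    res-⊕ : ∀ x y → res (x ⊕ P ⊗ y) ≡ res x
    res-⊕ x y = Finₚ.toℕ-injective (begin
      toℕ (res (x ⊕ P ⊗ y))                    ≡⟨ cong (λ z → toℕ (res z)) (cong₂ (λ a b → a ⊕ P ⊗ b) (sym ([]-toℕ x)) (sym ([]-toℕ y))) ⟩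
      toℕ (res ([ toℕ x ] ⊕ P ⊗ [ toℕ y ]))    ≡⟨ cong (λ z → toℕ (res z)) (trans (cong ([ toℕ x ] ⊕_) (sym ([]-* p (toℕ y)))) (sym ([]-+ (toℕ x) (p * toℕ y)))) ⟩
      toℕ (res [ toℕ x + p * toℕ y ])          ≡⟨ res-[] (toℕ x + p * toℕ y) ⟩
      (toℕ x + p * toℕ y) % p                  ≡⟨ %-remove-+ʳ (toℕ x) {p * toℕ y} {p} (m∣m*n (toℕ y)) ⟩
      toℕ x % p                                ≡⟨ sym (toℕ-res x) ⟩
      toℕ (res x)                              ∎)

    res-lift : ∀ x → ∃ λ y → x ≡ [ toℕ (res x) ] ⊕ P ⊗ y
    res-lift x = [ toℕ x / p ] , (begin
      x                                        ≡⟨ sym ([]-toℕ x) ⟩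
      [ toℕ x ]                                ≡⟨ cong [_] (trans (m≡m%n+[m/n]*n (toℕ x) p) (cong₂ _+_ (sym (toℕ-res x)) (ℕₚ.*-comm (toℕ x / p) p))) ⟩
      [ toℕ (res x) + p * (toℕ x / p) ]        ≡⟨ trans ([]-+ (toℕ (res x)) (p * (toℕ x / p))) (cong ([ toℕ (res x) ] ⊕_) ([]-* p (toℕ x / p))) ⟩
      [ toℕ (res x) ] ⊕ P ⊗ [ toℕ x / p ]      ∎)

    res-≡ : ∀ {x y} → res x ≡ res y → ∃ λ z → x ≡ y ⊕ P ⊗ z
    res-≡ {x} {y} e with res-lift x | res-lift y
    ... | a , ex | b , ey = a ⊝ b , (begin
      x                                          ≡⟨ ex ⟩
      [ toℕ (res x) ] ⊕ P ⊗ a                    ≡⟨ cong (λ r → [ toℕ r ] ⊕ P ⊗ a) e ⟩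
      [ toℕ (res y) ] ⊕ P ⊗ a                    ≡⟨ solve 4 (λ r p a b → r :+ p :* a := r :+ p :* b :+ p :* (a :- b)) refl [ toℕ (res y) ] P a b ⟩
      [ toℕ (res y) ] ⊕ P ⊗ b ⊕ P ⊗ (a ⊝ b)      ≡⟨ cong (_⊕ P ⊗ (a ⊝ b)) (sym ey) ⟩
      y ⊕ P ⊗ (a ⊝ b)                            ∎)

  -- α permutes the p < q residue classes modulo p, and its order there divides the prime q.
  preserves-residues : ∀ (α : Fin v → Fin v) b → (∀ x → α (x ⊕ P) ≡ α x ⊕ P ⊗ b) → (∀ x → fold x α q ≡ x) →
    ∀ x → ∃ λ e → α x ≡ x ⊕ P ⊗ e
  preserves-residues α b α-eq α-per x with res (α x) Finₚ.≟ res x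
  ... | yes e = res-≡ e
  ... | no  ne = contradiction p<q (ℕₚ.≤⇒≯ (Finₚ.injective⇒≤ {f = orbit} orbit-injective))
    where
    f : Fin p → Fin p
    f c = res (α [ toℕ c ])
    f-res : ∀ x → f (res x) ≡ res (α x)
    f-res x with res-lift x
    ... | y , e = begin
      res (α [ toℕ (res x) ])                       ≡⟨ sym (res-⊕ _ (b ⊗ y)) ⟩
      res (α [ toℕ (res x) ] ⊕ P ⊗ (b ⊗ y))         ≡⟨ cong (λ z → res (α [ toℕ (res x) ] ⊕ z)) (sym (⊗-assoc P b y)) ⟩
      res (α [ toℕ (res x) ] ⊕ P ⊗ b ⊗ y)           ≡⟨ cong res (sym (translation-linear α P (P ⊗ b) α-eq y [ toℕ (res x) ])) ⟩
      res (α ([ toℕ (res x) ] ⊕ P ⊗ y))             ≡⟨ cong (λ z → res (α z)) (sym e) ⟩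
      res (α x)                                     ∎
    f-fold : ∀ n → fold (res x) f n ≡ res (fold x α n)
    f-fold zero    = refl
    f-fold (suc n) = trans (cong f (f-fold n)) (f-res (fold x α n))
    distinct : ∀ {i j} → i < j → j < q → fold (res x) f i ≢ fold (res x) f j
    distinct = prime-period-<-distinct f q-prime (trans (f-fold q) (cong res (α-per x))) (λ e → ne (trans (sym (f-res x)) e))
    orbit : Fin q → Fin p
    orbit i = fold (res x) f (toℕ i)
    orbit-injective : ∀ {i j} → orbit i ≡ orbit j → i ≡ j
    orbit-injective {i} {j} e with ℕₚ.<-cmp (toℕ i) (toℕ j)
    ... | tri< i<j _ _ = contradiction e (distinct i<j (Finₚ.toℕ<n j))
    ... | tri≈ _ i≡j _ = Finₚ.toℕ-injective i≡j
    ... | tri> _ _ j<i = contradiction (sym e) (distinct j<i (Finₚ.toℕ<n i))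

  module Core {S} (sid : IsSidon S) {s₁ s₂} (Ss₁ : S s₁ ≡ true) (Ss₂ : S s₂ ≡ true)
    (δ-nonmultiple : ∀ y → s₁ ⊝ s₂ ≢ P ⊗ y) where

    -- q elements of S would have q (q − 1) ≥ v distinct nonzero differences.
    no-q-elements : ∀ (s : Fin q → Fin v) → (∀ {i j} → s i ≡ s j → i ≡ j) → (∀ i → S (s i) ≡ true) → ⊥
    no-q-elements s s-inj s∈S = go q refl s s-inj s∈S
      where
      go : ∀ q₀ → q₀ ≡ q → (s : Fin q₀ → Fin v) → (∀ {i j} → s i ≡ s j → i ≡ j) → (∀ i → S (s i) ≡ true) → ⊥
      go zero    refl = contradiction p<q λ ()
      go (suc r) q≡ s s-inj s∈S with Finₚ.pigeonhole v< diff
        where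
        v< : v < suc (suc r * r)
        v< = s≤s (subst₂ _≤_ (sym (trans v≡pq (trans (ℕₚ.*-comm p q) (cong (_* p) (sym q≡))))) refl
          (ℕₚ.*-monoʳ-≤ (suc r) (ℕₚ.≤-pred (subst (p <_) (sym q≡) p<q))))
        -- The value 0 precedes the q (q - 1) differences, because v = q (q - 1) can occur: only one
        -- further value forces a collision.
        diff : Fin (suc (suc r * r)) → Fin v
        diff zero    = [ 0 ]
        diff (suc k) = let a , c = remQuot r k in s a ⊝ s (punchIn a c)
      ... | zero , suc k , _ , e = let a , c = remQuot r k in
        Finₚ.punchInᵢ≢i a c (sym (s-inj (⊝≡0⇒≡ (sym e))))
      ... | suc k , suc k′ , k<k′ , e = ℕₚ.<⇒≢ k<k′ (cong (λ k → suc (toℕ k)) k≡k′)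
        where
        a = proj₁ (remQuot {suc r} r k) ; c = proj₂ (remQuot {suc r} r k)
        a′ = proj₁ (remQuot {suc r} r k′) ; c′ = proj₂ (remQuot {suc r} r k′)
        a≡a′ : a ≡ a′
        a≡a′ = s-inj (differences-distinct sid (s∈S _) (s∈S _) (s∈S _) (s∈S _) e
          (λ sa≡sb → Finₚ.punchInᵢ≢i a c (sym (s-inj sa≡sb))))
        sb≡sb′ : s (punchIn a c) ≡ s (punchIn a′ c′)
        sb≡sb′ = begin
          s (punchIn a c)                             ≡⟨ solve 2 (λ x y → y := x :- (x :- y)) refl (s a) (s (punchIn a c)) ⟩
          s a ⊝ (s a ⊝ s (punchIn a c))               ≡⟨ cong₂ (λ x d → s x ⊝ d) a≡a′ e ⟩
          s a′ ⊝ (s a′ ⊝ s (punchIn a′ c′))           ≡⟨ solve 2 (λ x y → x :- (x :- y) := y) refl (s a′) (s (punchIn a′ c′)) ⟩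
          s (punchIn a′ c′)                           ∎
        c≡c′ : c ≡ c′
        c≡c′ = Finₚ.punchIn-injective a′ c c′ (trans (cong (λ x → punchIn x c) (sym a≡a′)) (s-inj sb≡sb′))
        k≡k′ : k ≡ k′
        k≡k′ = trans (sym (Finₚ.combine-remQuot {suc r} r k)) (trans (cong₂ combine a≡a′ c≡c′) (Finₚ.combine-remQuot {suc r} r k′))

    module _ (β : Iso S S [ 0 ]) (β-comm : ∀ x → to β (x ⊕ P) ≡ to β x ⊕ P)
      (β-res : ∀ x → ∃ λ e → to β x ≡ x ⊕ P ⊗ e) (β0 : to β [ 0 ] ≡ [ 0 ]) where

      private
        γ : Fin v → Fin v
        γ i = proj₁ (LeftInverse.preserves (fwd β) i)

        γ-line : ∀ n i x → S (x ⊝ i) ≡ S (fold x (to β) n ⊝ fold i γ n)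
        γ-line zero    i x = refl
        γ-line (suc n) i x = trans (γ-line n i x) (proj₂ (LeftInverse.preserves (fwd β) (fold i γ n)) (fold x (to β) n))

        β-linear : ∀ z x → to β (x ⊕ P ⊗ z) ≡ to β x ⊕ P ⊗ z
        β-linear = translation-linear (to β) P P β-comm

        β-fold : ∀ n x → fold x (to β) n ≡ x ⊕ P ⊗ ([ n ] ⊗ proj₁ (β-res x))
        β-fold zero x = solve 3 (λ x p e → x := x :+ p :* (:0 :* e)) refl x P (proj₁ (β-res x))
        β-fold (suc n) x = begin
          to β (fold x (to β) n)                   ≡⟨ cong (to β) (β-fold n x) ⟩
          to β (x ⊕ P ⊗ ([ n ] ⊗ e))               ≡⟨ β-linear ([ n ] ⊗ e) x ⟩
          to β x ⊕ P ⊗ ([ n ] ⊗ e)                 ≡⟨ cong (_⊕ P ⊗ ([ n ] ⊗ e)) (proj₂ (β-res x)) ⟩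
          x ⊕ P ⊗ e ⊕ P ⊗ ([ n ] ⊗ e)              ≡⟨ solve 4 (λ x p n e → x :+ p :* e :+ p :* (n :* e) := x :+ p :* ((:1 :+ n) :* e)) refl x P [ n ] e ⟩
          x ⊕ P ⊗ (([ 1 ] ⊕ [ n ]) ⊗ e)            ≡⟨ cong (λ z → x ⊕ P ⊗ (z ⊗ e)) (sym ([]-+ 1 n)) ⟩
          x ⊕ P ⊗ ([ suc n ] ⊗ e)                  ∎
          where e = proj₁ (β-res x)

        β-period : ∀ x → fold x (to β) q ≡ x
        β-period x = trans (β-fold q x) (trans (cong (x ⊕_) (trans (sym (⊗-assoc P Q _)) (cong (_⊗ proj₁ (β-res x)) PQ≡0)))
          (solve 2 (λ x e → x :+ :0 :* e := x) refl x (proj₁ (β-res x))))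

        -- The q-th iterate of β is the identity, so lines i and `fold i γ q` coincide as sets, and
        -- S has no translational symmetry.
        γ-period : ∀ i → fold i γ q ≡ i
        γ-period i = ⊝≡0⇒≡ (translation-invariant⇒0 sid Ss₁ (fold i γ q ⊝ i) λ x → begin
          S x                                          ≡⟨ cong S (solve 2 (λ x i → x := x :+ i :- i) refl x i) ⟩
          S (x ⊕ i ⊝ i)                                ≡⟨ γ-line q i (x ⊕ i) ⟩
          S (fold (x ⊕ i) (to β) q ⊝ fold i γ q)       ≡⟨ cong (λ z → S (z ⊝ fold i γ q)) (β-period (x ⊕ i)) ⟩
          S (x ⊕ i ⊝ fold i γ q)                       ≡⟨ cong S (solve 3 (λ x i j → x :+ i :- j := x :- (j :- i)) refl x i (fold i γ q)) ⟩
          S (x ⊝ (fold i γ q ⊝ i))                     ∎)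

        -- Otherwise the q lines in the orbit of i are distinct and all pass through y, which places
        -- the q elements y - γᵐ i in S.
        fixed-line : ∀ {y i} → to β y ≡ y → S (y ⊝ i) ≡ true → γ i ≡ i
        fixed-line {y} {i} βy≡y Sy with γ i Finₚ.≟ i
        ... | yes e  = e
        ... | no  ne = ⊥-elim (no-q-elements (λ m → y ⊝ fold i γ (toℕ m)) injective
            (λ m → trans (sym (trans (γ-line (toℕ m) i y) (cong (λ z → S (z ⊝ fold i γ (toℕ m))) (fold-fixed (toℕ m))))) Sy))
          where
          fold-fixed : ∀ n → fold y (to β) n ≡ y
          fold-fixed zero    = refl
          fold-fixed (suc n) = trans (cong (to β) (fold-fixed n)) βy≡y
          distinct : ∀ {a b} → a < b → b < q → fold i γ a ≢ fold i γ b
          distinct = prime-period-<-distinct γ q-prime (γ-period i) ne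
          unshift : ∀ {c d} → y ⊝ c ≡ y ⊝ d → c ≡ d
          unshift {c} {d} e = trans (solve 2 (λ y c → c := y :- (y :- c)) refl y c)
            (trans (cong (y ⊝_) e) (solve 2 (λ y c → y :- (y :- c) := c) refl y d))
          injective : ∀ {a b : Fin q} → y ⊝ fold i γ (toℕ a) ≡ y ⊝ fold i γ (toℕ b) → a ≡ b
          injective {a} {b} e with ℕₚ.<-cmp (toℕ a) (toℕ b)
          ... | tri≈ _ a≡b _ = Finₚ.toℕ-injective a≡b
          ... | tri< a<b _ _ = contradiction (unshift e) (distinct a<b (Finₚ.toℕ<n b))
          ... | tri> _ _ b<a = contradiction (unshift (sym e)) (distinct b<a (Finₚ.toℕ<n a))

        -- β x = x + d with d a multiple of p, and β commutes with the translation by d; so x, β x,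
        -- β (β x) is a progression on line i.
        fixed-on-line : ∀ {i x} → γ i ≡ i → S (x ⊝ i) ≡ true → to β x ≡ x
        fixed-on-line {i} {x} γi≡i Sx = trans (proj₂ (β-res x)) (trans (cong (x ⊕_) d≡0) (solve 1 (λ x → x :+ :0 := x) refl x))
          where
          d = P ⊗ proj₁ (β-res x)
          step : ∀ y → S (y ⊝ i) ≡ true → S (to β y ⊝ i) ≡ true
          step y Sy = trans (cong (λ j → S (to β y ⊝ j)) (sym γi≡i)) (trans (sym (γ-line 1 i y)) Sy)
          S₁ : S (x ⊕ d ⊝ i) ≡ true
          S₁ = trans (cong (λ z → S (z ⊝ i)) (sym (proj₂ (β-res x)))) (step x Sx)
          S₂ : S (x ⊕ d ⊕ d ⊝ i) ≡ true
          S₂ = trans (cong (λ z → S (z ⊝ i)) (sym (trans (β-linear _ x) (cong (_⊕ d) (proj₂ (β-res x)))))) (step (x ⊕ d) S₁)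
          d≡0 : d ≡ [ 0 ]
          d≡0 = sidon-progression sid d Sx
            (trans (cong S (solve 3 (λ x d i → x :- i :+ d := x :+ d :- i) refl x d i)) S₁)
            (trans (cong S (solve 3 (λ x d i → x :- i :+ d :+ d := x :+ d :+ d :- i) refl x d i)) S₂)

        δ = s₁ ⊝ s₂

        -- Walk along δ: line `δ ⊗ [ n ] ⊝ s₂` joins δ n, where it has s₂, to δ (n + 1), where it
        -- has s₁. The fixed point δ n fixes the line, and the line fixes its points.
        fix-δ : ∀ n → to β (δ ⊗ [ n ]) ≡ δ ⊗ [ n ]
        fix-δ zero = trans (cong (to β) (solve 1 (λ d → d :* :0 := :0) refl δ)) (trans β0 (solve 1 (λ d → :0 := d :* :0) refl δ))
        fix-δ (suc n) = subst (λ z → to β z ≡ z)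
          (trans (solve 2 (λ d n → d :* n :+ d := d :* (:1 :+ n)) refl δ [ n ]) (cong (δ ⊗_) (sym ([]-+ 1 n))))
          (fixed-on-line {δ ⊗ [ n ] ⊝ s₂} (fixed-line (fix-δ n)
            (trans (cong S (solve 2 (λ y s → y :- (y :- s) := s) refl (δ ⊗ [ n ]) s₂)) Ss₂))
            (trans (cong S (solve 3 (λ y a b → y :+ (a :- b) :- (y :- b) := a) refl (δ ⊗ [ n ]) s₁ s₂)) Ss₁))

      -- δ is invertible modulo p, so its multiples meet every coset of the subgroup generated by p,
      -- and in each coset one fixed point suffices.
      fixes-all : ∀ x → to β x ≡ x
      fixes-all x with dich-p δ
      ... | inj₁ (y , e) = contradiction e (δ-nonmultiple y)
      ... | inj₂ (y , e) = subst (λ z → to β z ≡ z) (sym decomposition)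
          (trans (β-linear (A ⊗ x) (δ ⊗ z)) (cong (_⊕ P ⊗ (A ⊗ x)) (subst (λ z → to β (δ ⊗ z) ≡ δ ⊗ z) ([]-toℕ z) (fix-δ (toℕ z)))))
        where
        z = Q ⊗ y ⊗ (B ⊗ x)
        decomposition : x ≡ δ ⊗ z ⊕ P ⊗ (A ⊗ x)
        decomposition = begin
          x                                            ≡⟨ split x ⟩
          P ⊗ (A ⊗ x) ⊕ Q ⊗ (B ⊗ x)                    ≡⟨ cong (λ t → P ⊗ (A ⊗ x) ⊕ t ⊗ (B ⊗ x)) (sym e) ⟩
          P ⊗ (A ⊗ x) ⊕ Q ⊗ δ ⊗ y ⊗ (B ⊗ x)            ≡⟨ solve 5 (λ a q d y b → a :+ q :* d :* y :* b := d :* (q :* y :* b) :+ a) refl (P ⊗ (A ⊗ x)) Q δ y (B ⊗ x) ⟩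
          δ ⊗ z ⊕ P ⊗ (A ⊗ x)                          ∎

    module _ {T} (h : Iso S T [ 0 ]) (norm : Normalises P (conjugate h P)) where

      private
        α : Fin v → Fin v
        α = to (conjugate h P)

        b : Fin v
        b = proj₁ (proj₁ norm)

        α-res : ∀ x → ∃ λ e → α x ≡ x ⊕ P ⊗ e
        α-res = preserves-residues α b (proj₂ (proj₁ norm)) (conjugate-fold-period h P q (trans (⊗-comm Q P) PQ≡0))

        e₀ : Fin v
        e₀ = proj₁ (α-res [ 0 ])

        α0 : α [ 0 ] ≡ P ⊗ e₀
        α0 = trans (proj₂ (α-res [ 0 ])) (⊕-identityˡ _)

        -- On the subgroup of order q, α is x ↦ b x + p e₀; if b were not 1 modulo q, it would have
        -- a fixed point there.
        Pb≡P : P ⊗ b ≡ P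
        Pb≡P with dich-q (b ⊝ [ 1 ])
        ... | inj₁ (y , e) = begin
          P ⊗ b                      ≡⟨ solve 2 (λ p b → p :* b := p :+ p :* (b :- :1)) refl P b ⟩
          P ⊕ P ⊗ (b ⊝ [ 1 ])        ≡⟨ cong (λ z → P ⊕ P ⊗ z) e ⟩
          P ⊕ P ⊗ (Q ⊗ y)            ≡⟨ cong (P ⊕_) (trans (sym (⊗-assoc P Q y)) (cong (_⊗ y) PQ≡0)) ⟩
          P ⊕ [ 0 ] ⊗ y              ≡⟨ solve 2 (λ p y → p :+ :0 :* y := p) refl P y ⟩
          P                          ∎
        ... | inj₂ (y , e) = contradiction (conjugate-fixed-point h P x (begin
          α x                                                   ≡⟨ cong α (sym (⊕-identityˡ x)) ⟩
          α ([ 0 ] ⊕ P ⊗ ⊖ (e₀ ⊗ y))                            ≡⟨ translation-linear α P (P ⊗ b) (proj₂ (proj₁ norm)) (⊖ (e₀ ⊗ y)) [ 0 ] ⟩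
          α [ 0 ] ⊕ P ⊗ b ⊗ ⊖ (e₀ ⊗ y)                          ≡⟨ cong (_⊕ P ⊗ b ⊗ ⊖ (e₀ ⊗ y)) α0 ⟩
          P ⊗ e₀ ⊕ P ⊗ b ⊗ ⊖ (e₀ ⊗ y)                           ≡⟨ solve 4 (λ p b e y → p :* e :+ p :* b :* :- (e :* y) := p :* :- (e :* y) :+ (p :* e :- p :* (b :- :1) :* y :* e)) refl P b e₀ y ⟩
          x ⊕ (P ⊗ e₀ ⊝ P ⊗ (b ⊝ [ 1 ]) ⊗ y ⊗ e₀)               ≡⟨ cong (λ z → x ⊕ (P ⊗ e₀ ⊝ z ⊗ e₀)) e ⟩
          x ⊕ (P ⊗ e₀ ⊝ P ⊗ e₀)                                 ≡⟨ solve 2 (λ x a → x :+ (a :- a) := x) refl x (P ⊗ e₀) ⟩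
          x                                                     ∎)) P≢0
          where x = P ⊗ ⊖ (e₀ ⊗ y)

        -- α with its rotation of the coset of 0 undone, to which `fixes-all` applies; α is then a
        -- translation.
        β : Iso S S [ 0 ]
        β = translation (⊖ (P ⊗ e₀)) ∘ⁱ conjugate h P

        α-translation : ∀ x → α x ≡ x ⊕ P ⊗ e₀
        α-translation x = trans (solve 2 (λ a c → a := a :- c :+ c) refl (α x) (P ⊗ e₀)) (cong (_⊕ P ⊗ e₀) (fixes-all β
          (λ x → trans (cong (_⊝ P ⊗ e₀) (trans (proj₂ (proj₁ norm) x) (cong (α x ⊕_) Pb≡P)))
            (solve 3 (λ a p c → a :+ p :- c := a :- c :+ p) refl (α x) P (P ⊗ e₀)))
          (λ x → proj₁ (α-res x) ⊝ e₀ , trans (cong (_⊝ P ⊗ e₀) (proj₂ (α-res x)))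
            (solve 4 (λ x p e e₀ → x :+ p :* e :- p :* e₀ := x :+ p :* (e :- e₀)) refl x P (proj₁ (α-res x)) e₀))
          (trans (cong (_⊝ P ⊗ e₀) α0) (solve 1 (λ a → a :- a := :0) refl (P ⊗ e₀))) x))

      -- As α 0 ≠ 0, e₀ is invertible modulo q. So p and p e₀ are multiples of each other, and h
      -- intertwines the two translations.
      normalises-P : Normalises P h
      normalises-P with dich-q e₀
      ... | inj₁ (y , e) = contradiction (conjugate-fixed-point h P [ 0 ] (trans α0 (trans (cong (P ⊗_) e)
        (trans (sym (⊗-assoc P Q y)) (trans (cong (_⊗ y) PQ≡0) (solve 1 (λ y → :0 :* y := :0) refl y)))))) P≢0
      ... | inj₂ (y , e) = (y , λ x → trans (cong (λ z → to h (x ⊕ z)) (sym e))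
          (translation-linear (to h) (P ⊗ e₀) P (to-shift h α-translation) y x)) ,
        (e₀ , from-shift h α-translation)

    module _ {T} (h : Iso S T P) (norm : Normalises [ 1 ] (conjugate h Q)) where

      private
        α : Fin v → Fin v
        α = to (conjugate h Q)

        u j b b′ : Fin v
        u = proj₁ (proj₁ norm)
        j = α [ 0 ]
        b = proj₁ (LeftInverse.equivariant (fwd h))
        b′ = proj₁ (LeftInverse.equivariant (bwd h))

        to-P : ∀ z x → to h (x ⊕ P ⊗ z) ≡ to h x ⊕ P ⊗ b ⊗ z
        to-P = translation-linear (to h) P (P ⊗ b) (proj₂ (LeftInverse.equivariant (fwd h)))

        from-P : ∀ z x → from h (x ⊕ P ⊗ z) ≡ from h x ⊕ P ⊗ b′ ⊗ z
        from-P = translation-linear (from h) P (P ⊗ b′) (proj₂ (LeftInverse.equivariant (bwd h)))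

        α-affine : ∀ x → α x ≡ j ⊕ u ⊗ x
        α-affine = equivariant-1⇒affine α u (proj₂ (proj₁ norm))

        cancel-left : ∀ {x y z} → x ⊕ y ≡ x ⊕ z → y ≡ z
        cancel-left {x} {y} {z} e = trans (solve 2 (λ x y → y := x :+ y :- x) refl x y)
          (trans (cong (_⊝ x) e) (solve 2 (λ x y → x :+ y :- x := y) refl x z))

        Pb′b≡P : P ⊗ b′ ⊗ b ≡ P
        Pb′b≡P = cancel-left {[ 0 ]} (begin
          [ 0 ] ⊕ P ⊗ b′ ⊗ b                       ≡⟨ cong (_⊕ P ⊗ b′ ⊗ b) (sym (from-to h [ 0 ])) ⟩
          from h (to h [ 0 ]) ⊕ P ⊗ b′ ⊗ b         ≡⟨ sym (from-P b (to h [ 0 ])) ⟩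
          from h (to h [ 0 ] ⊕ P ⊗ b)              ≡⟨ cong (from h) (sym (proj₂ (LeftInverse.equivariant (fwd h)) [ 0 ])) ⟩
          from h (to h ([ 0 ] ⊕ P))                ≡⟨ from-to h _ ⟩
          [ 0 ] ⊕ P                                ∎)

        -- Translations by q and by multiples of p commute, and h normalises the latter; hence α
        -- respects the step from 0 to p, which determines u modulo q.
        uP≡P : u ⊗ P ≡ P
        uP≡P = cancel-left {j} (begin
          j ⊕ u ⊗ P                                    ≡⟨ sym (α-affine P) ⟩
          from h (to h P ⊕ Q)                          ≡⟨ cong (λ z → from h (to h z ⊕ Q)) (sym (⊕-identityˡ P)) ⟩
          from h (to h ([ 0 ] ⊕ P) ⊕ Q)                ≡⟨ cong (λ z → from h (z ⊕ Q)) (proj₂ (LeftInverse.equivariant (fwd h)) [ 0 ]) ⟩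
          from h (to h [ 0 ] ⊕ P ⊗ b ⊕ Q)              ≡⟨ cong (from h) (solve 3 (λ a c q → a :+ c :+ q := a :+ q :+ c) refl (to h [ 0 ]) (P ⊗ b) Q) ⟩
          from h (to h [ 0 ] ⊕ Q ⊕ P ⊗ b)              ≡⟨ from-P b _ ⟩
          j ⊕ P ⊗ b′ ⊗ b                               ≡⟨ cong (j ⊕_) Pb′b≡P ⟩
          j ⊕ P                                        ∎)

        Pα-fold : ∀ n → P ⊗ fold [ 0 ] α n ≡ [ n ] ⊗ (P ⊗ j)
        Pα-fold zero = solve 2 (λ p j → p :* :0 := :0 :* (p :* j)) refl P j
        Pα-fold (suc n) = begin
          P ⊗ α (fold [ 0 ] α n)                   ≡⟨ cong (P ⊗_) (α-affine _) ⟩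
          P ⊗ (j ⊕ u ⊗ fold [ 0 ] α n)             ≡⟨ solve 4 (λ p j u y → p :* (j :+ u :* y) := p :* j :+ u :* p :* y) refl P j u (fold [ 0 ] α n) ⟩
          P ⊗ j ⊕ u ⊗ P ⊗ fold [ 0 ] α n           ≡⟨ cong (λ z → P ⊗ j ⊕ z ⊗ fold [ 0 ] α n) uP≡P ⟩
          P ⊗ j ⊕ P ⊗ fold [ 0 ] α n               ≡⟨ cong (P ⊗ j ⊕_) (Pα-fold n) ⟩
          P ⊗ j ⊕ [ n ] ⊗ (P ⊗ j)                  ≡⟨ solve 2 (λ a n → a :+ n :* a := (:1 :+ n) :* a) refl (P ⊗ j) [ n ] ⟩
          ([ 1 ] ⊕ [ n ]) ⊗ (P ⊗ j)                ≡⟨ cong (_⊗ (P ⊗ j)) (sym ([]-+ 1 n)) ⟩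
          [ suc n ] ⊗ (P ⊗ j)                      ∎

        -- Modulo q, that is after multiplication by P, α is the translation by j; as its p-th
        -- iterate is the identity, p j vanishes modulo q.
        PPj≡0 : P ⊗ (P ⊗ j) ≡ [ 0 ]
        PPj≡0 = trans (sym (Pα-fold p)) (trans (cong (P ⊗_) (conjugate-fold-period h Q p PQ≡0 [ 0 ]))
          (solve 1 (λ p → p :* :0 := :0) refl P))

        j′ : Fin v
        j′ = B ⊗ j

        j≡Qj′ : j ≡ Q ⊗ j′
        j≡Qj′ = begin
          j                                  ≡⟨ split j ⟩
          P ⊗ (A ⊗ j) ⊕ Q ⊗ (B ⊗ j)          ≡⟨ cong (_⊕ Q ⊗ j′) (begin
              P ⊗ (A ⊗ j)                                          ≡⟨ split _ ⟩
              P ⊗ (A ⊗ (P ⊗ (A ⊗ j))) ⊕ Q ⊗ (B ⊗ (P ⊗ (A ⊗ j)))    ≡⟨ solve 5 (λ p a q b j → p :* (a :* (p :* (a :* j))) :+ q :* (b :* (p :* (a :* j))) := a :* a :* (p :* (p :* j)) :+ p :* q :* (b :* (a :* j))) refl P A Q B j ⟩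
              A ⊗ A ⊗ (P ⊗ (P ⊗ j)) ⊕ P ⊗ Q ⊗ (B ⊗ (A ⊗ j))        ≡⟨ cong₂ (λ s t → A ⊗ A ⊗ s ⊕ t ⊗ (B ⊗ (A ⊗ j))) PPj≡0 PQ≡0 ⟩
              A ⊗ A ⊗ [ 0 ] ⊕ [ 0 ] ⊗ (B ⊗ (A ⊗ j))                ≡⟨ solve 2 (λ a c → a :* :0 :+ :0 :* c := :0) refl (A ⊗ A) (B ⊗ (A ⊗ j)) ⟩
              [ 0 ]                                                ∎) ⟩
          [ 0 ] ⊕ Q ⊗ j′                     ≡⟨ ⊕-identityˡ _ ⟩
          Q ⊗ j′                             ∎

        -- Modulo q this is `uP≡P`. If u - 1 were invertible modulo p with inverse y, then -q y j′
        -- would be fixed by α.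
        u≡1 : u ≡ [ 1 ]
        u≡1 with dich-p (u ⊝ [ 1 ])
        ... | inj₁ (y , e) = ⊝≡0⇒≡ (begin
          u ⊝ [ 1 ]                                           ≡⟨ split _ ⟩
          P ⊗ (A ⊗ (u ⊝ [ 1 ])) ⊕ Q ⊗ (B ⊗ (u ⊝ [ 1 ]))       ≡⟨ cong₂ _⊕_ (solve 3 (λ p a u → p :* (a :* (u :- :1)) := a :* (u :* p :- p)) refl P A u) (cong (λ z → Q ⊗ (B ⊗ z)) e) ⟩
          A ⊗ (u ⊗ P ⊝ P) ⊕ Q ⊗ (B ⊗ (P ⊗ y))                 ≡⟨ cong₂ _⊕_ (cong (λ z → A ⊗ (z ⊝ P)) uP≡P) (solve 4 (λ q b p y → q :* (b :* (p :* y)) := p :* q :* (b :* y)) refl Q B P y) ⟩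
          A ⊗ (P ⊝ P) ⊕ P ⊗ Q ⊗ (B ⊗ y)                       ≡⟨ cong (λ z → A ⊗ (P ⊝ P) ⊕ z ⊗ (B ⊗ y)) PQ≡0 ⟩
          A ⊗ (P ⊝ P) ⊕ [ 0 ] ⊗ (B ⊗ y)                       ≡⟨ solve 3 (λ a p c → a :* (p :- p) :+ :0 :* c := :0) refl A P (B ⊗ y) ⟩
          [ 0 ]                                               ∎)
        ... | inj₂ (y , e) = contradiction (conjugate-fixed-point h Q x (begin
          α x                                                 ≡⟨ α-affine x ⟩
          j ⊕ u ⊗ x                                           ≡⟨ cong (_⊕ u ⊗ x) j≡Qj′ ⟩
          Q ⊗ j′ ⊕ u ⊗ x                                      ≡⟨ solve 4 (λ q j u y → let x = :- (q :* y :* j) in q :* j :+ u :* x := x :+ (q :* j :- q :* (u :- :1) :* y :* j)) refl Q j′ u y ⟩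
          x ⊕ (Q ⊗ j′ ⊝ Q ⊗ (u ⊝ [ 1 ]) ⊗ y ⊗ j′)             ≡⟨ cong (λ z → x ⊕ (Q ⊗ j′ ⊝ z ⊗ j′)) e ⟩
          x ⊕ (Q ⊗ j′ ⊝ Q ⊗ j′)                               ≡⟨ solve 2 (λ x a → x :+ (a :- a) := x) refl x (Q ⊗ j′) ⟩
          x                                                   ∎)) Q≢0
          where x = ⊖ (Q ⊗ y ⊗ j′)

        α-translation : ∀ x → α x ≡ x ⊕ Q ⊗ j′
        α-translation x = trans (α-affine x) (trans (cong₂ (λ j u → j ⊕ u ⊗ x) j≡Qj′ u≡1)
          (solve 2 (λ j x → j :+ :1 :* x := x :+ j) refl (Q ⊗ j′) x))

        equivariant-1 : ∀ (f : Fin v → Fin v) c d → (∀ z x → f (x ⊕ P ⊗ z) ≡ f x ⊕ c ⊗ z) →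
          (∀ z x → f (x ⊕ Q ⊗ z) ≡ f x ⊕ d ⊗ z) → Equivariant [ 1 ] f
        equivariant-1 f c d f-P f-Q = c ⊗ A ⊕ d ⊗ B , λ x → begin
          f (x ⊕ [ 1 ])                          ≡⟨ cong (λ z → f (x ⊕ z)) (sym PA+QB≡1) ⟩
          f (x ⊕ (P ⊗ A ⊕ Q ⊗ B))                ≡⟨ cong f (sym (⊕-assoc x _ _)) ⟩
          f (x ⊕ P ⊗ A ⊕ Q ⊗ B)                  ≡⟨ f-Q B _ ⟩
          f (x ⊕ P ⊗ A) ⊕ d ⊗ B                  ≡⟨ cong (_⊕ d ⊗ B) (f-P A x) ⟩
          f x ⊕ c ⊗ A ⊕ d ⊗ B                    ≡⟨ solve 3 (λ x a b → x :+ a :+ b := x :+ :1 :* (a :+ b)) refl (f x) (c ⊗ A) (d ⊗ B) ⟩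
          f x ⊕ [ 1 ] ⊗ (c ⊗ A ⊕ d ⊗ B)          ∎

      -- As α 0 ≠ 0, j′ is invertible modulo p; so h is equivariant for steps of q as well as of p,
      -- and 1 = p A + q B combines them.
      normalises-1 : Normalises [ 1 ] h
      normalises-1 with dich-p j′
      ... | inj₁ (y , e) = contradiction (conjugate-fixed-point h Q [ 0 ] (begin
          j                    ≡⟨ j≡Qj′ ⟩
          Q ⊗ j′               ≡⟨ cong (Q ⊗_) e ⟩
          Q ⊗ (P ⊗ y)          ≡⟨ solve 3 (λ q p y → q :* (p :* y) := p :* q :* y) refl Q P y ⟩
          P ⊗ Q ⊗ y            ≡⟨ cong (_⊗ y) PQ≡0 ⟩
          [ 0 ] ⊗ y            ≡⟨ solve 1 (λ y → :0 :* y := :0) refl y ⟩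
          [ 0 ]                ∎)) Q≢0
      ... | inj₂ (y , e) =
        equivariant-1 (to h) (P ⊗ b) (Q ⊗ y) to-P (translation-linear (to h) Q (Q ⊗ y) λ x →
          trans (cong (λ z → to h (x ⊕ z)) (sym e)) (translation-linear (to h) (Q ⊗ j′) Q (to-shift h α-translation) y x)) ,
        equivariant-1 (from h) (P ⊗ b′) (Q ⊗ j′) from-P
          (translation-linear (from h) Q (Q ⊗ j′) (from-shift h α-translation))

    two-primes-related : ∀ {T} → Iso S T [ 0 ] → MultiplierRelated S T
    two-primes-related {T} f = affine-iso⇒related (proj₁ second) (proj₂ second)
      where
      first : ∃ λ (h : Iso S T [ 0 ]) → Normalises P h
      -- The translation by p has order q, so the count is modulo q; in the second round the primes
      -- change places.
      first = normalising-iso q-prime 1 P P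
        (trans (cong (λ n → [ n ] ⊗ P) (ℕₚ.*-identityʳ q)) (trans (⊗-comm Q P) PQ≡0)) f normalises-P
      h = proj₁ first
      -- Recording the equivariance in the type confines the second conjugation to automorphisms
      -- normalising the translation by p, so that it is preserved.
      h-P : Iso S T P
      h-P = iso (to h) (from h)
        (leftInverse (to-from h) (LeftInverse.preserves (fwd h)) (proj₁ (proj₂ first)))
        (leftInverse (from-to h) (LeftInverse.preserves (bwd h)) (proj₂ (proj₂ first)))
      second : ∃ λ (h : Iso S T P) → Normalises [ 1 ] h
      second = normalising-iso p-prime 1 [ 1 ] Q
        (trans (cong (λ n → [ n ] ⊗ Q) (ℕₚ.*-identityʳ p)) PQ≡0) h-P normalises-1

-- Reduction to a connected component

injective⇒surjective : ∀ {m n} {f : Fin m → Fin n} → n ≤ m → (∀ {x y} → f x ≡ f y → x ≡ y) →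
                       ∀ y → ∃ λ x → f x ≡ y
injective⇒surjective {m} {n} {f} n≤m f-inj y with Finₚ.any? (λ x → f x Finₚ.≟ y)
... | yes found = found
... | no  missed = contradiction (Finₚ.injective⇒≤ {f = extended} extended-injective) (ℕₚ.≤⇒≯ n≤m)
  where
  extended : Fin (suc m) → Fin n
  extended zero    = y
  extended (suc x) = f x
  extended-injective : ∀ {x x′} → extended x ≡ extended x′ → x ≡ x′
  extended-injective {zero}  {zero}   _ = refl
  extended-injective {zero}  {suc x′} e = contradiction (x′ , sym e) missed
  extended-injective {suc x} {zero}   e = contradiction (x , e) missed
  extended-injective {suc x} {suc x′} e = cong suc (f-inj e)

≡-by-truth : ∀ {a b : Bool} → (a ≡ true → b ≡ true) → (b ≡ true → a ≡ true) → a ≡ b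
≡-by-truth {true}  {b}     f g = sym (f refl)
≡-by-truth {false} {true}  f g = g refl
≡-by-truth {false} {false} f g = refl

module InjectiveIso (v : ℕ) .{{_ : NonZero v}} where

  open ZMod v
  open Units v
  open Development v
  open Sidon v

  -- The induced map on lines is injective since S has no translational symmetry, so both maps are invertible.
  injective⇒iso : ∀ {S T} → IsSidon S → ∀ {s} → S s ≡ true → ∀ f → (∀ {x y} → f x ≡ f y → x ≡ y) →
                  PreservesLines S T f → Iso S T [ 0 ]
  injective⇒iso {S} {T} sid Ss f f-inj lin = iso f g
      (leftInverse f-g lin (equivariant-0 f))
      (leftInverse (λ x → f-inj (f-g (f x))) g-lines (equivariant-0 g))
    where
    g : Fin v → Fin v
    g y = proj₁ (injective⇒surjective ℕₚ.≤-refl f-inj y)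
    f-g : ∀ y → f (g y) ≡ y
    f-g y = proj₂ (injective⇒surjective ℕₚ.≤-refl f-inj y)
    γ : Fin v → Fin v
    γ i = proj₁ (lin i)
    γ-inj : ∀ {i j} → γ i ≡ γ j → i ≡ j
    γ-inj {i} {j} e = sym (⊝≡0⇒≡ (translation-invariant⇒0 sid Ss (j ⊝ i) λ x → begin
      S x                        ≡⟨ cong S (solve 2 (λ x i → x := x :+ i :- i) refl x i) ⟩
      S (x ⊕ i ⊝ i)              ≡⟨ proj₂ (lin i) (x ⊕ i) ⟩
      T (f (x ⊕ i) ⊝ γ i)        ≡⟨ cong (λ k → T (f (x ⊕ i) ⊝ k)) e ⟩
      T (f (x ⊕ i) ⊝ γ j)        ≡⟨ sym (proj₂ (lin j) (x ⊕ i)) ⟩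
      S (x ⊕ i ⊝ j)              ≡⟨ cong S (solve 3 (λ x i j → x :+ i :- j := x :- (j :- i)) refl x i j) ⟩
      S (x ⊝ (j ⊝ i))            ∎))
      where open ≡-Reasoning
    g-lines : PreservesLines T S g
    g-lines i = j , λ x → sym (trans (proj₂ (lin j) (g x)) (cong₂ (λ y k → T (y ⊝ k)) (f-g x) γj≡i))
      where
      j : Fin v
      j = proj₁ (injective⇒surjective ℕₚ.≤-refl γ-inj i)
      γj≡i : γ j ≡ i
      γj≡i = proj₂ (injective⇒surjective ℕₚ.≤-refl γ-inj i)

module Reduction (v v′ d : ℕ) .{{_ : NonZero v}} .{{_ : NonZero v′}} .{{_ : NonZero d}} (v≡ : v ≡ d * v′) where

  open ZMod v
  open Units v
  open Development v
  open Sidon v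
  module Z′ = ZMod v′
  module U′ = Units v′
  module D′ = Development v′
  module S′ = Sidon v′
  open Z′ using () renaming ([_] to [_]′; _⊕_ to _⊕′_; _⊝_ to _⊝′_; _⊗_ to _⊗′_; ⊖_ to ⊖′_; []-toℕ to []′-toℕ)
  open ≡-Reasoning

  -- Multiplication by d, which identifies ℤ/v′ with the subgroup of ℤ/v generated by d.
  ι : Fin v′ → Fin v
  ι y = [ d * toℕ y ]

  ι-[] : ∀ m → ι [ m ]′ ≡ [ d * m ]
  ι-[] m = sym (begin
    [ d * m ]                                        ≡⟨ cong (λ k → [ d * k ]) (m≡m%n+[m/n]*n m v′) ⟩
    [ d * (m % v′ + m / v′ * v′) ]                   ≡⟨ cong [_] (ℕₚ.*-distribˡ-+ d (m % v′) (m / v′ * v′)) ⟩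
    [ d * (m % v′) + d * (m / v′ * v′) ]             ≡⟨ []-+ (d * (m % v′)) (d * (m / v′ * v′)) ⟩
    [ d * (m % v′) ] ⊕ [ d * (m / v′ * v′) ]         ≡⟨ cong₂ (λ k z → [ d * k ] ⊕ z) (sym (Z′.toℕ-[] m)) ([]≡0 v∣) ⟩
    ι [ m ]′ ⊕ [ 0 ]                                 ≡⟨ solve 1 (λ x → x :+ :0 := x) refl (ι [ m ]′) ⟩
    ι [ m ]′                                         ∎)
    where
    v∣ : v ∣ d * (m / v′ * v′)
    v∣ = subst (_∣ d * (m / v′ * v′)) (sym v≡) (*-monoʳ-∣ d (n∣m*n (m / v′)))

  ι-⊕ : ∀ x y → ι (x ⊕′ y) ≡ ι x ⊕ ι y
  ι-⊕ x y = begin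
    ι (x ⊕′ y)                           ≡⟨ cong₂ (λ a b → ι (a ⊕′ b)) (sym ([]′-toℕ x)) (sym ([]′-toℕ y)) ⟩
    ι ([ toℕ x ]′ ⊕′ [ toℕ y ]′)         ≡⟨ cong ι (sym (Z′.[]-+ (toℕ x) (toℕ y))) ⟩
    ι [ toℕ x + toℕ y ]′                 ≡⟨ ι-[] (toℕ x + toℕ y) ⟩
    [ d * (toℕ x + toℕ y) ]              ≡⟨ cong [_] (ℕₚ.*-distribˡ-+ d (toℕ x) (toℕ y)) ⟩
    [ d * toℕ x + d * toℕ y ]            ≡⟨ []-+ (d * toℕ x) (d * toℕ y) ⟩
    ι x ⊕ ι y                            ∎

  ι-⊗ : ∀ n y → [ n ] ⊗ ι y ≡ ι ([ n ]′ ⊗′ y)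
  ι-⊗ n y = begin
    [ n ] ⊗ [ d * toℕ y ]                ≡⟨ sym ([]-* n (d * toℕ y)) ⟩
    [ n * (d * toℕ y) ]                  ≡⟨ cong [_] (trans (sym (ℕₚ.*-assoc n d (toℕ y))) (trans (cong (_* toℕ y) (ℕₚ.*-comm n d)) (ℕₚ.*-assoc d n (toℕ y)))) ⟩
    [ d * (n * toℕ y) ]                  ≡⟨ sym (ι-[] (n * toℕ y)) ⟩
    ι [ n * toℕ y ]′                     ≡⟨ cong ι (trans (Z′.[]-* n (toℕ y)) (cong ([ n ]′ ⊗′_) ([]′-toℕ y))) ⟩
    ι ([ n ]′ ⊗′ y)                      ∎

  ι-⊝ : ∀ x y → ι (x ⊝′ y) ≡ ι x ⊝ ι y
  ι-⊝ x y = begin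
    ι (x ⊝′ y)                     ≡⟨ solve 2 (λ a b → a := a :+ b :- b) refl (ι (x ⊝′ y)) (ι y) ⟩
    ι (x ⊝′ y) ⊕ ι y ⊝ ι y         ≡⟨ cong (_⊝ ι y) (sym (ι-⊕ (x ⊝′ y) y)) ⟩
    ι (x ⊝′ y ⊕′ y) ⊝ ι y          ≡⟨ cong (λ z → ι z ⊝ ι y) (Z′.solve 2 (λ x y → x Z′.:- y Z′.:+ y Z′.:= x) refl x y) ⟩
    ι x ⊝ ι y                      ∎

  ι-injective : ∀ {x y} → ι x ≡ ι y → x ≡ y
  ι-injective {x} {y} e = U′.⊝≡0⇒≡ (trans (sym ([]′-toℕ (x ⊝′ y))) (U′.[]≡0 v′∣))
    where
    ι0 : ι (x ⊝′ y) ≡ [ 0 ]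
    ι0 = trans (ι-⊝ x y) (trans (cong (_⊝ ι y) e) (solve 1 (λ a → a :- a := :0) refl (ι y)))
    v′∣ : v′ ∣ toℕ (x ⊝′ y)
    v′∣ = *-cancelˡ-∣ d (subst (_∣ d * toℕ (x ⊝′ y)) v≡ ([]≡0⇒∣ ι0))

  ι-multiple : ∀ y → [ d ] ⊗ y ≡ ι [ toℕ y ]′
  ι-multiple y = trans (cong ([ d ] ⊗_) (sym ([]-toℕ y))) (trans (sym ([]-* d (toℕ y))) (sym (ι-[] (toℕ y))))

  InClass : Line → Fin v → Set
  InClass S s = ∀ x → S x ≡ true → ∃ λ y → x ≡ s ⊕ ι y

  restrict : Line → Fin v → D′.Line
  restrict S s y = S (s ⊕ ι y)

  restrict-sidon : ∀ {S} s → IsSidon S → S′.IsSidon (restrict S s)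
  restrict-sidon s sid = S′.sidon λ {a} {b} {c} {e} Sa Sb Sc Se eq a≢b →
    unshift (differences-distinct sid Sa Sb Sc Se (begin
      s ⊕ ι a ⊝ (s ⊕ ι b)       ≡⟨ solve 3 (λ s a b → s :+ a :- (s :+ b) := a :- b) refl s (ι a) (ι b) ⟩
      ι a ⊝ ι b                 ≡⟨ sym (ι-⊝ a b) ⟩
      ι (a ⊝′ b)                ≡⟨ cong ι eq ⟩
      ι (c ⊝′ e)                ≡⟨ ι-⊝ c e ⟩
      ι c ⊝ ι e                 ≡⟨ solve 3 (λ s a b → a :- b := s :+ a :- (s :+ b)) refl s (ι c) (ι e) ⟩
      s ⊕ ι c ⊝ (s ⊕ ι e)       ∎) (λ e → a≢b (unshift e)))
    where
    unshift : ∀ {a b} → s ⊕ ι a ≡ s ⊕ ι b → a ≡ b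
    unshift {a} {b} e = ι-injective (trans (solve 2 (λ s a → a := s :+ a :- s) refl s (ι a))
      (trans (cong (_⊝ s) e) (solve 2 (λ s a → s :+ a :- s := a) refl s (ι b))))

  module _ {S T} (sid : IsSidon S) {s t δ} (S-class : InClass S s) (T-class : InClass T t)
    (Ss : S s ≡ true) (Ss+δ : S (s ⊕ ι δ) ≡ true) (δ-unit : U′.Unit δ) where

    module _ (f : Iso S T [ 0 ]) where

      private
        f₀ : Fin v
        f₀ = to f [ 0 ]

        -- x and x + ι δ lie on line x - s, so their images lie on one line of T, which stays inside
        -- one coset.
        f-step : ∀ x → ∃ λ w → to f (x ⊕ ι δ) ≡ to f x ⊕ ι w
        f-step x = b ⊝′ a , (begin
          to f (x ⊕ ι δ)                                              ≡⟨ solve 3 (λ y z k → z := y :+ (z :- k :- (y :- k))) refl (to f x) (to f (x ⊕ ι δ)) k ⟩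
          to f x ⊕ (to f (x ⊕ ι δ) ⊝ k ⊝ (to f x ⊝ k))                ≡⟨ cong₂ (λ y z → to f x ⊕ (y ⊝ z)) eb ea ⟩
          to f x ⊕ (t ⊕ ι b ⊝ (t ⊕ ι a))                              ≡⟨ solve 4 (λ y t a b → y :+ (t :+ b :- (t :+ a)) := y :+ (b :- a)) refl (to f x) t (ι a) (ι b) ⟩
          to f x ⊕ (ι b ⊝ ι a)                                        ≡⟨ cong (to f x ⊕_) (sym (ι-⊝ b a)) ⟩
          to f x ⊕ ι (b ⊝′ a)                                         ∎)
          where
          k : Fin v
          k = proj₁ (LeftInverse.preserves (fwd f) (x ⊝ s))
          line : ∀ y → S (y ⊝ (x ⊝ s)) ≡ T (to f y ⊝ k)
          line = proj₂ (LeftInverse.preserves (fwd f) (x ⊝ s))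
          image₁ : ∃ λ a → to f x ⊝ k ≡ t ⊕ ι a
          image₁ = T-class _ (trans (sym (line x)) (trans (cong S (solve 2 (λ x s → x :- (x :- s) := s) refl x s)) Ss))
          image₂ : ∃ λ b → to f (x ⊕ ι δ) ⊝ k ≡ t ⊕ ι b
          image₂ = T-class _ (trans (sym (line (x ⊕ ι δ)))
            (trans (cong S (solve 3 (λ x s d → x :+ d :- (x :- s) := s :+ d) refl x s (ι δ))) Ss+δ))
          a b : Fin v′
          a = proj₁ image₁
          b = proj₁ image₂
          ea : to f x ⊝ k ≡ t ⊕ ι a
          ea = proj₂ image₁
          eb : to f (x ⊕ ι δ) ⊝ k ≡ t ⊕ ι b
          eb = proj₂ image₂

        f-steps : ∀ n → ∃ λ w → to f ([ n ] ⊗ ι δ) ≡ f₀ ⊕ ι w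
        f-steps zero = [ 0 ]′ , (begin
          to f ([ 0 ] ⊗ ι δ)        ≡⟨ cong (to f) (solve 1 (λ d → :0 :* d := :0) refl (ι δ)) ⟩
          f₀                        ≡⟨ solve 1 (λ y → y := y :+ :0) refl f₀ ⟩
          f₀ ⊕ [ 0 ]                ≡⟨ cong (f₀ ⊕_) (sym (trans (ι-[] 0) (cong [_] (ℕₚ.*-zeroʳ d)))) ⟩
          f₀ ⊕ ι [ 0 ]′             ∎)
        f-steps (suc n) = w ⊕′ w′ , (begin
          to f ([ suc n ] ⊗ ι δ)              ≡⟨ cong (λ k → to f (k ⊗ ι δ)) ([]-+ 1 n) ⟩
          to f (([ 1 ] ⊕ [ n ]) ⊗ ι δ)        ≡⟨ cong (to f) (solve 2 (λ n d → (:1 :+ n) :* d := n :* d :+ d) refl [ n ] (ι δ)) ⟩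
          to f ([ n ] ⊗ ι δ ⊕ ι δ)            ≡⟨ proj₂ (f-step ([ n ] ⊗ ι δ)) ⟩
          to f ([ n ] ⊗ ι δ) ⊕ ι w′           ≡⟨ cong (_⊕ ι w′) (proj₂ (f-steps n)) ⟩
          f₀ ⊕ ι w ⊕ ι w′                     ≡⟨ ⊕-assoc f₀ (ι w) (ι w′) ⟩
          f₀ ⊕ (ι w ⊕ ι w′)                   ≡⟨ cong (f₀ ⊕_) (sym (ι-⊕ w w′)) ⟩
          f₀ ⊕ ι (w ⊕′ w′)                    ∎)
          where
          w w′ : Fin v′
          w  = proj₁ (f-steps n)
          w′ = proj₁ (f-step ([ n ] ⊗ ι δ))

        -- δ generates ℤ/v′, so steps of ι δ connect the whole subgroup and f keeps it within one
        -- coset.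
        component : ∀ y → ∃ λ w → to f (ι y) ≡ f₀ ⊕ ι w
        component y = proj₁ steps , trans (cong (to f) (sym (begin
          [ toℕ (δ⁻¹ ⊗′ y) ] ⊗ ι δ            ≡⟨ ι-⊗ (toℕ (δ⁻¹ ⊗′ y)) δ ⟩
          ι ([ toℕ (δ⁻¹ ⊗′ y) ]′ ⊗′ δ)        ≡⟨ cong (λ z → ι (z ⊗′ δ)) ([]′-toℕ (δ⁻¹ ⊗′ y)) ⟩
          ι (δ⁻¹ ⊗′ y ⊗′ δ)                   ≡⟨ cong ι (Z′.solve 3 (λ e y d → e Z′.:* y Z′.:* d Z′.:= d Z′.:* e Z′.:* y) refl δ⁻¹ y δ) ⟩
          ι (δ ⊗′ δ⁻¹ ⊗′ y)                   ≡⟨ cong (λ z → ι (z ⊗′ y)) (proj₂ δ-unit) ⟩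
          ι ([ 1 ]′ ⊗′ y)                     ≡⟨ cong ι (Z′.⊗-identityˡ y) ⟩
          ι y                                 ∎))) (proj₂ steps)
          where
          δ⁻¹ : Fin v′
          δ⁻¹ = proj₁ δ-unit
          steps : ∃ λ w → to f ([ toℕ (δ⁻¹ ⊗′ y) ] ⊗ ι δ) ≡ f₀ ⊕ ι w
          steps = f-steps (toℕ (δ⁻¹ ⊗′ y))

        f′ : Fin v′ → Fin v′
        f′ y = proj₁ (component y)

        f′-eq : ∀ y → to f (ι y) ≡ f₀ ⊕ ι (f′ y)
        f′-eq y = proj₂ (component y)

        f′-injective : ∀ {x y} → f′ x ≡ f′ y → x ≡ y
        f′-injective {x} {y} e = ι-injective (to-injective f
          (trans (f′-eq x) (trans (cong (λ z → f₀ ⊕ ι z) e) (sym (f′-eq y)))))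

        f′-lines : D′.PreservesLines (restrict S s) (restrict T t) f′
        -- The line through ι i at position s has its image through f (ι i) at position t + ι a;
        -- this gives the number k = f′ i - a.
        f′-lines i = k , λ y → begin
          S (s ⊕ ι (y ⊝′ i))               ≡⟨ cong (λ z → S (s ⊕ z)) (ι-⊝ y i) ⟩
          S (s ⊕ (ι y ⊝ ι i))              ≡⟨ cong S (solve 3 (λ s y i → s :+ (y :- i) := y :- (i :- s)) refl s (ι y) (ι i)) ⟩
          S (ι y ⊝ (ι i ⊝ s))              ≡⟨ line (ι y) ⟩
          T (to f (ι y) ⊝ j)               ≡⟨ cong (λ z → T (z ⊝ j)) (f′-eq y) ⟩
          T (f₀ ⊕ ι (f′ y) ⊝ j)            ≡⟨ cong T (solve 4 (λ f y i j → f :+ y :- j := y :- i :+ (f :+ i :- j)) refl f₀ (ι (f′ y)) (ι (f′ i)) j) ⟩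
          T (ι (f′ y) ⊝ ι (f′ i) ⊕ (f₀ ⊕ ι (f′ i) ⊝ j)) ≡⟨ cong (λ z → T (ι (f′ y) ⊝ ι (f′ i) ⊕ z)) (trans (cong (_⊝ j) (sym (f′-eq i))) ea) ⟩
          T (ι (f′ y) ⊝ ι (f′ i) ⊕ (t ⊕ ι a))           ≡⟨ cong T (solve 4 (λ y i t a → y :- i :+ (t :+ a) := t :+ (y :- (i :- a))) refl (ι (f′ y)) (ι (f′ i)) t (ι a)) ⟩
          T (t ⊕ (ι (f′ y) ⊝ (ι (f′ i) ⊝ ι a)))         ≡⟨ cong (λ z → T (t ⊕ (ι (f′ y) ⊝ z))) (sym (ι-⊝ (f′ i) a)) ⟩
          T (t ⊕ (ι (f′ y) ⊝ ι k))         ≡⟨ cong (λ z → T (t ⊕ z)) (sym (ι-⊝ (f′ y) k)) ⟩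
          T (t ⊕ ι (f′ y ⊝′ k))            ∎
          where
          j : Fin v
          j = proj₁ (LeftInverse.preserves (fwd f) (ι i ⊝ s))
          line : ∀ y → S (y ⊝ (ι i ⊝ s)) ≡ T (to f y ⊝ j)
          line = proj₂ (LeftInverse.preserves (fwd f) (ι i ⊝ s))
          image : ∃ λ a → to f (ι i) ⊝ j ≡ t ⊕ ι a
          image = T-class _ (trans (sym (line (ι i)))
            (trans (cong S (solve 2 (λ i s → i :- (i :- s) := s) refl (ι i) s)) Ss))
          a k : Fin v′
          a = proj₁ image
          k = f′ i ⊝′ a
          ea : to f (ι i) ⊝ j ≡ t ⊕ ι a
          ea = proj₂ image

      restrict-iso : D′.Iso (restrict S s) (restrict T t) [ 0 ]′
      restrict-iso = InjectiveIso.injective⇒iso v′ (restrict-sidon s sid) {δ} Ss+δ f′ f′-injective f′-lines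

    -- Any unit of ℤ/v reducing to b′ works: on the class of s it acts through b′, and off the
    -- classes both sides are false.
    extend-related : (∀ n → Coprime n v′ → ∃ λ m → [ m ]′ ≡ [ n ]′ × Coprime m v) →
      S′.MultiplierRelated (restrict S s) (restrict T t) → MultiplierRelated S T
    extend-related lift (b′ , b′-unit , c′ , rel) = b , b-unit , c , λ x → ≡-by-truth (forward x) (backward x)
      where
      lifted : ∃ λ m → [ m ]′ ≡ [ toℕ b′ ]′ × Coprime m v
      lifted = lift (toℕ b′) (U′.unit⇒coprime b′-unit)
      m : ℕ
      m = proj₁ lifted
      b c : Fin v
      b = [ m ]
      -- Chosen so that the affine map sends s + ι y to t + ι (b′ y + c′).
      c = t ⊕ ι c′ ⊝ b ⊗ s
      b-unit : Unit b
      b-unit = coprime⇒unit (proj₂ (proj₂ lifted))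
      b-ι : ∀ y → b ⊗ ι y ≡ ι (b′ ⊗′ y)
      b-ι y = trans (ι-⊗ m y) (cong (λ z → ι (z ⊗′ y)) (trans (proj₁ (proj₂ lifted)) ([]′-toℕ b′)))
      on-class : ∀ y → b ⊗ (s ⊕ ι y) ⊕ c ≡ t ⊕ ι (b′ ⊗′ y ⊕′ c′)
      on-class y = begin
        b ⊗ (s ⊕ ι y) ⊕ (t ⊕ ι c′ ⊝ b ⊗ s)     ≡⟨ solve 5 (λ b s y t c → b :* (s :+ y) :+ (t :+ c :- b :* s) := t :+ (b :* y :+ c)) refl b s (ι y) t (ι c′) ⟩
        t ⊕ (b ⊗ ι y ⊕ ι c′)                   ≡⟨ cong (λ z → t ⊕ (z ⊕ ι c′)) (b-ι y) ⟩
        t ⊕ (ι (b′ ⊗′ y) ⊕ ι c′)               ≡⟨ cong (t ⊕_) (sym (ι-⊕ (b′ ⊗′ y) c′)) ⟩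
        t ⊕ ι (b′ ⊗′ y ⊕′ c′)                  ∎
      class-rel : ∀ y → S (s ⊕ ι y) ≡ T (b ⊗ (s ⊕ ι y) ⊕ c)
      class-rel y = trans (rel y) (cong T (sym (on-class y)))
      forward : ∀ x → S x ≡ true → T (b ⊗ x ⊕ c) ≡ true
      forward x Sx = trans (cong (λ z → T (b ⊗ z ⊕ c)) (proj₂ (S-class x Sx)))
        (trans (sym (class-rel (proj₁ (S-class x Sx)))) (trans (cong S (sym (proj₂ (S-class x Sx)))) Sx))
      backward : ∀ x → T (b ⊗ x ⊕ c) ≡ true → S x ≡ true
      backward x Tx = trans (cong S x≡) (trans (class-rel y) (trans (cong (λ z → T (b ⊗ z ⊕ c)) (sym x≡)) Tx))
        where
        w : Fin v′
        w = proj₁ (T-class _ Tx)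
        b⁻¹ : Fin v
        b⁻¹ = proj₁ b-unit
        y : Fin v′
        y = [ toℕ b⁻¹ ]′ ⊗′ (w ⊝′ c′)
        x≡ : x ≡ s ⊕ ι y
        x≡ = begin
          x                                              ≡⟨ solve 2 (λ x s → x := s :+ :1 :* (x :- s)) refl x s ⟩
          s ⊕ [ 1 ] ⊗ (x ⊝ s)                            ≡⟨ cong (λ z → s ⊕ z ⊗ (x ⊝ s)) (sym (proj₂ b-unit)) ⟩
          s ⊕ b ⊗ b⁻¹ ⊗ (x ⊝ s)                          ≡⟨ solve 6 (λ x s b a t c → s :+ b :* a :* (x :- s) := s :+ a :* (b :* x :+ (t :+ c :- b :* s) :- t :- c)) refl x s b b⁻¹ t (ι c′) ⟩
          s ⊕ b⁻¹ ⊗ (b ⊗ x ⊕ c ⊝ t ⊝ ι c′)               ≡⟨ cong (λ z → s ⊕ b⁻¹ ⊗ (z ⊝ t ⊝ ι c′)) (proj₂ (T-class _ Tx)) ⟩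
          s ⊕ b⁻¹ ⊗ (t ⊕ ι w ⊝ t ⊝ ι c′)                 ≡⟨ solve 5 (λ s a t w c → s :+ a :* (t :+ w :- t :- c) := s :+ a :* (w :- c)) refl s b⁻¹ t (ι w) (ι c′) ⟩
          s ⊕ b⁻¹ ⊗ (ι w ⊝ ι c′)                         ≡⟨ cong₂ (λ a z → s ⊕ a ⊗ z) (sym ([]-toℕ b⁻¹)) (sym (ι-⊝ w c′)) ⟩
          s ⊕ [ toℕ b⁻¹ ] ⊗ ι (w ⊝′ c′)                  ≡⟨ cong (s ⊕_) (ι-⊗ (toℕ b⁻¹) (w ⊝′ c′)) ⟩
          s ⊕ ι y                                        ∎

-- Both cases combined

-- Turns the irrelevant instance into a relevant one, which `subst` can transport.
nonZero : ∀ n .{{_ : NonZero n}} → NonZero n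
nonZero (suc n) = _

module Classification (v : ℕ) .{{_ : NonZero v}} where

  open ZMod v
  open Units v
  open Development v
  open Sidon v

  Congruent : Line → Fin v → ℕ → Set
  Congruent S s d = ∀ x → S x ≡ true → ∃ λ y → x ≡ s ⊕ [ d ] ⊗ y

  congruent⊎ : ∀ S s d → Congruent S s d ⊎ (∃ λ x → S x ≡ true × (∀ y → x ≢ s ⊕ [ d ] ⊗ y))
  congruent⊎ S s d with Finₚ.all? dec
    where
    dec : ∀ x → Dec (S x ≡ true → ∃ λ y → x ≡ s ⊕ [ d ] ⊗ y)
    dec x = (S x Boolₚ.≟ true) →-dec Finₚ.any? (λ y → x Finₚ.≟ s ⊕ [ d ] ⊗ y)
  ... | yes all = inj₁ all
  ... | no ¬all = inj₂ (found (Finₚ.any? λ x → (S x Boolₚ.≟ true) ×-dec ¬? (Finₚ.any? λ y → x Finₚ.≟ s ⊕ [ d ] ⊗ y)))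
    where
    found : Dec (∃ λ x → S x ≡ true × ¬ (∃ λ y → x ≡ s ⊕ [ d ] ⊗ y)) → ∃ λ x → S x ≡ true × (∀ y → x ≢ s ⊕ [ d ] ⊗ y)
    found (yes (x , Sx , none)) = x , Sx , λ y e → none (y , e)
    found (no  none) = contradiction (λ x Sx → decidable-stable (Finₚ.any? λ y → x Finₚ.≟ s ⊕ [ d ] ⊗ y) (λ n → none (x , Sx , n))) ¬all

  module _ {p} (pr : Prime p) (lift : ∀ m n → ¬ p ∣ n → ∃ λ k → Coprime (n + k * p ^ suc m) v) where

    module _ (m d : ℕ) (v≡ : v ≡ d * p ^ suc m) {S T s t} (sid : IsSidon S) (Ss : S s ≡ true)
      (S-class : Congruent S s d) (T-class : Congruent T t d)
      {x} (Sx : S x ≡ true) (x≢ : ∀ y → x ≢ s ⊕ [ d * p ] ⊗ y) (f : Iso S T [ 0 ]) where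

      private
        v′ : ℕ
        v′ = p ^ suc m

        instance
          v′-nonZero : NonZero v′
          v′-nonZero = ℕₚ.m^n≢0 p (suc m) {{prime⇒nonZero pr}}
          d-nonZero : NonZero d
          d-nonZero = ℕₚ.m*n≢0⇒m≢0 d {{subst NonZero v≡ (nonZero v)}}

        open Reduction v v′ d v≡ using (ι; ι-⊗; ι-[]; ι-multiple; InClass; restrict; restrict-sidon; restrict-iso; extend-related)
        module Z′ = ZMod v′
        module U′ = Units v′

        p∣v′ : p ∣ v′
        p∣v′ = m∣m*n (p ^ m)

        in-class : ∀ {U u} → Congruent U u d → InClass U u
        in-class {U} {u} cl x Ux = Z′.[ toℕ (proj₁ (cl x Ux)) ] , trans (proj₂ (cl x Ux)) (cong (u ⊕_) (ι-multiple (proj₁ (cl x Ux))))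

        δ : Fin v′
        δ = proj₁ (in-class {S} {s} S-class x Sx)

        x≡ : x ≡ s ⊕ ι δ
        x≡ = proj₂ (in-class {S} {s} S-class x Sx)

        -- Were δ divisible by p, x would be congruent to s modulo d p.
        δ-unit : U′.Unit δ
        δ-unit with U′.PrimePower.multiple⊎unit pr (suc m) refl p∣v′ δ
        ... | inj₂ u       = u
        ... | inj₁ (y , e) = contradiction (trans x≡ (cong (s ⊕_) (begin
            ι δ                              ≡⟨ cong ι e ⟩
            ι (Z′.[ p ] Z′.⊗ y)              ≡⟨ sym (ι-⊗ p y) ⟩
            [ p ] ⊗ [ d * toℕ y ]            ≡⟨ cong ([ p ] ⊗_) ([]-* d (toℕ y)) ⟩
            [ p ] ⊗ ([ d ] ⊗ [ toℕ y ])      ≡⟨ solve 3 (λ p d y → p :* (d :* y) := d :* p :* y) refl [ p ] [ d ] [ toℕ y ] ⟩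
            [ d ] ⊗ [ p ] ⊗ [ toℕ y ]        ≡⟨ cong (_⊗ [ toℕ y ]) (sym ([]-* d p)) ⟩
            [ d * p ] ⊗ [ toℕ y ]            ∎))) (x≢ [ toℕ y ])
          where open ≡-Reasoning

        Ss+δ : S (s ⊕ ι δ) ≡ true
        Ss+δ = trans (cong S (sym x≡)) Sx

        S0 : S (s ⊕ ι Z′.[ 0 ]) ≡ true
        S0 = trans (cong S (trans (cong (s ⊕_) (trans (ι-[] 0) (cong [_] (ℕₚ.*-zeroʳ d))))
          (solve 1 (λ s → s :+ :0 := s) refl s))) Ss

        lift′ : ∀ n → Coprime n v′ → ∃ λ k → Z′.[ k ] ≡ Z′.[ n ] × Coprime k v
        lift′ n c = n + proj₁ lifted * v′ , eq , proj₂ lifted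
          where
          lifted : ∃ λ k → Coprime (n + k * p ^ suc m) v
          lifted = lift m n λ p∣n → ¬prime[1] (subst Prime (c (p∣n , p∣v′)) pr)
          eq : Z′.[ n + proj₁ lifted * v′ ] ≡ Z′.[ n ]
          eq = trans (Z′.[]-+ n (proj₁ lifted * v′)) (trans (cong (Z′.[ n ] Z′.⊕_) (U′.[]≡0 (n∣m*n (proj₁ lifted))))
            (Z′.solve 1 (λ a → a Z′.:+ Z′.:0 Z′.:= a) refl Z′.[ n ]))

      connected-related : MultiplierRelated S T
      connected-related = extend-related sid (in-class S-class) (in-class T-class) Ss Ss+δ δ-unit lift′
        (Conjugates.PrimePowerCore.prime-power-related v′ pr (suc m) refl p∣v′ (restrict-sidon s sid) {δ} {Z′.[ 0 ]} Ss+δ S0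
          (subst U′.Unit (Z′.solve 1 (λ a → a Z′.:= a Z′.:- Z′.:0) refl δ) δ-unit)
          (restrict-iso sid (in-class S-class) (in-class T-class) Ss Ss+δ δ-unit f))

    -- Pass to the largest d = d₀ pⁱ modulo which both S and T are constant.
    congruent-related : ∀ m d → v ≡ d * p ^ m → ∀ {S T s t} → IsSidon S → IsSidon T → S s ≡ true → T t ≡ true →
      (∃ λ x → S x ≡ true × x ≢ s) → Congruent S s d → Congruent T t d → Iso S T [ 0 ] → MultiplierRelated S T
    congruent-related zero d v≡ {s = s} sidS sidT Ss Tt (x , Sx , x≢s) S-class T-class f =
      -- Now d = v, so S would consist of s alone.
      contradiction (trans (proj₂ (S-class x Sx)) (trans (cong (λ z → s ⊕ z ⊗ proj₁ (S-class x Sx)) d≡0)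
        (solve 2 (λ s y → s :+ :0 :* y := s) refl s (proj₁ (S-class x Sx))))) x≢s
      where
      d≡0 : [ d ] ≡ [ 0 ]
      d≡0 = []≡0 (subst (_∣ d) (sym (trans v≡ (ℕₚ.*-identityʳ d))) ∣-refl)
    congruent-related (suc m) d v≡ {S} {T} {s} {t} sidS sidT Ss Tt two S-class T-class f
      with congruent⊎ S s (d * p) | congruent⊎ T t (d * p)
    ... | inj₂ (x , Sx , x≢) | _ = connected-related m d v≡ sidS Ss S-class T-class Sx x≢ f
    ... | inj₁ _ | inj₂ (x , Tx , x≢) =
      related-sym (connected-related m d v≡ sidT Tt T-class S-class Tx x≢ (inverseⁱ f))
    ... | inj₁ S-class′ | inj₁ T-class′ =
      congruent-related m (d * p) (trans v≡ (sym (ℕₚ.*-assoc d p (p ^ m)))) sidS sidT Ss Tt two S-class′ T-class′ f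

  module _ {S T} (sidS : IsSidon S) (sidT : IsSidon T) {s t} (Ss : S s ≡ true) (Tt : T t ≡ true)
    (two : ∃ λ x → S x ≡ true × x ≢ s) (f : Iso S T [ 0 ]) where

    prime-power : ∀ {p n} → Prime p → v ≡ p ^ n → MultiplierRelated S T
    prime-power {p} {n} pr v≡ = congruent-related pr lift n 1 (trans v≡ (sym (ℕₚ.*-identityˡ (p ^ n))))
        sidS sidT Ss Tt two (λ x _ → everything s x) (λ x _ → everything t x) f
      where
      lift : ∀ m k → ¬ p ∣ k → ∃ λ l → Coprime (k + l * p ^ suc m) v
      lift m k p∤k = 0 , subst₂ Coprime (sym (ℕₚ.+-identityʳ k)) (sym v≡) (coprime-^ʳ (prime∤⇒coprime pr p∤k) n)
      everything : ∀ s x → ∃ λ y → x ≡ s ⊕ [ 1 ] ⊗ y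
      everything s x = x ⊝ s , solve 2 (λ x s → x := s :+ :1 :* (x :- s)) refl x s

    -- If S or T is not constant modulo p, the argument for two primes starts from that one.
    -- Otherwise division by p leaves the prime q, treated as a prime power.
    ordered-primes : ∀ {p q} → Prime p → Prime q → p < q → v ≡ p * q → MultiplierRelated S T
    ordered-primes {p} {q} pp pq p<q v≡ with congruent⊎ S s p | congruent⊎ T t p
    ... | inj₂ (x , Sx , x≢) | _ = TwoPrimes.Core.two-primes-related v pp pq p<q v≡ sidS Sx Ss (λ y e → x≢ y (shifted e)) f
      where
      shifted : ∀ {y} → x ⊝ s ≡ [ p ] ⊗ y → x ≡ s ⊕ [ p ] ⊗ y
      shifted e = trans (solve 2 (λ x s → x := s :+ (x :- s)) refl x s) (cong (s ⊕_) e)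
    ... | inj₁ _ | inj₂ (x , Tx , x≢) =
      related-sym (TwoPrimes.Core.two-primes-related v pp pq p<q v≡ sidT Tx Tt (λ y e → x≢ y (shifted e)) (inverseⁱ f))
      where
      shifted : ∀ {y} → x ⊝ t ≡ [ p ] ⊗ y → x ≡ t ⊕ [ p ] ⊗ y
      shifted e = trans (solve 2 (λ x s → x := s :+ (x :- s)) refl x t) (cong (t ⊕_) e)
    ... | inj₁ S-class | inj₁ T-class = congruent-related pq lift 1 p
        (trans v≡ (cong (p *_) (sym (ℕₚ.*-identityʳ q)))) sidS sidT Ss Tt two S-class T-class f
      where
      coprime-to-v : ∀ {k} → ¬ p ∣ k → ¬ q ∣ k → Coprime k v
      coprime-to-v p∤k q∤k = subst (Coprime _) (sym v≡) (coprime-*ʳ (prime∤⇒coprime pp p∤k) (prime∤⇒coprime pq q∤k))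
      lift : ∀ m k → ¬ q ∣ k → ∃ λ l → Coprime (k + l * q ^ suc m) v
      lift m k q∤k with p ∣? k
      ... | no  p∤k = 0 , coprime-to-v (λ p∣ → p∤k (subst (p ∣_) (ℕₚ.+-identityʳ k) p∣)) (λ q∣ → q∤k (subst (q ∣_) (ℕₚ.+-identityʳ k) q∣))
      -- Adding a power of q, prime to p, removes the factor p without changing the residue modulo
      -- that power.
      ... | yes p∣k = 1 , coprime-to-v
          (λ p∣ → ¬prime[1] (subst Prime (coprime-^ʳ (prime∤⇒coprime pq q∤p) (suc m)
            (∣-refl , subst (p ∣_) (ℕₚ.*-identityˡ (q ^ suc m)) (∣m+n∣m⇒∣n p∣ p∣k))) pp))
          (λ q∣ → q∤k (∣m+n∣m⇒∣n (subst (q ∣_) (ℕₚ.+-comm k (1 * q ^ suc m)) q∣) (∣n⇒∣m*n 1 (m∣m*n (q ^ m)))))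
        where
        q∤p : ¬ q ∣ p
        q∤p q∣p = ℕₚ.<⇒≱ p<q (∣⇒≤ {{prime⇒nonZero pp}} q∣p)

    two-primes : ∀ {p q} → Prime p → Prime q → v ≡ p * q → MultiplierRelated S T
    two-primes {p} {q} pp pq v≡ with ℕₚ.<-cmp p q
    ... | tri< p<q _ _ = ordered-primes pp pq p<q v≡
    ... | tri≈ _ refl _ = prime-power {p} {2} pp (trans v≡ (cong (p *_) (sym (ℕₚ.*-identityʳ p))))
    ... | tri> _ _ q<p = ordered-primes pq pp q<p (trans v≡ (ℕₚ.*-comm p q))

-- Base lines of cyclic configurations

∣p∣≤1⇒≡ : ∀ {n} {s : Subset n} {x y} → card s ≤ 1 → x ∈ₛ s → y ∈ₛ s → x ≡ y
∣p∣≤1⇒≡ {s = s} {x} {y} le x∈ y∈ with x Finₚ.≟ y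
... | yes x≡y = x≡y
... | no  x≢y = contradiction (ℕₚ.≤-trans (x∈p⇒∣p-x∣<∣p∣ x∈) le) (ℕₚ.<⇒≱ (s≤s 1≤))
  where
  1≤ : 1 ≤ card (s - x)
  1≤ = subst (_≤ card (s - x)) (∣⁅x⁆∣≡1 y) (p⊆q⇒∣p∣≤∣q∣ λ z∈ →
    subst (_∈ₛ s - x) (sym (x∈⁅y⁆⇒x≡y y z∈)) (x∈p∧x≢y⇒x∈p-y y∈ (λ y≡x → x≢y (sym y≡x))))

threeDistinct : ∀ {A : Set} (xs : List A) → Unique xs → 3 ≤ length xs →
  ∃ λ a → ∃ λ b → ∃ λ c → (a ∈ xs × b ∈ xs × c ∈ xs) × (a ≢ b × a ≢ c × b ≢ c)
threeDistinct (a ∷ b ∷ c ∷ _) ((a≢b ∷ a≢c ∷ _) ∷ (b≢c ∷ _) ∷ _) _ =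
  a , b , c , (here refl , there (here refl) , there (there (here refl))) , (a≢b , a≢c , b≢c)
threeDistinct (_ ∷ []) _ (s≤s ())
threeDistinct (_ ∷ _ ∷ []) _ (s≤s (s≤s ()))

module CyclicConfigurations (v : ℕ) .{{_ : NonZero v}} where

  open ZMod v
  open Units v
  open Development v
  open Sidon v
  open InjectiveIso v

  -- The subgroup generated by h ≠ 0 contains the subgroup of order p or that of order q.
  minimal-multiple : ∀ {p q} ((_ , p∣v) : Prime p × p ∣ v) ((_ , q∣v) : Prime q × q ∣ v) →
    (∀ x → ¬ p ∣ x → ¬ q ∣ x → Coprime x v) → ∀ h → h ≢ [ 0 ] →
    ∃ λ c → h ⊗ c ≡ [ quotient p∣v ] ⊎ h ⊗ c ≡ [ quotient q∣v ]
  minimal-multiple {p} {q} (pp , p∣v) (pq , q∣v) cover h h≢0 = conclude (p ∣? e) (q ∣? e)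
    where
    open ≡-Reasoning
    g : ℕ
    g = gcd (toℕ h) v
    -- The additive order v / gcd (h, v) of h; a prime r dividing it makes v / r a multiple of h.
    e : ℕ
    e = quotient (gcd[m,n]∣n (toℕ h) v)
    v≡eg : v ≡ e * g
    v≡eg = _∣_.equality (gcd[m,n]∣n (toℕ h) v)
    e∣v : e ∣ v
    e∣v = subst (e ∣_) (sym v≡eg) (m∣m*n g)
    e≢1 : e ≢ 1
    e≢1 e≡1 = h≢0 (trans (sym ([]-toℕ h)) ([]≡0 (subst (_∣ toℕ h)
      (sym (trans v≡eg (trans (cong (_* g) e≡1) (ℕₚ.*-identityˡ g)))) (gcd[m,n]∣m (toℕ h) v))))
    reach : ∀ {r} → Prime r → (r∣v : r ∣ v) → r ∣ e → ∃ λ c → h ⊗ c ≡ [ quotient r∣v ]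
    reach {r} pr r∣v (divides e′ e≡) = proj₁ (multiple-gcd (toℕ h)) ⊗ [ e′ ] , (begin
      h ⊗ (proj₁ (multiple-gcd (toℕ h)) ⊗ [ e′ ])             ≡⟨ sym (⊗-assoc h _ _) ⟩
      h ⊗ proj₁ (multiple-gcd (toℕ h)) ⊗ [ e′ ]               ≡⟨ cong (λ z → z ⊗ proj₁ (multiple-gcd (toℕ h)) ⊗ [ e′ ]) (sym ([]-toℕ h)) ⟩
      [ toℕ h ] ⊗ proj₁ (multiple-gcd (toℕ h)) ⊗ [ e′ ]       ≡⟨ cong (_⊗ [ e′ ]) (proj₂ (multiple-gcd (toℕ h))) ⟩
      [ g ] ⊗ [ e′ ]                                   ≡⟨ sym ([]-* g e′) ⟩
      [ g * e′ ]                                       ≡⟨ cong [_] (ℕₚ.*-cancelʳ-≡ (g * e′) (quotient r∣v) r {{prime⇒nonZero pr}} ge′r≡) ⟩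
      [ quotient r∣v ]                                 ∎)
      where
      ge′r≡ : g * e′ * r ≡ quotient r∣v * r
      ge′r≡ = begin
        g * e′ * r            ≡⟨ ℕₚ.*-assoc g e′ r ⟩
        g * (e′ * r)          ≡⟨ cong (g *_) (sym e≡) ⟩
        g * e                 ≡⟨ ℕₚ.*-comm g e ⟩
        e * g                 ≡⟨ sym v≡eg ⟩
        v                     ≡⟨ _∣_.equality r∣v ⟩
        quotient r∣v * r      ∎
    conclude : Dec (p ∣ e) → Dec (q ∣ e) → ∃ λ c → h ⊗ c ≡ [ quotient p∣v ] ⊎ h ⊗ c ≡ [ quotient q∣v ]
    conclude (yes p∣e) _         = proj₁ (reach pp p∣v p∣e) , inj₁ (proj₂ (reach pp p∣v p∣e))
    conclude (no _)    (yes q∣e) = proj₁ (reach pq q∣v q∣e) , inj₂ (proj₂ (reach pq q∣v q∣e))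
    conclude (no p∤e)  (no q∤e)  = contradiction (cover e p∤e q∤e (∣-refl , e∣v)) e≢1

  [quotient]≢0 : ∀ {p} → Prime p → (p∣v : p ∣ v) → [ quotient p∣v ] ≢ [ 0 ]
  [quotient]≢0 {p} pr p∣v e = contradiction (subst Prime p≡1 pr) ¬prime[1]
    where
    w : ℕ
    w = quotient p∣v
    w-nonZero : NonZero w
    w-nonZero = ℕₚ.m*n≢0⇒m≢0 w {{subst NonZero (_∣_.equality p∣v) (nonZero v)}}
    p≡1 : p ≡ 1
    p≡1 = ∣1⇒≡1 (*-cancelˡ-∣ w {{w-nonZero}} (subst₂ _∣_ (_∣_.equality p∣v) (sym (ℕₚ.*-identityʳ w)) ([]≡0⇒∣ e)))

  shift≡ : ∀ x → shift x ≡ x ⊕ [ 1 ]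
  shift≡ x = trans ([]-mod (toℕ x + 1)) (trans ([]-+ (toℕ x) 1) (cong (_⊕ [ 1 ]) ([]-toℕ x)))

  mulBy≡ : ∀ a x → mulBy a x ≡ a ⊗ x
  mulBy≡ a x = ⊗-mod a x

  image⇒lookup : ∀ (f : Fin v → Fin v) (ℓ ℓ′ : Subset v) → (∀ {x y} → f x ≡ f y → x ≡ y) → IsImage f ℓ ℓ′ → ∀ x → lookup ℓ x ≡ lookup ℓ′ (f x)
  image⇒lookup f ℓ ℓ′ f-inj im x = ≡-by-truth
    (λ x∈ → []=⇒lookup (Equivalence.from (im (f x)) (x , lookup⇒[]= x ℓ x∈ , refl)))
    (λ fx∈ → preimage (Equivalence.to (im (f x)) (lookup⇒[]= (f x) ℓ′ fx∈)))
    where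
    preimage : (∃ λ y → y ∈ₛ ℓ × f y ≡ f x) → lookup ℓ x ≡ true
    preimage (y , y∈ , e) = trans (cong (lookup ℓ) (sym (f-inj e))) ([]=⇒lookup y∈)

  lookup⇒image : ∀ (f g : Fin v → Fin v) (ℓ ℓ′ : Subset v) → (∀ y → f (g y) ≡ y) → (∀ x → lookup ℓ x ≡ lookup ℓ′ (f x)) → IsImage f ℓ ℓ′
  lookup⇒image f g ℓ ℓ′ f-g eq y = mk⇔
    (λ y∈ → g y , lookup⇒[]= (g y) ℓ (trans (eq (g y)) (trans (cong (lookup ℓ′) (f-g y)) ([]=⇒lookup y∈))) , f-g y)
    (λ { (x , x∈ , refl) → lookup⇒[]= (f x) ℓ′ (trans (sym (eq x)) ([]=⇒lookup x∈)) })

  record BaseLine (C : Config v) : Set where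
    field
      base     : Line
      isSidon  : IsSidon base
      ∋0       : base [ 0 ] ≡ true
      ∋another : ∃ λ x → base x ≡ true × x ≢ [ 0 ]
      translate : ∀ i → ∃ λ ℓ → ℓ ∈ lines C × (∀ x → lookup ℓ x ≡ base (x ⊝ i))
      covers    : ∀ {ℓ} → ℓ ∈ lines C → ∃ λ i → ∀ x → lookup ℓ x ≡ base (x ⊝ i)

  module _ (C : Config v) (cyclic : IsCyclic C) where

    private
      shift-injective : ∀ {x y : Fin v} → shift x ≡ shift y → x ≡ y
      shift-injective = proj₁ (proj₁ cyclic)

      translate-by : ∀ {ℓ} → ℓ ∈ lines C → ∀ n → ∃ λ ℓ′ → ℓ′ ∈ lines C × (∀ x → lookup ℓ′ x ≡ lookup ℓ (x ⊝ [ n ]))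
      translate-by {ℓ} ℓ∈ zero = ℓ , ℓ∈ , λ x → cong (lookup ℓ) (solve 1 (λ x → x := x :- :0) refl x)
      translate-by {ℓ} ℓ∈ (suc n) = proj₁ next , proj₁ (proj₂ next) , λ x → begin
        lookup (proj₁ next) x                          ≡⟨ cong (lookup (proj₁ next)) (trans (solve 1 (λ x → x := x :- :1 :+ :1) refl x) (sym (shift≡ (x ⊝ [ 1 ])))) ⟩
        lookup (proj₁ next) (shift (x ⊝ [ 1 ]))        ≡⟨ sym (image⇒lookup shift (proj₁ previous) (proj₁ next) shift-injective (proj₂ (proj₂ next)) (x ⊝ [ 1 ])) ⟩
        lookup (proj₁ previous) (x ⊝ [ 1 ])            ≡⟨ proj₂ (proj₂ previous) (x ⊝ [ 1 ]) ⟩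
        lookup ℓ (x ⊝ [ 1 ] ⊝ [ n ])                   ≡⟨ cong (lookup ℓ) (solve 2 (λ x n → x :- :1 :- n := x :- (:1 :+ n)) refl x [ n ]) ⟩
        lookup ℓ (x ⊝ ([ 1 ] ⊕ [ n ]))                 ≡⟨ cong (λ z → lookup ℓ (x ⊝ z)) (sym ([]-+ 1 n)) ⟩
        lookup ℓ (x ⊝ [ suc n ])                       ∎
        where
        open ≡-Reasoning
        previous : ∃ λ ℓ′ → ℓ′ ∈ lines C × (∀ x → lookup ℓ′ x ≡ lookup ℓ (x ⊝ [ n ]))
        previous = translate-by ℓ∈ n
        next : ∃ λ ℓ′ → ℓ′ ∈ lines C × IsImage shift (proj₁ previous) ℓ′
        next = proj₁ (proj₂ cyclic) (proj₁ (proj₂ previous))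

      meet-twice⇒≡ : ∀ {ℓ₁ ℓ₂ x y} → ℓ₁ ∈ lines C → ℓ₂ ∈ lines C → ℓ₁ ≢ ℓ₂ →
        lookup ℓ₁ x ≡ true → lookup ℓ₂ x ≡ true → lookup ℓ₁ y ≡ true → lookup ℓ₂ y ≡ true → x ≡ y
      meet-twice⇒≡ {ℓ₁} {ℓ₂} {x} {y} ∈₁ ∈₂ ℓ₁≢ℓ₂ x₁ x₂ y₁ y₂ = ∣p∣≤1⇒≡ (meetAtMost1 C ∈₁ ∈₂ ℓ₁≢ℓ₂)
        (x∈p∩q⁺ (lookup⇒[]= x ℓ₁ x₁ , lookup⇒[]= x ℓ₂ x₂)) (x∈p∩q⁺ (lookup⇒[]= y ℓ₁ y₁ , lookup⇒[]= y ℓ₂ y₂))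

      Symmetric : Subset v → Set
      Symmetric ℓ = ∃ λ h → h ≢ [ 0 ] × (∀ x → lookup ℓ x ≡ lookup ℓ (x ⊝ h))

      symmetric? : ∀ ℓ → Dec (Symmetric ℓ)
      symmetric? ℓ = Finₚ.any? λ h → ¬? (h Finₚ.≟ [ 0 ]) ×-dec Finₚ.all? λ x → lookup ℓ x Boolₚ.≟ lookup ℓ (x ⊝ h)

      symmetric-∋multiples : ∀ {ℓ} → lookup ℓ [ 0 ] ≡ true → ∀ h → (∀ x → lookup ℓ x ≡ lookup ℓ (x ⊝ h)) →
        ∀ c → lookup ℓ (h ⊗ c) ≡ true
      symmetric-∋multiples {ℓ} ∋0 h inv c = subst (λ c → lookup ℓ (h ⊗ c) ≡ true) ([]-toℕ c) (go (toℕ c))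
        where
        go : ∀ n → lookup ℓ (h ⊗ [ n ]) ≡ true
        go zero    = trans (cong (lookup ℓ) (solve 1 (λ h → h :* :0 := :0) refl h)) ∋0
        go (suc n) = trans (inv _) (trans (cong (lookup ℓ) (trans (cong (λ z → h ⊗ z ⊝ h) ([]-+ 1 n))
          (solve 2 (λ h n → h :* (:1 :+ n) :- h := h :* n) refl h [ n ]))) (go n))

    -- For a prime power the two primes are equal. `cover` says that v has no further prime
    -- divisors.
    module _ {p q} (pp : Prime p × p ∣ v) (pq : Prime q × q ∣ v) (cover : ∀ x → ¬ p ∣ x → ¬ q ∣ x → Coprime x v) where

      private
        M₁ M₂ : Fin v
        M₁ = [ quotient (proj₂ pp) ]
        M₂ = [ quotient (proj₂ pq) ]

        symmetric-∋ : ∀ {ℓ} → lookup ℓ [ 0 ] ≡ true → Symmetric ℓ → lookup ℓ M₁ ≡ true ⊎ lookup ℓ M₂ ≡ true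
        symmetric-∋ {ℓ} ∋0 (h , h≢0 , inv) with minimal-multiple pp pq cover h h≢0
        ... | c , inj₁ e = inj₁ (subst (λ z → lookup ℓ z ≡ true) e (symmetric-∋multiples {ℓ} ∋0 h inv c))
        ... | c , inj₂ e = inj₂ (subst (λ z → lookup ℓ z ≡ true) e (symmetric-∋multiples {ℓ} ∋0 h inv c))

        -- If three lines through 0 were symmetric, two of them would share `M₁` or `M₂` besides 0.
        asymmetric-line : ∃ λ ℓ → ℓ ∈ lines C × lookup ℓ [ 0 ] ≡ true × ¬ Symmetric ℓ
        asymmetric-line = choose (threeDistinct through0 (Uniqueₚ.filter⁺ ([ 0 ] ∈ₛ?_) (Config.distinct C))
            (subst (3 ≤_) (sym (pointDeg C [ 0 ])) (k≥3 C)))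
          where
          through0 : List (Subset v)
          through0 = filter ([ 0 ] ∈ₛ?_) (lines C)
          in-lines : ∀ {ℓ} → ℓ ∈ through0 → ℓ ∈ lines C
          in-lines ℓ∈ = proj₁ (∈-filter⁻ ([ 0 ] ∈ₛ?_) ℓ∈)
          on0 : ∀ {ℓ} → ℓ ∈ through0 → lookup ℓ [ 0 ] ≡ true
          on0 ℓ∈ = []=⇒lookup (proj₂ (∈-filter⁻ ([ 0 ] ∈ₛ?_) {xs = lines C} ℓ∈))
          clash : ∀ {ℓ₁ ℓ₂ m} → m ≢ [ 0 ] → ℓ₁ ∈ through0 → ℓ₂ ∈ through0 → ℓ₁ ≢ ℓ₂ →
            lookup ℓ₁ m ≡ true → lookup ℓ₂ m ≡ true → ⊥
          clash m≢0 ∈₁ ∈₂ ne m₁ m₂ = m≢0 (meet-twice⇒≡ (in-lines ∈₁) (in-lines ∈₂) ne m₁ m₂ (on0 ∈₁) (on0 ∈₂))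
          M₁≢0 : M₁ ≢ [ 0 ]
          M₁≢0 = [quotient]≢0 (proj₁ pp) (proj₂ pp)
          M₂≢0 : M₂ ≢ [ 0 ]
          M₂≢0 = [quotient]≢0 (proj₁ pq) (proj₂ pq)
          absurd : ∀ {a b c} → a ∈ through0 → b ∈ through0 → c ∈ through0 → a ≢ b → a ≢ c → b ≢ c →
            lookup a M₁ ≡ true ⊎ lookup a M₂ ≡ true → lookup b M₁ ≡ true ⊎ lookup b M₂ ≡ true →
            lookup c M₁ ≡ true ⊎ lookup c M₂ ≡ true → ⊥
          absurd a∈ b∈ c∈ a≢b a≢c b≢c (inj₁ x) (inj₁ y) _        = clash M₁≢0 a∈ b∈ a≢b x y
          absurd a∈ b∈ c∈ a≢b a≢c b≢c (inj₂ x) (inj₂ y) _        = clash M₂≢0 a∈ b∈ a≢b x y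
          absurd a∈ b∈ c∈ a≢b a≢c b≢c (inj₁ x) (inj₂ _) (inj₁ z) = clash M₁≢0 a∈ c∈ a≢c x z
          absurd a∈ b∈ c∈ a≢b a≢c b≢c (inj₂ x) (inj₁ _) (inj₂ z) = clash M₂≢0 a∈ c∈ a≢c x z
          absurd a∈ b∈ c∈ a≢b a≢c b≢c (inj₁ _) (inj₂ y) (inj₂ z) = clash M₂≢0 b∈ c∈ b≢c y z
          absurd a∈ b∈ c∈ a≢b a≢c b≢c (inj₂ _) (inj₁ y) (inj₁ z) = clash M₁≢0 b∈ c∈ b≢c y z
          choose : (∃ λ a → ∃ λ b → ∃ λ c → (a ∈ through0 × b ∈ through0 × c ∈ through0) × (a ≢ b × a ≢ c × b ≢ c)) →
            ∃ λ ℓ → ℓ ∈ lines C × lookup ℓ [ 0 ] ≡ true × ¬ Symmetric ℓ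
          choose (a , b , c , (a∈ , b∈ , c∈) , (a≢b , a≢c , b≢c)) with symmetric? a | symmetric? b | symmetric? c
          ... | no ¬a | _     | _     = a , in-lines a∈ , on0 a∈ , ¬a
          ... | yes _ | no ¬b | _     = b , in-lines b∈ , on0 b∈ , ¬b
          ... | yes _ | yes _ | no ¬c = c , in-lines c∈ , on0 c∈ , ¬c
          ... | yes A | yes B | yes C = ⊥-elim (absurd a∈ b∈ c∈ a≢b a≢c b≢c
            (symmetric-∋ {a} (on0 a∈) A) (symmetric-∋ {b} (on0 b∈) B) (symmetric-∋ {c} (on0 c∈) C))

        ℓ₀ : Subset v
        ℓ₀ = proj₁ asymmetric-line

        ℓ₀∈ : ℓ₀ ∈ lines C
        ℓ₀∈ = proj₁ (proj₂ asymmetric-line)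

        S : Line
        S = lookup ℓ₀

        S0 : S [ 0 ] ≡ true
        S0 = proj₁ (proj₂ (proj₂ asymmetric-line))

        S-asymmetric : ∀ h → (∀ x → S x ≡ S (x ⊝ h)) → h ≡ [ 0 ]
        S-asymmetric h inv = decidable-stable (h Finₚ.≟ [ 0 ]) λ h≢0 → proj₂ (proj₂ (proj₂ asymmetric-line)) (h , h≢0 , inv)

        translated : ∀ i → ∃ λ ℓ → ℓ ∈ lines C × (∀ x → lookup ℓ x ≡ S (x ⊝ i))
        translated i = proj₁ by , proj₁ (proj₂ by) , λ x → trans (proj₂ (proj₂ by) x) (cong (λ z → S (x ⊝ z)) ([]-toℕ i))
          where
          by : ∃ λ ℓ → ℓ ∈ lines C × (∀ x → lookup ℓ x ≡ S (x ⊝ [ toℕ i ]))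
          by = translate-by ℓ₀∈ (toℕ i)

        index : Fin v → Fin (length (lines C))
        index i = Any.index (proj₁ (proj₂ (translated i)))

        index-line : ∀ i → proj₁ (translated i) ≡ List.lookup (lines C) (index i)
        index-line i = Anyₚ.lookup-index (proj₁ (proj₂ (translated i)))

        translated-injective : ∀ {i j} → proj₁ (translated i) ≡ proj₁ (translated j) → i ≡ j
        translated-injective {i} {j} e = sym (⊝≡0⇒≡ (S-asymmetric (j ⊝ i) λ x → begin
          S x                                   ≡⟨ cong S (solve 2 (λ x i → x := x :+ i :- i) refl x i) ⟩
          S (x ⊕ i ⊝ i)                         ≡⟨ sym (proj₂ (proj₂ (translated i)) (x ⊕ i)) ⟩
          lookup (proj₁ (translated i)) (x ⊕ i) ≡⟨ cong (λ ℓ → lookup ℓ (x ⊕ i)) e ⟩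
          lookup (proj₁ (translated j)) (x ⊕ i) ≡⟨ proj₂ (proj₂ (translated j)) (x ⊕ i) ⟩
          S (x ⊕ i ⊝ j)                         ≡⟨ cong S (solve 3 (λ x i j → x :+ i :- j := x :- (j :- i)) refl x i j) ⟩
          S (x ⊝ (j ⊝ i))                       ∎))
          where open ≡-Reasoning

        index-injective : ∀ {i j} → index i ≡ index j → i ≡ j
        index-injective {i} {j} e = translated-injective
          (trans (index-line i) (trans (cong (List.lookup (lines C)) e) (sym (index-line j))))

        -- The v translates have distinct positions in a list of length v, so they fill it.
        covered : ∀ {ℓ} → ℓ ∈ lines C → ∃ λ i → ∀ x → lookup ℓ x ≡ S (x ⊝ i)
        covered {ℓ} ℓ∈ = i , λ x → trans (cong (λ ℓ → lookup ℓ x) ℓ≡) (proj₂ (proj₂ (translated i)) x)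
          where
          hit : ∃ λ i → index i ≡ Any.index ℓ∈
          hit = injective⇒surjective (ℕₚ.≤-reflexive (numLines C)) index-injective (Any.index ℓ∈)
          i : Fin v
          i = proj₁ hit
          ℓ≡ : ℓ ≡ proj₁ (translated i)
          ℓ≡ = trans (Anyₚ.lookup-index ℓ∈) (trans (cong (List.lookup (lines C)) (sym (proj₂ hit))) (sym (index-line i)))

        -- With h = a - b = c - d, both a and c lie on S and on its translate by h, and these are
        -- different lines as S has no symmetry.
        S-sidon : IsSidon S
        S-sidon = sidon λ {a} {b} {c} {d} Sa Sb Sc Sd e a≢b →
          let h = a ⊝ b in
          meet-twice⇒≡ ℓ₀∈ (proj₁ (proj₂ (translated h)))
            (λ ℓ₀≡ → a≢b (⊝≡0⇒≡ (S-asymmetric h λ x → trans (cong (λ ℓ → lookup ℓ x) ℓ₀≡) (proj₂ (proj₂ (translated h)) x))))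
            Sa (trans (proj₂ (proj₂ (translated h)) a) (trans (cong S (solve 2 (λ a b → a :- (a :- b) := b) refl a b)) Sb))
            Sc (trans (proj₂ (proj₂ (translated h)) c) (trans (cong S (trans (cong (c ⊝_) e) (solve 2 (λ a b → a :- (a :- b) := b) refl c d))) Sd))

        another : ∃ λ x → S x ≡ true × x ≢ [ 0 ]
        another = decidable-stable (Finₚ.any? λ x → (S x Boolₚ.≟ true) ×-dec ¬? (x Finₚ.≟ [ 0 ])) λ none →
          contradiction (ℕₚ.≤-trans (k≥3 C) (ℕₚ.≤-trans (ℕₚ.≤-reflexive (sym (lineSize C ℓ₀∈)))
            (ℕₚ.≤-trans (p⊆q⇒∣p∣≤∣q∣ {p = ℓ₀} {q = ⁅ [ 0 ] ⁆} λ {x} x∈ → subst (_∈ₛ ⁅ [ 0 ] ⁆)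
              (sym (decidable-stable (x Finₚ.≟ [ 0 ]) λ x≢0 → none (x , []=⇒lookup x∈ , x≢0))) (x∈⁅x⁆ [ 0 ]))
              (ℕₚ.≤-reflexive (∣⁅x⁆∣≡1 [ 0 ]))))) λ { (s≤s ()) }

      baseLine : BaseLine C
      baseLine = record { base = S ; isSidon = S-sidon ; ∋0 = S0 ; ∋another = another
                        ; translate = translated ; covers = covered }

  module _ {C₁ C₂ : Config v} (B₁ : BaseLine C₁) (B₂ : BaseLine C₂) where

    open BaseLine

    isomorphic⇒iso : Isomorphic C₁ C₂ → Iso (base B₁) (base B₂) [ 0 ]
    isomorphic⇒iso (f , (f-inj , _) , image , _) = injective⇒iso (isSidon B₁) (∋0 B₁) f f-inj preserves
      where
      preserves : PreservesLines (base B₁) (base B₂) f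
      preserves i = proj₁ line′ , λ x → trans (sym (proj₂ (proj₂ line) x))
          (trans (image⇒lookup f (proj₁ line) (proj₁ im) f-inj (proj₂ (proj₂ im)) x) (proj₂ line′ (f x)))
        where
        line : ∃ λ ℓ → ℓ ∈ lines C₁ × (∀ x → lookup ℓ x ≡ base B₁ (x ⊝ i))
        line = translate B₁ i
        im : ∃ λ ℓ′ → ℓ′ ∈ lines C₂ × IsImage f (proj₁ line) ℓ′
        im = image (proj₁ (proj₂ line))
        line′ : ∃ λ j → ∀ x → lookup (proj₁ im) x ≡ base B₂ (x ⊝ j)
        line′ = covers B₂ (proj₁ (proj₂ im))

    -- Multiplication by b carries line i of the first configuration to line b i - c of the second,
    -- so the numbering of the lines absorbs c.
    related⇒multiplierEquivalent : MultiplierRelated (base B₁) (base B₂) → MultiplierEquivalent C₁ C₂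
    related⇒multiplierEquivalent (b , (b′ , bb′≡1) , c , rel) =
        b , unit⇒coprime (b′ , bb′≡1) , (injective , surjective) , forward , backward
      where
      open ≡-Reasoning
      b-b′ : ∀ y → mulBy b (b′ ⊗ y) ≡ y
      b-b′ y = begin
        mulBy b (b′ ⊗ y)    ≡⟨ mulBy≡ b (b′ ⊗ y) ⟩
        b ⊗ (b′ ⊗ y)        ≡⟨ sym (⊗-assoc b b′ y) ⟩
        b ⊗ b′ ⊗ y          ≡⟨ cong (_⊗ y) bb′≡1 ⟩
        [ 1 ] ⊗ y           ≡⟨ ⊗-identityˡ y ⟩
        y                   ∎
      injective : ∀ {x y} → mulBy b x ≡ mulBy b y → x ≡ y
      injective {x} {y} e = trans (sym (undo x)) (trans (cong (b′ ⊗_) e) (undo y))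
        where
        undo : ∀ x → b′ ⊗ mulBy b x ≡ x
        undo x = trans (cong (b′ ⊗_) (mulBy≡ b x)) (trans (solve 3 (λ b′ b x → b′ :* (b :* x) := b :* b′ :* x) refl b′ b x)
          (trans (cong (_⊗ x) bb′≡1) (⊗-identityˡ x)))
      surjective : ∀ y → ∃ λ x → ∀ {z} → z ≡ x → mulBy b z ≡ y
      surjective y = b′ ⊗ y , λ { refl → b-b′ y }
      image : ∀ (ℓ ℓ′ : Subset v) i j → b ⊗ i ⊝ c ≡ j → (∀ x → lookup ℓ x ≡ base B₁ (x ⊝ i)) →
        (∀ x → lookup ℓ′ x ≡ base B₂ (x ⊝ j)) → IsImage (mulBy b) ℓ ℓ′
      image ℓ ℓ′ i j ij eq eq′ = lookup⇒image (mulBy b) (b′ ⊗_) ℓ ℓ′ b-b′ λ x → begin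
        lookup ℓ x                             ≡⟨ eq x ⟩
        base B₁ (x ⊝ i)                        ≡⟨ rel (x ⊝ i) ⟩
        base B₂ (b ⊗ (x ⊝ i) ⊕ c)              ≡⟨ cong (base B₂) (solve 4 (λ b x i c → b :* (x :- i) :+ c := b :* x :- (b :* i :- c)) refl b x i c) ⟩
        base B₂ (b ⊗ x ⊝ (b ⊗ i ⊝ c))          ≡⟨ cong₂ (λ y k → base B₂ (y ⊝ k)) (sym (mulBy≡ b x)) ij ⟩
        base B₂ (mulBy b x ⊝ j)                ≡⟨ sym (eq′ (mulBy b x)) ⟩
        lookup ℓ′ (mulBy b x)                  ∎
      forward : ∀ {ℓ} → ℓ ∈ lines C₁ → ∃ λ ℓ′ → ℓ′ ∈ lines C₂ × IsImage (mulBy b) ℓ ℓ′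
      forward {ℓ} ℓ∈ = proj₁ line , proj₁ (proj₂ line) , image ℓ (proj₁ line) i _ refl (proj₂ (covers B₁ ℓ∈)) (proj₂ (proj₂ line))
        where
        i = proj₁ (covers B₁ ℓ∈)
        line = translate B₂ (b ⊗ i ⊝ c)
      backward : ∀ {ℓ′} → ℓ′ ∈ lines C₂ → ∃ λ ℓ → ℓ ∈ lines C₁ × IsImage (mulBy b) ℓ ℓ′
      backward {ℓ′} ℓ′∈ = proj₁ line , proj₁ (proj₂ line) , image (proj₁ line) ℓ′ _ j ij (proj₂ (proj₂ line)) (proj₂ (covers B₂ ℓ′∈))
        where
        j = proj₁ (covers B₂ ℓ′∈)
        line = translate B₁ (b′ ⊗ (j ⊕ c))
        ij : b ⊗ (b′ ⊗ (j ⊕ c)) ⊝ c ≡ j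
        ij = trans (solve 4 (λ b b′ j c → b :* (b′ :* (j :+ c)) :- c := b :* b′ :* (j :+ c) :- c) refl b b′ j c)
          (trans (cong (λ z → z ⊗ (j ⊕ c) ⊝ c) bb′≡1) (solve 2 (λ j c → :1 :* (j :+ c) :- c := j) refl j c))

  isomorphic⇒multiplierEquivalent :
    (∃ λ p → ∃ λ q → Prime p × Prime q × v ≡ p * q) ⊎ (∃ λ p → ∃ λ n → Prime p × n ≥ 1 × v ≡ p ^ n) →
    (C₁ C₂ : Config v) → IsCyclic C₁ → IsCyclic C₂ → Isomorphic C₁ C₂ → MultiplierEquivalent C₁ C₂
  isomorphic⇒multiplierEquivalent (inj₁ (p , q , pp , pq , v≡)) C₁ C₂ cyc₁ cyc₂ f =
    related⇒multiplierEquivalent B₁ B₂ (Classification.two-primes v (isSidon B₁) (isSidon B₂) (∋0 B₁) (∋0 B₂) (∋another B₁)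
      (isomorphic⇒iso B₁ B₂ f) pp pq v≡)
    where
    open BaseLine
    p∣v : p ∣ v
    p∣v = subst (p ∣_) (sym v≡) (m∣m*n q)
    q∣v : q ∣ v
    q∣v = subst (q ∣_) (sym v≡) (n∣m*n p)
    cover : ∀ x → ¬ p ∣ x → ¬ q ∣ x → Coprime x v
    cover x p∤x q∤x = subst (Coprime x) (sym v≡) (coprime-*ʳ (prime∤⇒coprime pp p∤x) (prime∤⇒coprime pq q∤x))
    B₁ : BaseLine C₁
    B₁ = baseLine C₁ cyc₁ (pp , p∣v) (pq , q∣v) cover
    B₂ : BaseLine C₂
    B₂ = baseLine C₂ cyc₂ (pp , p∣v) (pq , q∣v) cover
  isomorphic⇒multiplierEquivalent (inj₂ (p , suc n , pp , _ , v≡)) C₁ C₂ cyc₁ cyc₂ f =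
    related⇒multiplierEquivalent B₁ B₂ (Classification.prime-power v (isSidon B₁) (isSidon B₂) (∋0 B₁) (∋0 B₂) (∋another B₁)
      (isomorphic⇒iso B₁ B₂ f) {p} {suc n} pp v≡)
    where
    open BaseLine
    p∣v : p ∣ v
    p∣v = subst (p ∣_) (sym v≡) (m∣m*n (p ^ n))
    cover : ∀ x → ¬ p ∣ x → ¬ p ∣ x → Coprime x v
    cover x p∤x _ = subst (Coprime x) (sym v≡) (coprime-^ʳ (prime∤⇒coprime pp p∤x) (suc n))
    B₁ : BaseLine C₁
    B₁ = baseLine C₁ cyc₁ (pp , p∣v) (pp , p∣v) cover
    B₂ : BaseLine C₂
    B₂ = baseLine C₂ cyc₂ (pp , p∣v) (pp , p∣v) cover

theoremB : ∀ (v : ℕ) .{{_ : NonZero v}}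
    → ((∃ λ p → ∃ λ q → Prime p × Prime q × v ≡ p * q)
    ⊎ (∃ λ p → ∃ λ n → Prime p × n ≥ 1 × v ≡ p ^ n))
    → (C₁ C₂ : Config v) → IsCyclic C₁ → IsCyclic C₂
    → Isomorphic C₁ C₂ ⇔ MultiplierEquivalent C₁ C₂
theoremB v shape C₁ C₂ cyc₁ cyc₂ = mk⇔
  (CyclicConfigurations.isomorphic⇒multiplierEquivalent v shape C₁ C₂ cyc₁ cyc₂)
  (λ (a , _ , a-iso) → mulBy a , a-iso)
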